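{- For all $n \geq 0$, $$p_{\xi}(4n+2) \equiv \begin{cases} 2(-1)^k \pmod{4}, & \text{if } n=6k(3k-1) \text{ for some integer } k,\\ 0 \pmod{4}, & \text{otherwise}.\end{cases}$$
   Context: $(a;q)_n=(1-a)(1-aq)\cdots(1-aq^{n-1})$, $(a;q)_0=1$. The coefficients $p_\xi(n)$ are defined by $\sum_{n\ge0}p_\xi(n)q^n=\xi(q)=1+2\sum_{n\ge1}\frac{q^{6n^2-6n+1}}{(q;q^6)_n(q^5;q^6)_n}$. -}

module Defs where

open import Data.Nat as ℕ using (ℕ; zero; suc; _≤?_; _∸_)
open import Data.Nat.Divisibility using (_∣?_)
open import Data.Integer using (ℤ; +_; _+_; _*_; -_)
open import Data.Bool using (if_then_else_)
open import Relation.Nullary.Decidable using (does)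

-- Formal power series in q with integer coefficients: n ↦ [q^n].
Series : Set
Series = ℕ → ℤ

sumBelow : ℕ → (ℕ → ℤ) → ℤ
sumBelow zero    f = + 0
sumBelow (suc n) f = sumBelow n f + f n

one : Series
one zero    = + 1
one (suc _) = + 0

_⊛_ : Series → Series → Series
(f ⊛ g) m = sumBelow (suc m) (λ i → f i * g (m ∸ i))

shift : ℕ → Series → Series
shift e f m = if does (e ≤? m) then f (m ∸ e) else + 0

-- 1/(1 - q^a) = Σ_k q^{a k}, for a = suc b ≥ 1
geomInv : ℕ → Series
geomInv b m = if does (suc b ∣? m) then + 1 else + 0

-- 1/((q;q^6)_n (q^5;q^6)_n) = ∏_{j<n} 1/((1-q^{6j+1})(1-q^{6j+5}))
invPoch : ℕ → Series
invPoch zero    = one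
invPoch (suc j) = invPoch j ⊛ (geomInv (6 ℕ.* j) ⊛ geomInv (6 ℕ.* j ℕ.+ 4))

xiTerm : ℕ → Series
xiTerm n = shift (6 ℕ.* n ℕ.* n ∸ 6 ℕ.* n ℕ.+ 1) (invPoch n)

-- p_ξ(m) = [q^m] (1 + 2 Σ_{n≥1} xiTerm n).  Terms with n > m+1 have
-- 6n²-6n+1 > m and contribute 0, so the sum over 1 ≤ n ≤ m+1 is exact.
pξ : ℕ → ℤ
pξ m = one m + (+ 2) * sumBelow (suc m) (λ i → xiTerm (suc i) m)

-- (-1)^k for an integer k (depends only on parity of |k|)
neg1^ : ℕ → ℤ
neg1^ zero    = + 1
neg1^ (suc k) = - neg1^ k

-- Modulo 4 only the parity of S = Σ_{n≥1} q^(6n²-6n+1) / ((q;q⁶)_n (q⁵;q⁶)_n) matters.  Let P = (q⁶;q⁶)_∞.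
-- Partial fractions of each term, summed with Durfee's rectangle identity, turn P·S into a Lambert series, and the
-- same computation gives Euler's pentagonal series for P.  Modulo 2 the series P² = Σ_κ q^(6κ(3κ+1)) only involves
-- powers of q⁴, while the coefficient of q^(4n+2) in P²·S = P·(P·S) counts the indefinite forms (r, s, v) with
-- r² + s² + 4sv = 16n + 10, r ≡ s ≡ 1 (mod 6) and s, v of the same sign.  Seen as geodesics of the upper half plane
-- these are the ones that cross a side of a triangle whose other two sides lie on mirrors of reflections preserving
-- the congruences.  A geodesic crosses the boundary of the triangle an even number of times, and the reflections pair
-- off the crossings of the mirrors, except for geodesics orthogonal to a mirror: these are the factorisations of
-- 8n + 5.  Zagier's involution replaces them by the representations 8n + 5 = x² + 4y², whose number is the coefficient
-- of q^(4n+2) in P² · Σ_λ q^(2(6λ+1)²).  Cancelling P² shows that the coefficient of q^(4n+2) in S is odd exactly when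
-- 4n + 2 = 2(6k - 1)², that is when n = 6k(3k - 1); the sign (-1)^k is invisible in 2(-1)^k modulo 4.

{-# OPTIONS --safe #-}
module Submission where

open import Defs
open import Algebra using (CommutativeRing)
import Algebra.Solver.Ring.NaturalCoefficients.Default as SemiringSolver
open import Data.Bool using (Bool; true; false; not; _∧_; _xor_; if_then_else_)
import Data.Bool.Properties as Boolₚ
open import Data.Bool.Properties using (xor-assoc; xor-comm; xor-same; xor-identityʳ; ∧-comm; ∧-assoc; ∧-distribˡ-xor; ∧-distribʳ-xor; not-involutive; not-distribˡ-xor; not-distribʳ-xor)
open import Data.Empty using (⊥; ⊥-elim)
open import Data.Integer as ℤ using (ℤ; +_; -[1+_]; +[1+_]; +0)
import Data.Integer.Properties as ℤₚ
import Data.Nat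
open import Data.Nat as ℕ using (ℕ; zero; suc; _<_; _≤_; z≤n; s≤s)
open import Data.Nat.Divisibility as ℕ∣ using (_∣?_; divides)
open import Data.Nat.Induction using (<-rec)
import Data.Nat.Properties as ℕₚ
open import Data.Nat.Tactic.RingSolver as ℕ-Solver using ()
open import Data.Product using (Σ; ∃; _×_; _,_; proj₁; proj₂)
open import Data.Sum using (_⊎_; inj₁; inj₂; [_,_]′)
open import Data.Unit using (⊤; tt)
open import Function using (_∘_; id)
open import Level using (0ℓ)
open import Relation.Binary using (DecidableEquality)
open import Relation.Binary.PropositionalEquality using (_≡_; _≢_; refl; sym; trans; cong; cong₂; subst; module ≡-Reasoning)
open import Relation.Nullary using (¬_; Dec; yes; no; contradiction; does)
open import Relation.Nullary.Decidable using (dec-true; dec-false; False; toWitnessFalse; _×-dec_)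
open import Relation.Unary using (Decidable)

-- Counting modulo 2

-- The residue of n modulo 3 shapes the count of forms. The equation forces v ≡ n - 1 (mod 3), and a
-- reflection keeps r ≡ s ≡ 1 (mod 6) only for the right v. One mirror is always Re z = -1. The
-- other is the circle |z + 1|² = 2, with the sign of the form kept for n ≡ 0 and reversed for n ≡
-- 1, or the circle |z| = 1 for n ≡ 2. So the triangle has the vertices ∞, i and -1 + i√2, the last
-- replaced by the cusp -1 for n ≡ 2. Only n ≡ 0 admits representations 8n + 5 = a² + 4b² with a ≡ b
-- ≡ 1 (mod 6); otherwise the number of forms has to be even. For n ≡ 1 the geodesics through i (v =
-- 0) escape the pairing, since negating a form does not change the sign assigned to zero, and they
-- cancel against the factorisations. For n ≡ 2 the number 8n + 5 is a multiple of 3 and its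
-- divisors prime to 3 are even in number. Series are compared modulo q^M: all sums are finite, and
-- 1/P enters only through Durfee's sums.

odd : ℕ → Bool
odd zero    = false
odd (suc n) = not (odd n)

odd-+ : ∀ m n → odd (m ℕ.+ n) ≡ odd m xor odd n
odd-+ zero    n = refl
odd-+ (suc m) n = trans (cong not (odd-+ m n)) (not-distribˡ-xor (odd m) (odd n))

-- Cardinality as a relation between a predicate and a number: counts can be stated and transported
-- along bijections without deciding equality on `A`.
data Card {A : Set} : (A → Set) → ℕ → Set₁ where
  empty  : ∀ {P} → (∀ x → ¬ P x) → Card P zero
  insert : ∀ {P n} a → P a → Card (λ x → P x × x ≢ a) n → Card P (suc n)

Cnt : {A : Set} → (A → Set) → Bool → Set₁
Cnt P b = Σ ℕ λ n → Card P n × odd n ≡ b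

card-image : ∀ {A B : Set} {P : A → Set} {Q : B → Set} {n} (f : A → B) →
  (∀ {x} → P x → Q (f x)) → (∀ {x x′} → P x → P x′ → f x ≡ f x′ → x ≡ x′) →
  (∀ {y} → Q y → Σ A λ x → P x × f x ≡ y) → Card P n → Card Q n
card-image f pq inj onto (empty e) = empty λ y qy → e _ (proj₁ (proj₂ (onto qy)))
card-image f pq inj onto (insert a pa c) = insert (f a) (pq pa)
  (card-image f (λ { (px , x≢a) → pq px , λ e → x≢a (inj px pa e) })
    (λ { (px , _) (px′ , _) → inj px px′ })
    (λ { (qy , y≢fa) → let (x , px , e) = onto qy in
           x , (px , λ x≡a → y≢fa (trans (sym e) (cong f x≡a))) , e }) c)

-- For maps whose inverse is a case distinction: each element of `Q` exhibits its own preimage, and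
-- no inverse function has to be defined on all of `B`.
card-preimage : ∀ {A B : Set} {P : A → Set} {Q : B → Set} {n} (f : A → B) →
  (∀ {x} → P x → Q (f x)) → (∀ {x x′} → P x → P x′ → f x ≡ f x′ → x ≡ x′) →
  (∀ {y} → Q y → Σ A λ x → P x × f x ≡ y) → Card Q n → Card P n
card-preimage f pq inj onto (empty e) = empty λ x px → e (f x) (pq px)
card-preimage f pq inj onto (insert b qb c) with onto qb
... | a , pa , refl = insert a pa (card-preimage f
  (λ { (px , x≢a) → pq px , λ e → x≢a (inj px pa e) })
  (λ { (px , _) (px′ , _) → inj px px′ })
  (λ { (qy , y≢fa) → let (x , px , e) = onto qy in x , (px , λ { refl → y≢fa (sym e) }) , e }) c)

card-bij : ∀ {A B : Set} {P : A → Set} {Q : B → Set} {n} (f : A → B) (g : B → A) →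
  (∀ {x} → P x → Q (f x)) → (∀ {y} → Q y → P (g y)) →
  (∀ {x} → P x → g (f x) ≡ x) → (∀ {y} → Q y → f (g y) ≡ y) → Card P n → Card Q n
card-bij f g pq qp gf fg = card-image f pq
  (λ px px′ e → trans (sym (gf px)) (trans (cong g e) (gf px′)))
  (λ {y} qy → g y , qp qy , fg qy)

card-resp : ∀ {A : Set} {P Q : A → Set} {n} → (∀ {x} → P x → Q x) → (∀ {x} → Q x → P x) → Card P n → Card Q n
card-resp pq qp = card-bij id id pq qp (λ _ → refl) (λ _ → refl)

card-⊎ : ∀ {A : Set} {P Q : A → Set} {m n} → (∀ {x} → P x → ¬ Q x) →
  Card P m → Card Q n → Card (λ x → P x ⊎ Q x) (m ℕ.+ n)
card-⊎ dis (empty e) d = card-resp inj₂ (λ { (inj₁ p) → ⊥-elim (e _ p) ; (inj₂ q) → q }) d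
card-⊎ {Q = Q} dis (insert a pa c) d = insert a (inj₁ pa)
  (card-resp (λ { (inj₁ (p , ne)) → inj₁ p , ne ; (inj₂ q) → inj₂ q , λ { refl → dis pa q } })
             (λ { (inj₁ p , ne) → inj₁ (p , ne) ; (inj₂ q , ne) → inj₂ q })
             (card-⊎ (λ { (p , _) → dis p }) c d))

card-filter : ∀ {A : Set} {P Q : A → Set} {n} → Decidable Q → Card P n →
  Σ ℕ λ k → Σ ℕ λ l → Card (λ x → P x × Q x) k × Card (λ x → P x × ¬ Q x) l × n ≡ k ℕ.+ l
card-filter Q? (empty e) = 0 , 0 , empty (λ { x (p , _) → e x p }) , empty (λ { x (p , _) → e x p }) , refl
card-filter Q? (insert a pa c) with card-filter Q? c | Q? a
... | k , l , ck , cl , refl | yes qa = suc k , l ,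
  insert a (pa , qa) (card-resp (λ { ((p , ne) , q) → (p , q) , ne }) (λ { ((p , q) , ne) → (p , ne) , q }) ck) ,
  card-resp (λ { ((p , ne) , q) → p , q }) (λ { (p , q) → (p , λ { refl → q qa }) , q }) cl , refl
... | k , l , ck , cl , refl | no ¬qa = k , suc l ,
  card-resp (λ { ((p , ne) , q) → p , q }) (λ { (p , q) → (p , λ { refl → ¬qa q }) , q }) ck ,
  insert a (pa , ¬qa) (card-resp (λ { ((p , ne) , q) → (p , q) , ne }) (λ { ((p , q) , ne) → (p , ne) , q }) cl) ,
  sym (ℕₚ.+-suc k l)

module _ {A : Set} (_≟_ : DecidableEquality A) where

  card-remove : ∀ {P : A → Set} {n} a → P a → Card P n →
    Σ ℕ λ m → n ≡ suc m × Card (λ x → P x × x ≢ a) m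
  card-remove a pa (empty e) = ⊥-elim (e a pa)
  card-remove a pa (insert {n = n} b pb c) with a ≟ b
  ... | yes refl = n , refl , c
  ... | no a≢b with card-remove a (pa , a≢b) c
  ...   | m , refl , d = suc m , refl , insert b (pb , a≢b ∘ sym)
          (card-resp (λ { ((p , u) , v) → (p , v) , u }) (λ { ((p , u) , v) → (p , v) , u }) d)

  card-unique : ∀ {P : A → Set} {m n} → Card P m → Card P n → m ≡ n
  card-unique (empty e) (empty _) = refl
  card-unique (empty e) (insert a pa _) = ⊥-elim (e a pa)
  card-unique (insert a pa c) d with card-remove a pa d
  ... | _ , refl , d′ = cong suc (card-unique c d′)

  card-involution : ∀ {P : A → Set} {n} (f : A → A) → (∀ {x} → P x → P (f x)) →
    (∀ {x} → P x → f (f x) ≡ x) → (∀ {x} → P x → f x ≢ x) → Card P n → odd n ≡ false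
  card-involution {P} {n} f fP ff fx = go n ℕₚ.≤-refl fP ff fx
    where
    -- `N` is fuel: what remains after removing the pair a, `f a` is rebuilt by `card-remove` and is
    -- not a subderivation.
    go : ∀ {P : A → Set} {n} N → n ≤ N → (∀ {x} → P x → P (f x)) →
      (∀ {x} → P x → f (f x) ≡ x) → (∀ {x} → P x → f x ≢ x) → Card P n → odd n ≡ false
    go N _ fP ff fx (empty e) = refl
    go (suc N) (s≤s n≤N) fP ff fx (insert a pa c) with card-remove (f a) (fP pa , fx pa) c
    ... | m , refl , d = trans (not-involutive (odd m)) (go N (ℕₚ.≤-trans (ℕₚ.n≤1+n m) n≤N)
      (λ { {x} ((p , x≢a) , x≢fa) → (fP p , λ fx≡a → x≢fa (trans (sym (ff p)) (cong f fx≡a))) ,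
             λ fx≡fa → x≢a (trans (sym (ff p)) (trans (cong f fx≡fa) (ff pa))) })
      (λ { ((p , _) , _) → ff p }) (λ { ((p , _) , _) → fx p }) d)

cnt-bij : ∀ {A B : Set} {P : A → Set} {Q : B → Set} {b} (f : A → B) (g : B → A) →
  (∀ {x} → P x → Q (f x)) → (∀ {y} → Q y → P (g y)) →
  (∀ {x} → P x → g (f x) ≡ x) → (∀ {y} → Q y → f (g y) ≡ y) → Cnt P b → Cnt Q b
cnt-bij f g pq qp gf fg (n , c , o) = n , card-bij f g pq qp gf fg c , o

cnt-image : ∀ {A B : Set} {P : A → Set} {Q : B → Set} {b} (f : A → B) →
  (∀ {x} → P x → Q (f x)) → (∀ {x x′} → P x → P x′ → f x ≡ f x′ → x ≡ x′) →
  (∀ {y} → Q y → Σ A λ x → P x × f x ≡ y) → Cnt P b → Cnt Q b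
cnt-image f pq inj onto (n , c , o) = n , card-image f pq inj onto c , o

cnt-preimage : ∀ {A B : Set} {P : A → Set} {Q : B → Set} {b} (f : A → B) →
  (∀ {x} → P x → Q (f x)) → (∀ {x x′} → P x → P x′ → f x ≡ f x′ → x ≡ x′) →
  (∀ {y} → Q y → Σ A λ x → P x × f x ≡ y) → Cnt Q b → Cnt P b
cnt-preimage f pq inj onto (n , c , o) = n , card-preimage f pq inj onto c , o

cnt-resp : ∀ {A : Set} {P Q : A → Set} {b} → (∀ {x} → P x → Q x) → (∀ {x} → Q x → P x) → Cnt P b → Cnt Q b
cnt-resp pq qp (n , c , o) = n , card-resp pq qp c , o

cnt-empty : ∀ {A : Set} {P : A → Set} → (∀ x → ¬ P x) → Cnt P false
cnt-empty e = 0 , empty e , refl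

cnt-singleton : ∀ {A : Set} {P : A → Set} a → P a → (∀ {x} → P x → x ≡ a) → Cnt P true
cnt-singleton a pa u = 1 , insert a pa (empty λ { x (px , ne) → ne (u px) }) , refl

cnt-⊎ : ∀ {A : Set} {P Q : A → Set} {b c} → (∀ {x} → P x → ¬ Q x) →
  Cnt P b → Cnt Q c → Cnt (λ x → P x ⊎ Q x) (b xor c)
cnt-⊎ dis (m , c , refl) (n , d , refl) = m ℕ.+ n , card-⊎ dis c d , odd-+ m n

cnt-filter : ∀ {A : Set} {P Q : A → Set} {b} → Decidable Q → Cnt P b →
  Σ Bool λ k → Σ Bool λ l → Cnt (λ x → P x × Q x) k × Cnt (λ x → P x × ¬ Q x) l × b ≡ k xor l
cnt-filter Q? (n , c , refl) with card-filter Q? c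
... | k , l , ck , cl , refl = odd k , odd l , (k , ck , refl) , (l , cl , refl) , odd-+ k l

module _ {A : Set} (_≟_ : DecidableEquality A) where

  cnt-unique : ∀ {P : A → Set} {b c} → Cnt P b → Cnt P c → b ≡ c
  cnt-unique (m , c , refl) (n , d , refl) = cong odd (card-unique _≟_ c d)

  cnt-even : ∀ {P : A → Set} {b} (f : A → A) → (∀ {x} → P x → P (f x)) →
    (∀ {x} → P x → f (f x) ≡ x) → (∀ {x} → P x → f x ≢ x) → Cnt P b → b ≡ false
  cnt-even f fP ff fx (n , c , refl) = card-involution _≟_ f fP ff fx c

  -- The elements moved by the involution fall into pairs and vanish modulo 2.
  cnt-fixed : ∀ {P : A → Set} {b} (f : A → A) → (∀ {x} → P x → P (f x)) →
    (∀ {x} → P x → f (f x) ≡ x) → Cnt P b → Cnt (λ x → P x × f x ≡ x) b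
  cnt-fixed {P} f fP ff c with cnt-filter {Q = λ x → f x ≡ x} (λ x → f x ≟ x) c
  ... | k , l , ck , cl , refl = subst (Cnt _) (sym (trans (cong (k xor_) l≡0) (xor-identityʳ k))) ck
    where
    l≡0 : l ≡ false
    l≡0 = cnt-even f (λ { (p , ne) → fP p , λ e → ne (trans (sym e) (ff p)) })
            (λ { (p , _) → ff p }) proj₂ cl

  -- The intersection is counted once in `U` and once in `V`, so it cancels modulo 2.
  cnt-Δ : ∀ {U V W : A → Set} {u v} → Decidable U → Decidable V → Cnt U u → Cnt V v →
    (∀ {x} → U x → ¬ V x → W x) → (∀ {x} → V x → ¬ U x → W x) →
    (∀ {x} → W x → (U x × ¬ V x) ⊎ (V x × ¬ U x)) → Cnt W (u xor v)
  cnt-Δ U? V? cu cv uw vw w with cnt-filter V? cu | cnt-filter U? cv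
  ... | k , l , ck , cl , refl | k′ , l′ , ck′ , cl′ , refl
    with cnt-unique ck (cnt-resp (λ { (a , b) → b , a }) (λ { (a , b) → b , a }) ck′)
  ... | refl = subst (Cnt _) (lemma k l l′)
    (cnt-resp [ (λ { (u , nv) → uw u nv }) , (λ { (v , nu) → vw v nu }) ]′ w
      (cnt-⊎ (λ { (u , _) (_ , nu) → nu u }) cl cl′))
    where
    lemma : ∀ k l l′ → l xor l′ ≡ (k xor l) xor (k xor l′)
    lemma false l l′ = refl
    lemma true  l l′ = trans (sym (not-involutive (l xor l′)))
      (trans (cong not (not-distribˡ-xor l l′)) (not-distribʳ-xor (not l) l′))

-- Triangular exponents

Tri : ℕ → ℕ
Tri zero    = 0
Tri (suc r) = suc r ℕ.+ Tri r

-- (i - l)(i - l - 1)/2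
tri : ℕ → ℕ → ℕ
tri zero    (suc i) = Tri i
tri l       zero    = Tri l
tri (suc l) (suc i) = tri l i

-- Consecutive exponents differ by i - l, written here without subtraction.
tri-suc : ∀ l i → tri l (suc i) ℕ.+ l ≡ tri l i ℕ.+ i
tri-suc zero    zero    = refl
tri-suc zero    (suc i) = trans (ℕₚ.+-identityʳ _) (ℕₚ.+-comm (suc i) (Tri i))
tri-suc (suc zero) zero = refl
tri-suc (suc (suc l)) zero = trans (ℕₚ.+-comm (Tri (suc l)) _) (sym (ℕₚ.+-identityʳ _))
tri-suc (suc l) (suc i) = trans (ℕₚ.+-suc (tri l (suc i)) l)
  (trans (cong suc (tri-suc l i)) (sym (ℕₚ.+-suc (tri l i) i)))

tri-below : ∀ i r → tri (i ℕ.+ r) i ≡ Tri r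
tri-below zero    zero    = refl
tri-below zero    (suc r) = refl
tri-below (suc i) r       = tri-below i r

tri-above : ∀ l i → tri l (suc l ℕ.+ i) ≡ Tri i
tri-above zero    i = refl
tri-above (suc l) i = tri-above l i

-- Sums over intervals and antidiagonals

module Sums {c ℓ} (R : CommutativeRing c ℓ) where
  open CommutativeRing R hiding (refl; sym; trans)
  open SemiringSolver commutativeSemiring using (solve; _:+_; _:*_; _:=_; con) public
  module ≈ = CommutativeRing R using (refl; sym; trans; reflexive)
  open import Relation.Binary.Reasoning.Setoid setoid

  ∑ : ℕ → (ℕ → Carrier) → Carrier
  ∑ zero    f = 0#
  ∑ (suc n) f = f 0 + ∑ n (f ∘ suc)

  anti : ℕ → (ℕ → ℕ → Carrier) → Carrier
  anti zero    f = f 0 0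
  anti (suc n) f = f 0 (suc n) + anti n (f ∘ suc)

  interchange : ∀ a b c d → (a + b) + (c + d) ≈ (a + c) + (b + d)
  interchange = solve 4 (λ a b c d →
    (a :+ b) :+ (c :+ d) := (a :+ c) :+ (b :+ d)) ≈.refl

  ∑-cong : ∀ n {f g} → (∀ i → i < n → f i ≈ g i) → ∑ n f ≈ ∑ n g
  ∑-cong zero    e = ≈.refl
  ∑-cong (suc n) e = +-cong (e 0 (s≤s z≤n)) (∑-cong n (λ i i<n → e (suc i) (s≤s i<n)))

  ∑-+ : ∀ n f g → ∑ n f + ∑ n g ≈ ∑ n (λ i → f i + g i)
  ∑-+ zero    f g = +-identityˡ 0#
  ∑-+ (suc n) f g = ≈.trans (interchange _ _ _ _) (+-congˡ (∑-+ n (f ∘ suc) (g ∘ suc)))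

  ∑-zero : ∀ n {f} → (∀ i → i < n → f i ≈ 0#) → ∑ n f ≈ 0#
  ∑-zero zero    e = ≈.refl
  ∑-zero (suc n) e = ≈.trans (+-cong (e 0 (s≤s z≤n)) (∑-zero n (λ i i<n → e (suc i) (s≤s i<n)))) (+-identityˡ 0#)

  ∑-distribˡ : ∀ n a f → a * ∑ n f ≈ ∑ n (λ i → a * f i)
  ∑-distribˡ zero    a f = zeroʳ a
  ∑-distribˡ (suc n) a f = ≈.trans (distribˡ a _ _) (+-congˡ (∑-distribˡ n a (f ∘ suc)))

  ∑-extend : ∀ {n B} f → n ≤ B → (∀ i → n ≤ i → f i ≈ 0#) → ∑ n f ≈ ∑ B f
  ∑-extend {B = B} f z≤n e = ≈.sym (∑-zero B (λ i _ → e i z≤n))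
  ∑-extend f (s≤s n≤B) e = +-congˡ (∑-extend (f ∘ suc) n≤B (λ i n≤i → e (suc i) (s≤s n≤i)))

  anti-cong : ∀ n {f g} → (∀ i j → i ℕ.+ j ≡ n → f i j ≈ g i j) → anti n f ≈ anti n g
  anti-cong zero    e = e 0 0 refl
  anti-cong (suc n) e = +-cong (e 0 (suc n) refl) (anti-cong n (λ i j p → e (suc i) j (cong suc p)))

  anti-+ : ∀ n f g → anti n (λ i j → f i j + g i j) ≈ anti n f + anti n g
  anti-+ zero    f g = ≈.refl
  anti-+ (suc n) f g = ≈.trans (+-congˡ (anti-+ n (f ∘ suc) (g ∘ suc))) (interchange _ _ _ _)

  anti-distribˡ : ∀ n a f → a * anti n f ≈ anti n (λ i j → a * f i j)
  anti-distribˡ zero    a f = ≈.refl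
  anti-distribˡ (suc n) a f = ≈.trans (distribˡ a _ _) (+-congˡ (anti-distribˡ n a (f ∘ suc)))

  anti-last : ∀ n f → anti (suc n) f ≈ anti n (λ i j → f i (suc j)) + f (suc n) 0
  anti-last zero    f = ≈.refl
  anti-last (suc n) f = ≈.trans (+-congˡ (anti-last n (f ∘ suc))) (≈.sym (+-assoc _ _ _))

  anti-swap : ∀ n f → anti n f ≈ anti n (λ i j → f j i)
  anti-swap zero    f = ≈.refl
  anti-swap (suc n) f = begin
    f 0 (suc n) + anti n (f ∘ suc)                  ≈⟨ +-comm _ _ ⟩
    anti n (f ∘ suc) + f 0 (suc n)                  ≈⟨ +-congʳ (anti-swap n (f ∘ suc)) ⟩
    anti n (λ i j → f (suc j) i) + f 0 (suc n)      ≈⟨ anti-last n (λ i j → f j i) ⟨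
    anti (suc n) (λ i j → f j i)                    ∎

  anti-split : ∀ a b f → anti (a ℕ.+ suc b) f ≈
    anti a (λ i j → f i (j ℕ.+ suc b)) + anti b (λ i j → f (suc a ℕ.+ i) j)
  anti-split zero    b f = ≈.refl
  anti-split (suc a) b f = ≈.trans (+-congˡ (anti-split a b (f ∘ suc))) (≈.sym (+-assoc _ _ _))

  -- A triangle of indices is exchanged for a rectangle: the vanishing for i + j ≥ M makes all
  -- additional entries zero, so antidiagonals can be resummed as rows.
  ∑-anti : ∀ {M B} → M ≤ B → ∀ f → (∀ i j → M ≤ i ℕ.+ j → f i j ≈ 0#) →
    ∑ M (λ n → anti n f) ≈ ∑ M (λ i → ∑ B (f i))
  ∑-anti z≤n f e = ≈.refl
  ∑-anti {suc M} {B} M<B f e = begin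
    f 0 0 + ∑ M (λ n → f 0 (suc n) + anti n (f ∘ suc))
      ≈⟨ +-congˡ (∑-+ M _ _) ⟨
    f 0 0 + (∑ M (λ n → f 0 (suc n)) + ∑ M (λ n → anti n (f ∘ suc)))
      ≈⟨ +-assoc _ _ _ ⟨
    ∑ (suc M) (f 0) + ∑ M (λ n → anti n (f ∘ suc))
      ≈⟨ +-cong (∑-extend (f 0) M<B (λ j → e 0 j))
           (∑-anti (ℕₚ.<⇒≤ M<B) (f ∘ suc) (λ i j M≤ → e (suc i) j (s≤s M≤))) ⟩
    ∑ B (f 0) + ∑ M (λ i → ∑ B (f (suc i))) ∎

-- Partial fractions, Durfee's identity and the Lambert series

module _ {c ℓ} (R : CommutativeRing c ℓ) where
  open CommutativeRing R hiding (refl; sym; trans)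
  open Sums R
  open import Relation.Binary.Reasoning.Setoid setoid

  -- X k stands for Q^k, p k for 1/(Q;Q)_k and v r for 1/((1 - xQ^r)(1 - Q^(r+1)/x)), where y = x + Q/x.
  module Lambert
    (char2 : ∀ x → x + x ≈ 0#)
    (X : ℕ → Carrier) (X-0 : X 0 ≈ 1#) (X-+ : ∀ a b → X (a ℕ.+ b) ≈ X a * X b)
    (M : ℕ) (X-M : ∀ k → M ≤ k → X k ≈ 0#)
    (u : ℕ → Carrier) (u-inv : ∀ k → (1# + X (suc k)) * u k ≈ 1#)
    (y : Carrier) (v : ℕ → Carrier)
    (v-inv : ∀ r → (1# + X (suc (2 ℕ.* r)) + X r * y) * v r ≈ 1#)
    where

    X-cong : ∀ {a b} → a ≡ b → X a ≈ X b
    X-cong refl = ≈.refl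

    p : ℕ → Carrier
    p zero    = 1#
    p (suc k) = p k * u k

    p-suc : ∀ k → (1# + X (suc k)) * p (suc k) ≈ p k
    p-suc k = begin
      (1# + X (suc k)) * (p k * u k) ≈⟨ l1 (X (suc k)) (p k) (u k) ⟩
      p k * ((1# + X (suc k)) * u k) ≈⟨ *-congˡ (u-inv k) ⟩
      p k * 1#                       ≈⟨ *-identityʳ _ ⟩
      p k                            ∎
      where
      l1 : ∀ x a b → (1# + x) * (a * b) ≈ a * ((1# + x) * b)
      l1 = solve 3 (λ x a b →
        (con 1 :+ x) :* (a :* b) := a :* ((con 1 :+ x) :* b)) ≈.refl

    1+X0 : 1# + X 0 ≈ 0#
    1+X0 = ≈.trans (+-congˡ X-0) (char2 1#)

    +-cancel-char2 : ∀ {a b} → a + b ≈ 0# → a ≈ b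
    +-cancel-char2 {a} {b} e = begin
      a           ≈⟨ +-identityʳ a ⟨
      a + 0#      ≈⟨ +-congˡ (char2 b) ⟨
      a + (b + b) ≈⟨ +-assoc a b b ⟨
      a + b + b   ≈⟨ +-congʳ e ⟩
      0# + b      ≈⟨ +-identityˡ b ⟩
      b           ∎

    -- Up to the factor Q^(l(l+1)/2) / (Q;Q)_N this is the q-binomial sum of [N, i] Q^(i(i-1)/2) z^i
    -- at z = Q^(-l); the signs disappear in characteristic 2.
    S : ℕ → ℕ → Carrier
    S N l = anti N (λ i j → X (tri l i) * (p i * p j))

    -- The q-binomial product gains the factor 1 + zQ^N = 1 + Q^m with N = l + m. The recurrence
    -- comes from 1 + Q^(i+j) = (1 + Q^j) + Q^j(1 + Q^i), where each summand lowers the index of one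
    -- `p`.
    S-suc : ∀ m l → (1# + X (suc (l ℕ.+ m))) * S (suc (l ℕ.+ m)) l ≈ (1# + X m) * S (l ℕ.+ m) l
    S-suc m l = begin
      (1# + X (suc N)) * S (suc N) l
        ≈⟨ anti-distribˡ (suc N) _ (λ i j → X (tri l i) * (p i * p j)) ⟩
      anti (suc N) (λ i j → (1# + X (suc N)) * (X (tri l i) * (p i * p j)))
        ≈⟨ anti-cong (suc N) (λ i j e → split i j e) ⟩
      anti (suc N) (λ i j → f i j + g i j)
        ≈⟨ anti-+ (suc N) f g ⟩
      anti (suc N) f + anti (suc N) g
        ≈⟨ +-cong fpart gpart ⟩
      S N l + X m * S N l
        ≈⟨ l3 (S N l) (X m) ⟨
      (1# + X m) * S N l ∎
      where
      N = l ℕ.+ m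
      f g : ℕ → ℕ → Carrier
      f i j = X (tri l i) * (p i * ((1# + X j) * p j))
      g i j = X (tri l i) * X j * (((1# + X i) * p i) * p j)
      l2 : ∀ t a b x y → (1# + x * y) * (t * (a * b)) + (t * a * b * y + t * a * b * y) ≈
        t * (a * ((1# + y) * b)) + t * y * (((1# + x) * a) * b)
      l2 = solve 5 (λ t a b x y →
        (con 1 :+ x :* y) :* (t :* (a :* b)) :+ (t :* a :* b :* y :+ t :* a :* b :* y) := t :* (a :* ((con 1 :+ y) :* b)) :+ t :* y :* (((con 1 :+ x) :* a) :* b)) ≈.refl
      l3 : ∀ s x → (1# + x) * s ≈ s + x * s
      l3 = solve 2 (λ s x →
        (con 1 :+ x) :* s := s :+ x :* s) ≈.refl
      split : ∀ i j → i ℕ.+ j ≡ suc N → (1# + X (suc N)) * (X (tri l i) * (p i * p j)) ≈ f i j + g i j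
      split i j e = begin
        (1# + X (suc N)) * (X (tri l i) * (p i * p j))
          ≈⟨ *-congʳ (+-congˡ (≈.trans (X-cong (sym e)) (X-+ i j))) ⟩
        (1# + X i * X j) * (X (tri l i) * (p i * p j))
          ≈⟨ +-identityʳ _ ⟨
        (1# + X i * X j) * (X (tri l i) * (p i * p j)) + 0#
          ≈⟨ +-congˡ (char2 _) ⟨
        (1# + X i * X j) * (X (tri l i) * (p i * p j)) + (X (tri l i) * p i * p j * X j + X (tri l i) * p i * p j * X j)
          ≈⟨ l2 (X (tri l i)) (p i) (p j) (X i) (X j) ⟩
        f i j + g i j ∎
      fpart : anti (suc N) f ≈ S N l
      fpart = begin
        anti (suc N) f
          ≈⟨ anti-last N f ⟩
        anti N (λ i j → f i (suc j)) + X (tri l (suc N)) * (p (suc N) * ((1# + X 0) * 1#))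
          ≈⟨ +-cong (anti-cong N (λ i j _ → *-congˡ (*-congˡ (p-suc j))))
               (*-congˡ (*-congˡ (*-congʳ 1+X0))) ⟩
        S N l + X (tri l (suc N)) * (p (suc N) * (0# * 1#))
          ≈⟨ l4 (S N l) (X (tri l (suc N))) (p (suc N)) ⟩
        S N l ∎
        where
        l4 : ∀ s a b → s + a * (b * (0# * 1#)) ≈ s
        l4 = solve 3 (λ s a b →
          s :+ a :* (b :* (con 0 :* con 1)) := s) ≈.refl
      expo : ∀ i j → i ℕ.+ j ≡ N → tri l (suc i) ℕ.+ j ≡ m ℕ.+ tri l i
      expo i j e = ℕₚ.+-cancelʳ-≡ l _ _ (≡-begin (tri l (suc i)) (tri l i) (tri-suc l i))
        where
        ≡-begin : ∀ a b → a ℕ.+ l ≡ b ℕ.+ i → a ℕ.+ j ℕ.+ l ≡ m ℕ.+ b ℕ.+ l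
        ≡-begin a b h = trans (a1 a j l) (trans (cong (ℕ._+ j) h) (trans (ℕₚ.+-assoc b i j) (trans (cong (b ℕ.+_) e) (a2 b l m))))
          where
          a1 : ∀ a j l → a ℕ.+ j ℕ.+ l ≡ a ℕ.+ l ℕ.+ j
          a1 = ℕ-Solver.solve-∀
          a2 : ∀ b l m → b ℕ.+ (l ℕ.+ m) ≡ m ℕ.+ b ℕ.+ l
          a2 = ℕ-Solver.solve-∀
      gpart : anti (suc N) g ≈ X m * S N l
      gpart = begin
        X (tri l 0) * X (suc N) * (((1# + X 0) * 1#) * p (suc N)) + anti N (g ∘ suc)
          ≈⟨ +-cong (*-congˡ (*-congʳ (*-congʳ 1+X0))) (anti-cong N term) ⟩
        X (tri l 0) * X (suc N) * ((0# * 1#) * p (suc N)) + anti N (λ i j → X m * (X (tri l i) * (p i * p j)))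
          ≈⟨ l5 (X (tri l 0)) (X (suc N)) (p (suc N)) _ ⟩
        anti N (λ i j → X m * (X (tri l i) * (p i * p j)))
          ≈⟨ anti-distribˡ N (X m) _ ⟨
        X m * S N l ∎
        where
        l5 : ∀ a b c s → a * b * ((0# * 1#) * c) + s ≈ s
        l5 = solve 4 (λ a b c s →
          a :* b :* ((con 0 :* con 1) :* c) :+ s := s) ≈.refl
        term : ∀ i j → i ℕ.+ j ≡ N → g (suc i) j ≈ X m * (X (tri l i) * (p i * p j))
        term i j e = begin
          X (tri l (suc i)) * X j * (((1# + X (suc i)) * p (suc i)) * p j)
            ≈⟨ *-cong (≈.sym (X-+ _ _)) (*-congʳ (p-suc i)) ⟩
          X (tri l (suc i) ℕ.+ j) * (p i * p j)
            ≈⟨ *-congʳ (≈.trans (X-cong (expo i j e)) (X-+ m _)) ⟩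
          X m * X (tri l i) * (p i * p j)
            ≈⟨ *-assoc _ _ _ ⟩
          X m * (X (tri l i) * (p i * p j)) ∎

    -- For N > l the q-binomial product contains the factor 1 + zQ^l = 1 + 1 = 0. The recurrence
    -- meets it at m = 0 and carries the zero upwards.
    S-zero : ∀ m l → S (suc (l ℕ.+ m)) l ≈ 0#
    S-zero m l = cancel (≈.trans (S-suc m l) (vanish m))
      where
      cancel : ∀ {k s} → (1# + X (suc k)) * s ≈ 0# → s ≈ 0#
      cancel {k} {s} e = begin
        s                              ≈⟨ *-identityˡ s ⟨
        1# * s                         ≈⟨ *-congʳ (u-inv k) ⟨
        (1# + X (suc k)) * u k * s     ≈⟨ l6 (X (suc k)) (u k) s ⟩
        u k * ((1# + X (suc k)) * s)   ≈⟨ *-congˡ e ⟩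
        u k * 0#                       ≈⟨ zeroʳ _ ⟩
        0#                             ∎
        where
        l6 : ∀ x a b → (1# + x) * a * b ≈ a * ((1# + x) * b)
        l6 = solve 3 (λ x a b →
          (con 1 :+ x) :* a :* b := a :* ((con 1 :+ x) :* b)) ≈.refl
      vanish : ∀ m → (1# + X m) * S (l ℕ.+ m) l ≈ 0#
      vanish zero    = ≈.trans (*-congʳ 1+X0) (zeroˡ _)
      vanish (suc m) = ≈.trans (*-congˡ (≈.trans (≈.reflexive (cong (λ N → S N l) (ℕₚ.+-suc l m))) (S-zero m l))) (zeroʳ _)

    δ : ℕ → Carrier
    δ zero    = 1#
    δ (suc n) = 0#

    -- For n ≥ 1 this is the vanishing sum `S` with N = 2n and l = n, folded at its middle: indices
    -- i ≤ n give the products p(n-r) p(n+r), indices i > n the others. It is the unit Bailey pair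
    -- relative to 1, reduced modulo 2.
    fold : ∀ n → anti n (λ r j → X (Tri r) * ((1# + X j) * p j * p (suc n ℕ.+ r) + p j * p (n ℕ.+ r))) ≈ δ n
    fold zero = begin
      X 0 * ((1# + X 0) * 1# * p 1 + 1# * 1#) ≈⟨ *-cong X-0 (+-congʳ (*-congʳ (*-congʳ 1+X0))) ⟩
      1# * (0# * 1# * p 1 + 1# * 1#)          ≈⟨ l7 (p 1) ⟩
      1#                                      ∎
      where
      l7 : ∀ a → 1# * (0# * 1# * a + 1# * 1#) ≈ 1#
      l7 = solve 1 (λ a →
        con 1 :* (con 0 :* con 1 :* a :+ con 1 :* con 1) := con 1) ≈.refl
    fold (suc n) = begin
      anti N (λ r j → X (Tri r) * ((1# + X j) * p j * p (suc N ℕ.+ r) + p j * p (N ℕ.+ r)))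
        ≈⟨ anti-cong N (λ r j _ → l8 (X (Tri r)) (X j) (p j) (p (suc N ℕ.+ r)) (p (N ℕ.+ r))) ⟩
      anti N (λ r j → f r j + X (Tri r) * (p j * p (N ℕ.+ r)))
        ≈⟨ anti-+ N f h ⟩
      anti N f + anti N (λ r j → X (Tri r) * (p j * p (N ℕ.+ r)))
        ≈⟨ +-cong fpart (anti-swap N h) ⟩
      anti n (λ r j → X (Tri r) * (p (suc N ℕ.+ r) * p j)) + anti N (λ i r → X (Tri r) * (p i * p (N ℕ.+ r)))
        ≈⟨ +-comm _ _ ⟩
      anti N (λ i r → X (Tri r) * (p i * p (N ℕ.+ r))) + anti n (λ r j → X (Tri r) * (p (suc N ℕ.+ r) * p j))
        ≈⟨ +-cong
            (anti-cong N (λ { i r e → *-cong (X-cong (trans (sym (tri-below i r)) (cong (λ z → tri z i) e)))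
                                             (*-congˡ {p i} (≈.reflexive (cong p (ℕₚ.+-comm N r)))) }))
            (anti-cong n (λ r j _ → *-congʳ (X-cong (sym (tri-above N r))))) ⟩
      anti N (λ i r → X (tri N i) * (p i * p (r ℕ.+ N))) + anti n (λ r j → X (tri N (suc N ℕ.+ r)) * (p (suc N ℕ.+ r) * p j))
        ≈⟨ anti-split N n (λ i j → X (tri N i) * (p i * p j)) ⟨
      S (N ℕ.+ suc n) N
        ≈⟨ ≈.reflexive (cong (λ z → S z N) (ℕₚ.+-suc N n)) ⟩
      S (suc (N ℕ.+ n)) N
        ≈⟨ S-zero n N ⟩
      0# ∎
      where
      N = suc n
      f : ℕ → ℕ → Carrier
      f r j = X (Tri r) * (p (suc N ℕ.+ r) * ((1# + X j) * p j))
      h : ℕ → ℕ → Carrier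
      h r j = X (Tri r) * (p j * p (N ℕ.+ r))
      l8 : ∀ t x a b c → t * ((1# + x) * a * b + a * c) ≈ t * (b * ((1# + x) * a)) + t * (a * c)
      l8 = solve 5 (λ t x a b c →
        t :* ((con 1 :+ x) :* a :* b :+ a :* c) := t :* (b :* ((con 1 :+ x) :* a)) :+ t :* (a :* c)) ≈.refl
      l9 : ∀ s a b → s + a * (b * (0# * 1#)) ≈ s
      l9 = solve 3 (λ s a b →
        s :+ a :* (b :* (con 0 :* con 1)) := s) ≈.refl
      fpart : anti N f ≈ anti n (λ r j → X (Tri r) * (p (suc N ℕ.+ r) * p j))
      fpart = ≈.trans (anti-last n f) (≈.trans
        (+-cong (anti-cong n (λ r j _ → *-congˡ (*-congˡ (p-suc j)))) (*-congˡ (*-congˡ (*-congʳ 1+X0))))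
        (l9 _ _ _))

    V : ℕ → Carrier
    V zero    = 1#
    V (suc n) = V n * v n

    W : ℕ → Carrier
    W r = 1# + X (suc (2 ℕ.* r))

    -- Multiplying the expansion for N by the new denominator has to return the one for N - 1. By
    -- `w-split` that denominator is a multiple of the r-th one, which cancels `v r` and leaves the
    -- vanishing sum `fold`, plus a product of two factors which lower the indices of both `p`.
    partialFractions : ∀ n → V (suc n) ≈ anti n (λ r j → X (Tri r) * W r * (p j * p (suc n ℕ.+ r)) * v r)
    partialFractions zero = begin
      1# * v 0                                     ≈⟨ *-congʳ (p-suc 0) ⟨
      (1# + X 1) * p 1 * v 0                       ≈⟨ l1 (1# + X 1) (p 1) (v 0) ⟩
      1# * (1# + X 1) * (1# * p 1) * v 0           ≈⟨ *-congʳ (*-congʳ (*-congʳ X-0)) ⟨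
      X 0 * (1# + X 1) * (1# * p 1) * v 0 ∎
      where
      l1 : ∀ a b c → a * b * c ≈ 1# * a * (1# * b) * c
      l1 = solve 3 (λ a b c →
        a :* b :* c := con 1 :* a :* (con 1 :* b) :* c) ≈.refl
    partialFractions (suc n) = begin
      V N * v N                          ≈⟨ *-congʳ (≈.trans (partialFractions n) (≈.sym step)) ⟩
      w N * G * v N                      ≈⟨ l2 (w N) G (v N) ⟩
      G * (w N * v N)                    ≈⟨ *-congˡ (v-inv N) ⟩
      G * 1#                             ≈⟨ *-identityʳ G ⟩
      G                                  ∎
      where
      N = suc n
      w : ℕ → Carrier
      w r = 1# + X (suc (2 ℕ.* r)) + X r * y
      G = anti N (λ r j → X (Tri r) * W r * (p j * p (suc N ℕ.+ r)) * v r)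
      l2 : ∀ a b c → a * b * c ≈ b * (a * c)
      l2 = solve 3 (λ a b c →
        a :* b :* c := b :* (a :* c)) ≈.refl
      f g : ℕ → ℕ → Carrier
      f r j = X (Tri r) * ((1# + X j) * p j * p (suc N ℕ.+ r) + p j * p (N ℕ.+ r))
      g r j = X (Tri r) * W r * (((1# + X j) * p j) * p (N ℕ.+ r)) * v r
      h : ℕ → ℕ → Carrier
      h r j = X (Tri r) * W r * (p j * p (suc N ℕ.+ r)) * v r
      -- w_N = Q^j w_r + (1 + Q^j)(1 + Q^(N+1+r)) for r + j = N
      w-split : ∀ r j → r ℕ.+ j ≡ N → w N ≈ X j * w r + (1# + X j) * (1# + X (suc N ℕ.+ r))
      w-split r j e = begin
        w N
          ≈⟨ ≈.reflexive (cong w e) ⟨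
        1# + X (suc (2 ℕ.* (r ℕ.+ j))) + X (r ℕ.+ j) * y
          ≈⟨ +-cong (+-congˡ (X-cong (e1 r j))) (*-congʳ (X-+ r j)) ⟩
        1# + X (j ℕ.+ (suc (r ℕ.+ j) ℕ.+ r)) + X r * X j * y
          ≈⟨ +-congʳ (+-congˡ (X-+ j _)) ⟩
        1# + X j * X (suc (r ℕ.+ j) ℕ.+ r) + X r * X j * y
          ≈⟨ l3 (X j) (X (suc (r ℕ.+ j) ℕ.+ r)) (X r) ⟩
        1# + X j * z + X r * X j * y + 0# + 0#
          ≈⟨ +-cong (+-congˡ (char2 (X j))) (char2 z) ⟨
        1# + X j * z + X r * X j * y + (X j + X j) + (z + z)
          ≈⟨ +-congˡ (+-congˡ (≈.trans (X-cong (e2 r j)) (X-+ j _))) ⟩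
        1# + X j * z + X r * X j * y + (X j + X j) + (z + X j * X (suc (2 ℕ.* r)))
          ≈⟨ l4 (X j) z (X r) y (X (suc (2 ℕ.* r))) ⟩
        X j * w r + (1# + X j) * (1# + z)
          ≈⟨ +-congˡ (*-congˡ (+-congˡ (X-cong (cong (λ n → suc n ℕ.+ r) e)))) ⟩
        X j * w r + (1# + X j) * (1# + X (suc N ℕ.+ r)) ∎
        where
        z = X (suc (r ℕ.+ j) ℕ.+ r)
        e1 : ∀ r j → suc (2 ℕ.* (r ℕ.+ j)) ≡ j ℕ.+ (suc (r ℕ.+ j) ℕ.+ r)
        e1 = ℕ-Solver.solve-∀
        e2 : ∀ r j → suc (r ℕ.+ j) ℕ.+ r ≡ j ℕ.+ suc (2 ℕ.* r)
        e2 = ℕ-Solver.solve-∀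
        l3 : ∀ a z b → 1# + a * z + b * a * y ≈ 1# + a * z + b * a * y + 0# + 0#
        l3 a z b = ≈.sym (≈.trans (+-identityʳ _) (+-identityʳ _))
        l4 : ∀ a z b y d → 1# + a * z + b * a * y + (a + a) + (z + a * d) ≈
          a * (1# + d + b * y) + (1# + a) * (1# + z)
        l4 = solve 5 (λ a z b y d →
          con 1 :+ a :* z :+ b :* a :* y :+ (a :+ a) :+ (z :+ a :* d) := a :* (con 1 :+ d :+ b :* y) :+ (con 1 :+ a) :* (con 1 :+ z)) ≈.refl
      term : ∀ r j → r ℕ.+ j ≡ N → w N * (X (Tri r) * W r * (p j * p (suc N ℕ.+ r)) * v r) ≈ f r j + g r j
      term r j e = begin
        w N * (X (Tri r) * W r * (p j * P) * v r)
          ≈⟨ *-congʳ (w-split r j e) ⟩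
        (X j * w r + (1# + X j) * (1# + z)) * (X (Tri r) * W r * (p j * P) * v r)
          ≈⟨ l5 (X j) (w r) (1# + X j) (1# + z) (X (Tri r)) (W r) (p j) P (v r) ⟩
        X (Tri r) * (X j * W r) * (p j * P) * (w r * v r) + X (Tri r) * W r * (((1# + X j) * p j) * ((1# + z) * P)) * v r
          ≈⟨ +-cong (*-congˡ (v-inv r)) (*-congʳ (*-congˡ (*-congˡ (p-suc (N ℕ.+ r))))) ⟩
        X (Tri r) * (X j * W r) * (p j * P) * 1# + g r j
          ≈⟨ +-congʳ (≈.trans (*-identityʳ _) (*-congʳ (*-congˡ xw))) ⟩
        X (Tri r) * ((1# + X j) + (1# + z)) * (p j * P) + g r j
          ≈⟨ +-congʳ (l6 (X (Tri r)) (1# + X j) (1# + z) (p j) P) ⟩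
        X (Tri r) * ((1# + X j) * p j * P + p j * ((1# + z) * P)) + g r j
          ≈⟨ +-congʳ (*-congˡ (+-congˡ (*-congˡ (p-suc (N ℕ.+ r))))) ⟩
        f r j + g r j ∎
        where
        P = p (suc N ℕ.+ r)
        z = X (suc N ℕ.+ r)
        l5 : ∀ a w b c t d q s v → (a * w + b * c) * (t * d * (q * s) * v) ≈
          t * (a * d) * (q * s) * (w * v) + t * d * ((b * q) * (c * s)) * v
        l5 = solve 9 (λ a w b c t d q s v →
          (a :* w :+ b :* c) :* (t :* d :* (q :* s) :* v) := t :* (a :* d) :* (q :* s) :* (w :* v) :+ t :* d :* ((b :* q) :* (c :* s)) :* v) ≈.refl
        l6 : ∀ t a b q s → t * (a + b) * (q * s) ≈ t * (a * q * s + q * (b * s))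
        l6 = solve 5 (λ t a b q s →
          t :* (a :+ b) :* (q :* s) := t :* (a :* q :* s :+ q :* (b :* s))) ≈.refl
        l7 : ∀ a b → a * (1# + b) ≈ a + a * b
        l7 = solve 2 (λ a b →
          a :* (con 1 :+ b) := a :+ a :* b) ≈.refl
        l8 : ∀ a z → a + z + (1# + 1#) ≈ (1# + a) + (1# + z)
        l8 = solve 2 (λ a z →
          a :+ z :+ (con 1 :+ con 1) := (con 1 :+ a) :+ (con 1 :+ z)) ≈.refl
        e3 : ∀ j → j ℕ.+ suc (2 ℕ.* r) ≡ suc (r ℕ.+ j) ℕ.+ r
        e3 j = e3′ r j
          where
          e3′ : ∀ r j → j ℕ.+ suc (2 ℕ.* r) ≡ suc (r ℕ.+ j) ℕ.+ r
          e3′ = ℕ-Solver.solve-∀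
        -- Q^j(1 + Q^(2r+1)) is split into the factors that lower `p j` and `P`, which is the shape
        -- of the summand in `fold`.
        xw : X j * W r ≈ (1# + X j) + (1# + z)
        xw = begin
          X j * (1# + X (suc (2 ℕ.* r)))     ≈⟨ l7 _ _ ⟩
          X j + X j * X (suc (2 ℕ.* r))      ≈⟨ +-congˡ (X-+ j _) ⟨
          X j + X (j ℕ.+ suc (2 ℕ.* r))      ≈⟨ +-congˡ (X-cong (trans (e3 j) (cong (λ n → suc n ℕ.+ r) e))) ⟩
          X j + z                            ≈⟨ +-identityʳ _ ⟨
          X j + z + 0#                       ≈⟨ +-congˡ (char2 1#) ⟨
          X j + z + (1# + 1#)                ≈⟨ l8 (X j) z ⟩
          (1# + X j) + (1# + z) ∎
      step : w N * G ≈ anti n (λ r j → X (Tri r) * W r * (p j * p (N ℕ.+ r)) * v r)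
      step = begin
        w N * G                                            ≈⟨ anti-distribˡ N (w N) h ⟩
        anti N (λ r j → w N * (X (Tri r) * W r * (p j * p (suc N ℕ.+ r)) * v r))
                                                           ≈⟨ anti-cong N term ⟩
        anti N (λ r j → f r j + g r j)                     ≈⟨ anti-+ N f g ⟩
        anti N f + anti N g                                ≈⟨ +-cong (fold N) (anti-last n g) ⟩
        0# + (anti n (λ r j → g r (suc j)) + X (Tri N) * W N * (((1# + X 0) * 1#) * p (N ℕ.+ N)) * v N)
          ≈⟨ +-congˡ (+-cong (anti-cong n (λ r j _ → *-congʳ (*-congˡ (*-congʳ (p-suc j)))))
                             (*-congʳ (*-congˡ (*-congʳ (*-congʳ 1+X0))))) ⟩
        0# + (anti n (λ r j → X (Tri r) * W r * (p j * p (N ℕ.+ r)) * v r) + X (Tri N) * W N * ((0# * 1#) * p (N ℕ.+ N)) * v N)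
          ≈⟨ l9 _ (X (Tri N) * W N) (p (N ℕ.+ N)) (v N) ⟩
        anti n (λ r j → X (Tri r) * W r * (p j * p (N ℕ.+ r)) * v r) ∎
        where
        l9 : ∀ s a b c → 0# + (s + a * ((0# * 1#) * b) * c) ≈ s
        l9 = solve 4 (λ s a b c →
          con 0 :+ (s :+ a :* ((con 0 :* con 1) :* b) :* c) := s) ≈.refl

    X-vanish : ∀ {k} a → M ≤ k → X k * a ≈ 0#
    X-vanish a M≤k = ≈.trans (*-congʳ (X-M _ M≤k)) (zeroˡ a)

    n≤n²+ : ∀ n k → n ≤ n ℕ.* n ℕ.+ k
    n≤n²+ zero    k = z≤n
    n≤n²+ (suc n) k = ℕₚ.≤-trans (ℕₚ.m≤m*n (suc n) (suc n)) (ℕₚ.m≤m+n _ k)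

    t : ℕ → ℕ → Carrier
    t c m = X (m ℕ.* m ℕ.+ c ℕ.* m) * (p m * p (m ℕ.+ c))

    -- Sorting partitions by their largest rectangle m × (m + c) shows that, for every c, this sum
    -- is 1/(Q;Q)_∞ up to truncation. `D M 0` stands for that series; the infinite product is never
    -- formed.
    D : ℕ → ℕ → Carrier
    D B c = ∑ B (t c)

    -- The certificate by which the difference of D B c and D B (c + 1) telescopes.
    U : ℕ → ℕ → Carrier
    U c m = X (m ℕ.* m ℕ.+ c ℕ.* m) * ((1# + X m) * p m * p (m ℕ.+ c))

    t-diff : ∀ c m → t c m + t (suc c) m ≈ U c m + U c (suc m)
    t-diff c m = begin
      X e * (p m * p (m ℕ.+ c)) + X (m ℕ.* m ℕ.+ suc c ℕ.* m) * (p m * p (m ℕ.+ suc c))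
        ≈⟨ +-cong (*-congˡ (*-congˡ (≈.sym (p-suc (m ℕ.+ c)))))
             (*-cong (≈.trans (X-cong (e1 m c)) (X-+ e m)) (*-congˡ (≈.reflexive (cong p (ℕₚ.+-suc m c))))) ⟩
      X e * (p m * ((1# + X z) * P)) + X e * X m * (p m * P)
        ≈⟨ +-identityʳ _ ⟨
      X e * (p m * ((1# + X z) * P)) + X e * X m * (p m * P) + 0#
        ≈⟨ +-congˡ (char2 (X e * p m * P * X m * X z)) ⟨
      X e * (p m * ((1# + X z) * P)) + X e * X m * (p m * P)
        + (X e * p m * P * X m * X z + X e * p m * P * X m * X z)
        ≈⟨ l1 (X e) (p m) (X z) P (X m) ⟩
      X e * ((1# + X m) * p m * ((1# + X z) * P)) + X e * (X m * X z) * (p m * P)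
        ≈⟨ +-cong (*-congˡ (*-congˡ (p-suc (m ℕ.+ c))))
             (*-cong (≈.trans (*-congˡ (≈.sym (X-+ m z))) (≈.trans (≈.sym (X-+ e _)) (X-cong (e2 m c))))
               (*-congʳ (≈.sym (p-suc m)))) ⟩
      U c m + U c (suc m) ∎
      where
      e = m ℕ.* m ℕ.+ c ℕ.* m
      z = suc (m ℕ.+ c)
      P = p z
      e1 : ∀ m c → m ℕ.* m ℕ.+ suc c ℕ.* m ≡ m ℕ.* m ℕ.+ c ℕ.* m ℕ.+ m
      e1 = ℕ-Solver.solve-∀
      e2 : ∀ m c → m ℕ.* m ℕ.+ c ℕ.* m ℕ.+ (m ℕ.+ suc (m ℕ.+ c)) ≡ suc m ℕ.* suc m ℕ.+ c ℕ.* suc m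
      e2 = ℕ-Solver.solve-∀
      l1 : ∀ x a z q y → x * (a * ((1# + z) * q)) + x * y * (a * q) + (x * a * q * y * z + x * a * q * y * z) ≈
        x * ((1# + y) * a * ((1# + z) * q)) + x * (y * z) * (a * q)
      l1 = solve 5 (λ x a z q y →
        x :* (a :* ((con 1 :+ z) :* q)) :+ x :* y :* (a :* q) :+ (x :* a :* q :* y :* z :+ x :* a :* q :* y :* z) :=
        x :* ((con 1 :+ y) :* a :* ((con 1 :+ z) :* q)) :+ x :* (y :* z) :* (a :* q)) ≈.refl

    telescope : ∀ B (f : ℕ → Carrier) → ∑ B (λ m → f m + f (suc m)) ≈ f 0 + f B
    telescope zero    f = ≈.sym (char2 (f 0))
    telescope (suc B) f = begin
      f 0 + f 1 + ∑ B (λ m → f (suc m) + f (suc (suc m))) ≈⟨ +-congˡ (telescope B (f ∘ suc)) ⟩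
      f 0 + f 1 + (f 1 + f (suc B))                       ≈⟨ l1 (f 0) (f 1) (f (suc B)) ⟩
      f 0 + f (suc B) + (f 1 + f 1)                       ≈⟨ +-congˡ (char2 (f 1)) ⟩
      f 0 + f (suc B) + 0#                                ≈⟨ +-identityʳ _ ⟩
      f 0 + f (suc B)                                     ∎
      where
      l1 : ∀ a b c → a + b + (b + c) ≈ a + c + (b + b)
      l1 = solve 3 (λ a b c → a :+ b :+ (b :+ c) := a :+ c :+ (b :+ b)) ≈.refl

    -- Telescoping leaves `U c 0`, killed by its factor 1 + Q^0, and `U c M`, killed by the
    -- truncation.
    D-suc : ∀ c → D M c ≈ D M (suc c)
    D-suc c = +-cancel-char2 (begin
      D M c + D M (suc c)                    ≈⟨ ∑-+ M _ _ ⟩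
      ∑ M (λ m → t c m + t (suc c) m)        ≈⟨ ∑-cong M (λ m _ → t-diff c m) ⟩
      ∑ M (λ m → U c m + U c (suc m))        ≈⟨ telescope M (U c) ⟩
      U c 0 + U c M                          ≈⟨ +-cong
        (≈.trans (*-congˡ (≈.trans (*-congʳ (≈.trans (*-congʳ 1+X0) (zeroˡ _))) (zeroˡ _))) (zeroʳ _))
        (X-vanish _ (n≤n²+ M _)) ⟩
      0# + 0#                                ≈⟨ +-identityˡ 0# ⟩
      0#                                     ∎)

    D-const : ∀ c → D M c ≈ D M 0
    D-const zero    = ≈.refl
    D-const (suc c) = ≈.trans (≈.sym (D-suc c)) (D-const c)

    -- `A` is the sum of the given series with n replaced by n + 1 and a factor q removed. `Pent`
    -- pairs the pentagonal exponents r(3r + 1)/2 and (r + 1)(3r + 2)/2.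
    A L Pent : Carrier
    A    = ∑ M (λ n → X (n ℕ.* suc n) * V (suc n))
    L    = ∑ M (λ r → X (Tri r ℕ.+ r ℕ.* suc r) * W r * v r)
    Pent = ∑ M (λ r → X (Tri r) * (X (r ℕ.* r) + X (suc r ℕ.* suc r)))

    -- Since (r + j)(r + j + 1) = r(r + 1) + j² + (2r + 1)j, the sum over j in row r is the Durfee
    -- sum `D M` at 2r + 1, which does not depend on r.
    A≈DL : A ≈ D M 0 * L
    A≈DL = begin
      A
        ≈⟨ ∑-cong M (λ n _ → ≈.trans (*-congˡ (partialFractions n)) (≈.trans (anti-distribˡ n _ (f n))
             (anti-cong n λ r j e → ≈.reflexive (cong (λ z → X (z ℕ.* suc z) * f z r j) (sym e))))) ⟩
      ∑ M (λ n → anti n h)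
        ≈⟨ ∑-anti ℕₚ.≤-refl h (λ r j M≤ → X-vanish _ (ℕₚ.≤-trans M≤ (ℕₚ.m≤m*n (r ℕ.+ j) (suc (r ℕ.+ j))))) ⟩
      ∑ M (λ r → ∑ M (h r))
        ≈⟨ ∑-cong M (λ r _ → ≈.trans (∑-cong M (λ j _ → term r j)) (≈.sym (∑-distribˡ M (k r) (t (suc (2 ℕ.* r)))))) ⟩
      ∑ M (λ r → k r * D M (suc (2 ℕ.* r)))
        ≈⟨ ∑-cong M (λ r _ → ≈.trans (*-congˡ (D-const (suc (2 ℕ.* r)))) (*-comm _ _)) ⟩
      ∑ M (λ r → D M 0 * k r)
        ≈⟨ ∑-distribˡ M (D M 0) k ⟨
      D M 0 * L ∎
      where
      f : ℕ → ℕ → ℕ → Carrier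
      f n r j = X (Tri r) * W r * (p j * p (suc n ℕ.+ r)) * v r
      h : ℕ → ℕ → Carrier
      h r j = X ((r ℕ.+ j) ℕ.* suc (r ℕ.+ j)) * f (r ℕ.+ j) r j
      k : ℕ → Carrier
      k r = X (Tri r ℕ.+ r ℕ.* suc r) * W r * v r
      e1 : ∀ r j → (r ℕ.+ j) ℕ.* suc (r ℕ.+ j) ≡ r ℕ.* suc r ℕ.+ (j ℕ.* j ℕ.+ suc (2 ℕ.* r) ℕ.* j)
      e1 = ℕ-Solver.solve-∀
      e2 : ∀ r j → suc (r ℕ.+ j) ℕ.+ r ≡ j ℕ.+ suc (2 ℕ.* r)
      e2 = ℕ-Solver.solve-∀
      l1 : ∀ a b c w z v → a * b * (c * w * z * v) ≈ c * a * w * v * (b * z)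
      l1 = solve 6 (λ a b c w z v → a :* b :* (c :* w :* z :* v) := c :* a :* w :* v :* (b :* z)) ≈.refl
      term : ∀ r j → h r j ≈ k r * t (suc (2 ℕ.* r)) j
      term r j = begin
        h r j
          ≈⟨ *-cong (≈.trans (X-cong (e1 r j)) (X-+ _ _))
               (*-congʳ (*-congˡ (*-congˡ (≈.reflexive (cong p (e2 r j)))))) ⟩
        X (r ℕ.* suc r) * X (j ℕ.* j ℕ.+ suc (2 ℕ.* r) ℕ.* j) * (X (Tri r) * W r * (p j * p (j ℕ.+ suc (2 ℕ.* r))) * v r)
          ≈⟨ l1 _ _ _ _ _ _ ⟩
        X (Tri r) * X (r ℕ.* suc r) * W r * v r * t (suc (2 ℕ.* r)) j
          ≈⟨ *-congʳ (*-congʳ (*-congʳ (X-+ _ _))) ⟨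
        k r * t (suc (2 ℕ.* r)) j ∎

    -- The interchange used for `A`, now applied to the trivial sum of Q^(n²) `δ n`: row r splits
    -- into Durfee sums at 2r and 2r + 2, with the powers Q^(r²) and Q^((r+1)²) in front.
    D*Pent : 0 < M → D M 0 * Pent ≈ 1#
    D*Pent 0<M = ≈.sym (begin
      1#
        ≈⟨ unit 0<M ⟨
      ∑ M (λ n → X (n ℕ.* n) * δ n)
        ≈⟨ ∑-cong M (λ n _ → ≈.trans (*-congˡ (≈.sym (fold n))) (≈.trans (anti-distribˡ n _ (f n))
             (anti-cong n λ r j e → ≈.reflexive (cong (λ z → X (z ℕ.* z) * f z r j) (sym e))))) ⟩
      ∑ M (λ n → anti n h)
        ≈⟨ ∑-anti (ℕₚ.n≤1+n M) h (λ r j M≤ → X-vanish _ (ℕₚ.≤-trans M≤ (ℕₚ.≤-trans (n≤n²+ (r ℕ.+ j) 0) (ℕₚ.≤-reflexive (ℕₚ.+-identityʳ _))))) ⟩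
      ∑ M (λ r → ∑ (suc M) (h r))
        ≈⟨ ∑-cong M (λ r _ → row r) ⟩
      ∑ M (λ r → D M 0 * (X (Tri r) * (X (r ℕ.* r) + X (suc r ℕ.* suc r))))
        ≈⟨ ∑-distribˡ M (D M 0) _ ⟨
      D M 0 * Pent ∎)
      where
      unit : ∀ {M} → 0 < M → ∑ M (λ n → X (n ℕ.* n) * δ n) ≈ 1#
      unit {suc M} _ = ≈.trans (+-cong (≈.trans (*-identityʳ _) X-0) (∑-zero M (λ i _ → zeroʳ _))) (+-identityʳ 1#)
      f : ℕ → ℕ → ℕ → Carrier
      f n r j = X (Tri r) * ((1# + X j) * p j * p (suc n ℕ.+ r) + p j * p (n ℕ.+ r))
      h h₁ h₂ : ℕ → ℕ → Carrier
      h r j = X ((r ℕ.+ j) ℕ.* (r ℕ.+ j)) * f (r ℕ.+ j) r j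
      h₁ r j = X (Tri r) * (X ((r ℕ.+ j) ℕ.* (r ℕ.+ j)) * ((1# + X j) * p j * p (suc (r ℕ.+ j) ℕ.+ r)))
      h₂ r j = X (Tri r) * X (r ℕ.* r) * t (2 ℕ.* r) j
      e1 : ∀ r j → (r ℕ.+ j) ℕ.* (r ℕ.+ j) ≡ r ℕ.* r ℕ.+ (j ℕ.* j ℕ.+ 2 ℕ.* r ℕ.* j)
      e1 = ℕ-Solver.solve-∀
      e2 : ∀ r j → (r ℕ.+ j) ℕ.+ r ≡ j ℕ.+ 2 ℕ.* r
      e2 = ℕ-Solver.solve-∀
      e3 : ∀ r j → (r ℕ.+ suc j) ℕ.* (r ℕ.+ suc j) ≡ suc r ℕ.* suc r ℕ.+ (j ℕ.* j ℕ.+ suc (suc (2 ℕ.* r)) ℕ.* j)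
      e3 = ℕ-Solver.solve-∀
      e4 : ∀ r j → suc (r ℕ.+ suc j) ℕ.+ r ≡ j ℕ.+ suc (suc (2 ℕ.* r))
      e4 = ℕ-Solver.solve-∀
      l1 : ∀ a c x y → a * (c * (x + y)) ≈ c * (a * x) + c * (a * y)
      l1 = solve 4 (λ a c x y → a :* (c :* (x :+ y)) := c :* (a :* x) :+ c :* (a :* y)) ≈.refl
      l2 : ∀ a b c x → c * (a * b * x) ≈ c * a * (b * x)
      l2 = solve 4 (λ a b c x → c :* (a :* b :* x) := c :* a :* (b :* x)) ≈.refl
      l3 : ∀ a b c → a * (b * (0# * 1# * c)) ≈ 0#
      l3 = solve 3 (λ a b c → a :* (b :* (con 0 :* con 1 :* c)) := con 0) ≈.refl
      l4 : ∀ a b c d → a * b * d + a * c * d ≈ d * (a * (c + b))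
      l4 = solve 4 (λ a b c d → a :* b :* d :+ a :* c :* d := d :* (a :* (c :+ b))) ≈.refl
      split : ∀ r j → h r j ≈ h₁ r j + h₂ r j
      split r j = ≈.trans (l1 _ _ _ _) (+-congˡ (≈.trans
        (*-congˡ (*-cong (≈.trans (X-cong (e1 r j)) (X-+ _ _)) (*-congˡ (≈.reflexive (cong p (e2 r j))))))
        (l2 _ _ _ _)))
      h₁-suc : ∀ r j → h₁ r (suc j) ≈ X (Tri r) * X (suc r ℕ.* suc r) * t (suc (suc (2 ℕ.* r))) j
      h₁-suc r j = ≈.trans
        (*-congˡ (*-cong (≈.trans (X-cong (e3 r j)) (X-+ _ _))
          (*-cong (p-suc j) (≈.reflexive (cong p (e4 r j))))))
        (l2 _ _ _ _)
      row : ∀ r → ∑ (suc M) (h r) ≈ D M 0 * (X (Tri r) * (X (r ℕ.* r) + X (suc r ℕ.* suc r)))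
      row r = begin
        ∑ (suc M) (h r)
          ≈⟨ ∑-cong (suc M) (λ j _ → split r j) ⟩
        ∑ (suc M) (λ j → h₁ r j + h₂ r j)
          ≈⟨ ∑-+ (suc M) (h₁ r) (h₂ r) ⟨
        -- The factor 1 + Q^j kills the term j = 0 of `h₁`; shifting j by one turns the Durfee
        -- parameter 2r into 2r + 2, and the range `suc M` leaves exactly M terms.
        h₁ r 0 + ∑ M (λ j → h₁ r (suc j)) + ∑ (suc M) (h₂ r)
          ≈⟨ +-cong (+-cong (≈.trans (*-congˡ (*-congˡ (*-congʳ (*-congʳ 1+X0)))) (l3 _ _ _))
               (∑-cong M (λ j _ → h₁-suc r j))) (≈.sym (∑-distribˡ (suc M) _ (t (2 ℕ.* r)))) ⟩
        0# + ∑ M (λ j → X (Tri r) * X (suc r ℕ.* suc r) * t (suc (suc (2 ℕ.* r))) j)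
           + X (Tri r) * X (r ℕ.* r) * D (suc M) (2 ℕ.* r)
          ≈⟨ +-cong (≈.trans (+-identityˡ _) (≈.sym (∑-distribˡ M _ (t (suc (suc (2 ℕ.* r)))))))
               (*-congˡ (≈.sym (∑-extend (t (2 ℕ.* r)) (ℕₚ.n≤1+n M)
                 (λ m M≤m → X-vanish _ (ℕₚ.≤-trans M≤m (n≤n²+ m _)))))) ⟩
        X (Tri r) * X (suc r ℕ.* suc r) * D M (suc (suc (2 ℕ.* r))) + X (Tri r) * X (r ℕ.* r) * D M (2 ℕ.* r)
          ≈⟨ +-cong (*-congˡ (D-const (suc (suc (2 ℕ.* r))))) (*-congˡ (D-const (2 ℕ.* r))) ⟩
        X (Tri r) * X (suc r ℕ.* suc r) * D M 0 + X (Tri r) * X (r ℕ.* r) * D M 0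
          ≈⟨ l4 _ _ _ _ ⟩
        D M 0 * (X (Tri r) * (X (r ℕ.* r) + X (suc r ℕ.* suc r))) ∎

    A*Pent : 0 < M → A * Pent ≈ L
    A*Pent 0<M = begin
      A * Pent           ≈⟨ *-congʳ A≈DL ⟩
      D M 0 * L * Pent   ≈⟨ l1 (D M 0) L Pent ⟩
      L * (D M 0 * Pent) ≈⟨ *-congˡ (D*Pent 0<M) ⟩
      L * 1#             ≈⟨ *-identityʳ L ⟩
      L                  ∎
      where
      l1 : ∀ a b c → a * b * c ≈ b * (a * c)
      l1 = solve 3 (λ a b c → a :* b :* c := b :* (a :* c)) ≈.refl

-- Power series over the field with two elements

Ser : Set
Ser = ℕ → Bool

infixl 7 _·_
infixl 6 _⊕_

_⊕_ : Ser → Ser → Ser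
(f ⊕ g) m = f m xor g m

_·_ : Ser → Ser → Ser
(f · g) zero    = f 0 ∧ g 0
(f · g) (suc m) = (f 0 ∧ g (suc m)) xor (f ∘ suc · g) m

𝟎 𝟏 : Ser
𝟎 m = false
𝟏 zero    = true
𝟏 (suc m) = false

mono : ℕ → Ser
mono zero    m       = 𝟏 m
mono (suc e) zero    = false
mono (suc e) (suc m) = mono e m

·-cong≤ : ∀ {f f′ g g′ : Ser} m → (∀ i → i ≤ m → f i ≡ f′ i) → (∀ i → i ≤ m → g i ≡ g′ i) → (f · g) m ≡ (f′ · g′) m
·-cong≤ zero    p q = cong₂ _∧_ (p 0 z≤n) (q 0 z≤n)
·-cong≤ (suc m) p q = cong₂ _xor_ (cong₂ _∧_ (p 0 z≤n) (q (suc m) ℕₚ.≤-refl))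
  (·-cong≤ m (λ i i≤m → p (suc i) (s≤s i≤m)) (λ i i≤m → q i (ℕₚ.m≤n⇒m≤1+n i≤m)))

xor-interchange : ∀ a b c d → (a xor b) xor (c xor d) ≡ (a xor c) xor (b xor d)
xor-interchange false false c d = refl
xor-interchange false true  c d = not-distribʳ-xor c d
xor-interchange true  false c d = not-distribˡ-xor c d
xor-interchange true  true  c d = trans (sym (not-involutive _)) (trans (cong not (not-distribˡ-xor c d)) (not-distribʳ-xor (not c) d))

·-distribʳ : ∀ h f g m → ((f ⊕ g) · h) m ≡ ((f · h) ⊕ (g · h)) m
·-distribʳ h f g zero    = ∧-distribʳ-xor (h 0) (f 0) (g 0)
·-distribʳ h f g (suc m) = trans (cong₂ _xor_ (∧-distribʳ-xor (h (suc m)) (f 0) (g 0)) (·-distribʳ h (f ∘ suc) (g ∘ suc) m))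
  (xor-interchange (f 0 ∧ h (suc m)) _ _ _)

·-last : ∀ f g m → (f · g) (suc m) ≡ (f · g ∘ suc) m xor (f (suc m) ∧ g 0)
·-last f g zero    = refl
·-last f g (suc m) = trans (cong ((f 0 ∧ g (suc (suc m))) xor_) (·-last (f ∘ suc) g m))
  (sym (xor-assoc (f 0 ∧ g (suc (suc m))) _ _))

·-comm : ∀ f g m → (f · g) m ≡ (g · f) m
·-comm f g zero    = ∧-comm (f 0) (g 0)
·-comm f g (suc m) = trans (cong₂ _xor_ (∧-comm (f 0) (g (suc m))) (·-comm (f ∘ suc) g m))
  (trans (xor-comm (g (suc m) ∧ f 0) _) (sym (·-last g f m)))

scale-· : ∀ b f g m → ((λ i → b ∧ f i) · g) m ≡ b ∧ (f · g) m
scale-· b f g zero    = ∧-assoc b (f 0) (g 0)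
scale-· b f g (suc m) = trans (cong₂ _xor_ (∧-assoc b (f 0) (g (suc m))) (scale-· b (f ∘ suc) g m))
  (sym (∧-distribˡ-xor b (f 0 ∧ g (suc m)) _))

·-assoc : ∀ f g h m → ((f · g) · h) m ≡ (f · (g · h)) m
·-assoc f g h zero    = ∧-assoc (f 0) (g 0) (h 0)
·-assoc f g h (suc m) = begin
  ((f 0 ∧ g 0) ∧ h (suc m)) xor ((λ i → (f 0 ∧ g (suc i)) xor (f ∘ suc · g) i) · h) m
    ≡⟨ cong₂ _xor_ (∧-assoc (f 0) (g 0) _) (·-distribʳ h (λ i → f 0 ∧ g (suc i)) (f ∘ suc · g) m) ⟩
  (f 0 ∧ (g 0 ∧ h (suc m))) xor (((λ i → f 0 ∧ g (suc i)) · h) m xor ((f ∘ suc · g) · h) m)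
    ≡⟨ xor-assoc (f 0 ∧ (g 0 ∧ h (suc m))) _ _ ⟨
  ((f 0 ∧ (g 0 ∧ h (suc m))) xor ((λ i → f 0 ∧ g (suc i)) · h) m) xor ((f ∘ suc · g) · h) m
    ≡⟨ cong₂ _xor_ (trans (cong ((f 0 ∧ (g 0 ∧ h (suc m))) xor_) (scale-· (f 0) (g ∘ suc) h m))
         (sym (∧-distribˡ-xor (f 0) _ _))) (·-assoc (f ∘ suc) g h m) ⟩
  (f · (g · h)) (suc m) ∎
  where open ≡-Reasoning

𝟎·-zero : ∀ f m → (𝟎 · f) m ≡ false
𝟎·-zero f zero    = refl
𝟎·-zero f (suc m) = 𝟎·-zero f m

𝟏·-identity : ∀ f m → (𝟏 · f) m ≡ f m
𝟏·-identity f zero    = refl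
𝟏·-identity f (suc m) = trans (cong (f (suc m) xor_) (𝟎·-zero f m)) (xor-identityʳ _)

mono-shift : ∀ e f i → (mono e · f) (e ℕ.+ i) ≡ f i
mono-shift zero    f i = 𝟏·-identity f i
mono-shift (suc e) f i = mono-shift e f i

mono-< : ∀ e f {m} → m < e → (mono e · f) m ≡ false
mono-< (suc e) f {zero}  _         = refl
mono-< (suc e) f {suc m} (s≤s m<e) = mono-< e f m<e

mono-+ : ∀ a b m → mono (a ℕ.+ b) m ≡ (mono a · mono b) m
mono-+ zero    b m       = sym (𝟏·-identity (mono b) m)
mono-+ (suc a) b zero    = refl
mono-+ (suc a) b (suc m) = mono-+ a b m

mono-refl : ∀ e → mono e e ≡ true
mono-refl zero    = refl
mono-refl (suc e) = mono-refl e

mono-≢ : ∀ {e m} → e ≢ m → mono e m ≡ false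
mono-≢ {zero}  {zero}  ne = ⊥-elim (ne refl)
mono-≢ {zero}  {suc m} ne = refl
mono-≢ {suc e} {zero}  ne = refl
mono-≢ {suc e} {suc m} ne = mono-≢ (ne ∘ cong suc)

-- Equality of power series modulo q^M
module Truncated (M : ℕ) where

  infix 4 _≈_
  _≈_ : Ser → Ser → Set
  f ≈ g = ∀ m → m < M → f m ≡ g m

  below : ∀ {f g : Ser} → f ≈ g → ∀ {m} → m < M → ∀ i → i ≤ m → f i ≡ g i
  below p m<M i i≤m = p i (ℕₚ.≤-<-trans i≤m m<M)

  -- Truncating the equality instead of the carrier keeps the coefficient functions independent of
  -- M, and makes every q^k with k ≥ M equal to zero, as `Lambert` requires.
  series : CommutativeRing 0ℓ 0ℓ
  series = record
    { Carrier = Ser ; _≈_ = _≈_ ; _+_ = _⊕_ ; _*_ = _·_ ; -_ = id ; 0# = 𝟎 ; 1# = 𝟏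
    ; isCommutativeRing = record
      { isRing = record
        { +-isAbelianGroup = record
          { isGroup = record
            { isMonoid = record
              { isSemigroup = record
                { isMagma = record
                  { isEquivalence = record
                    { refl = λ _ _ → refl ; sym = λ p m l → sym (p m l) ; trans = λ p q m l → trans (p m l) (q m l) }
                  ; ∙-cong = λ p q m l → cong₂ _xor_ (p m l) (q m l) }
                ; assoc = λ f g h m _ → xor-assoc (f m) (g m) (h m) }
              ; identity = (λ f m _ → refl) , (λ f m _ → xor-identityʳ (f m)) }
            ; inverse = (λ f m _ → xor-same (f m)) , (λ f m _ → xor-same (f m))
            ; ⁻¹-cong = id }
          ; comm = λ f g m _ → xor-comm (f m) (g m) }
        ; *-cong = λ p q m l → ·-cong≤ m (below p l) (below q l)
        ; *-assoc = λ f g h m _ → ·-assoc f g h m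
        ; *-identity = (λ f m _ → 𝟏·-identity f m) , (λ f m _ → trans (·-comm f 𝟏 m) (𝟏·-identity f m))
        ; distrib = (λ f g h m _ → trans (·-comm f (g ⊕ h) m) (trans (·-distribʳ f g h m)
                       (cong₂ _xor_ (·-comm g f m) (·-comm h f m))))
                  , (λ f g h m _ → ·-distribʳ f g h m) }
      ; *-comm = λ f g m _ → ·-comm f g m } }

-- Reduction of integer series modulo 2

oddℤ : ℤ → Bool
oddℤ i = odd ℤ.∣ i ∣

odd-* : ∀ m n → odd (m ℕ.* n) ≡ odd m ∧ odd n
odd-* zero    n = refl
odd-* (suc m) n = trans (odd-+ n (m ℕ.* n)) (trans (cong (odd n xor_) (odd-* m n)) (lemma (odd m) (odd n)))
  where
  lemma : ∀ b c → c xor (b ∧ c) ≡ not b ∧ c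
  lemma true  c = xor-same c
  lemma false c = xor-identityʳ c

odd-⊖ : ∀ m n → oddℤ (m ℤ.⊖ n) ≡ odd m xor odd n
odd-⊖ zero    zero    = refl
odd-⊖ zero    (suc n) = refl
odd-⊖ (suc m) zero    = sym (xor-identityʳ _)
odd-⊖ (suc m) (suc n) = trans (cong oddℤ (ℤₚ.[1+m]⊖[1+n]≡m⊖n m n)) (trans (odd-⊖ m n)
  (trans (sym (not-involutive _)) (trans (cong not (not-distribˡ-xor (odd m) (odd n))) (not-distribʳ-xor (not (odd m)) (odd n)))))

oddℤ-+ : ∀ i j → oddℤ (i ℤ.+ j) ≡ oddℤ i xor oddℤ j
oddℤ-+ (+ m)    (+ n)    = odd-+ m n
oddℤ-+ (+ m)    -[1+ n ] = odd-⊖ m (suc n)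
oddℤ-+ -[1+ m ] (+ n)    = trans (odd-⊖ n (suc m)) (xor-comm (odd n) _)
oddℤ-+ -[1+ m ] -[1+ n ] = trans (not-involutive _) (trans (odd-+ m n)
  (trans (sym (not-involutive _)) (trans (cong not (not-distribˡ-xor (odd m) (odd n))) (not-distribʳ-xor (not (odd m)) (odd n)))))

oddℤ-* : ∀ i j → oddℤ (i ℤ.* j) ≡ oddℤ i ∧ oddℤ j
oddℤ-* i j = trans (cong odd (ℤₚ.abs-* i j)) (odd-* ℤ.∣ i ∣ ℤ.∣ j ∣)

sumBelow-front : ∀ n f → oddℤ (sumBelow (suc n) f) ≡ oddℤ (f 0) xor oddℤ (sumBelow n (f ∘ suc))
sumBelow-front zero    f = trans (oddℤ-+ (+ 0) (f 0)) (sym (xor-identityʳ _))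
sumBelow-front (suc n) f = begin
  oddℤ (sumBelow (suc n) f ℤ.+ f (suc n))                        ≡⟨ oddℤ-+ (sumBelow (suc n) f) _ ⟩
  oddℤ (sumBelow (suc n) f) xor oddℤ (f (suc n))                 ≡⟨ cong (_xor oddℤ (f (suc n))) (sumBelow-front n f) ⟩
  (oddℤ (f 0) xor oddℤ (sumBelow n (f ∘ suc))) xor oddℤ (f (suc n))
                                                                 ≡⟨ xor-assoc (oddℤ (f 0)) _ _ ⟩
  oddℤ (f 0) xor (oddℤ (sumBelow n (f ∘ suc)) xor oddℤ (f (suc n)))
                                                                 ≡⟨ cong (oddℤ (f 0) xor_) (oddℤ-+ (sumBelow n (f ∘ suc)) _) ⟨
  oddℤ (f 0) xor oddℤ (sumBelow (suc n) (f ∘ suc))               ∎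
  where open ≡-Reasoning

odd-⊛ : ∀ f g m → oddℤ ((f ⊛ g) m) ≡ (oddℤ ∘ f · oddℤ ∘ g) m
odd-⊛ f g zero    = trans (cong oddℤ (ℤₚ.+-identityˡ (f 0 ℤ.* g 0))) (oddℤ-* (f 0) (g 0))
odd-⊛ f g (suc m) = trans (sumBelow-front (suc m) (λ i → f i ℤ.* g (suc m ℕ.∸ i)))
  (cong₂ _xor_ (oddℤ-* (f 0) (g (suc m))) (odd-⊛ (f ∘ suc) g m))

odd-one : ∀ m → oddℤ (one m) ≡ 𝟏 m
odd-one zero    = refl
odd-one (suc m) = refl

odd-shift : ∀ e f m → oddℤ (shift e f m) ≡ (mono e · oddℤ ∘ f) m
odd-shift e f m with e ℕ.≤? m
... | yes e≤m = trans (cong branch (dec-true (e ℕ.≤? m) e≤m))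
  (trans (sym (mono-shift e (oddℤ ∘ f) (m ℕ.∸ e))) (cong (mono e · oddℤ ∘ f) (ℕₚ.m+[n∸m]≡n e≤m)))
  where
  branch : Bool → Bool
  branch b = oddℤ (if b then f (m ℕ.∸ e) else + 0)
... | no  e≰m = trans (cong branch (dec-false (e ℕ.≤? m) e≰m)) (sym (mono-< e (oddℤ ∘ f) (ℕₚ.≰⇒> e≰m)))
  where
  branch : Bool → Bool
  branch b = oddℤ (if b then f (m ℕ.∸ e) else + 0)

geom : ℕ → Ser
geom b m = does (suc b ∣? m)

odd-geomInv : ∀ b m → oddℤ (geomInv b m) ≡ geom b m
odd-geomInv b m with does (suc b ∣? m)
... | true  = refl
... | false = refl

does-⇔ : ∀ {A B : Set} (a : Dec A) (b : Dec B) → (A → B) → (B → A) → does a ≡ does b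
does-⇔ (yes a) b f g = sym (dec-true b (f a))
does-⇔ (no ¬a) b f g = sym (dec-false b (¬a ∘ g))

geom-inverse : ∀ b m → ((𝟏 ⊕ mono (suc b)) · geom b) m ≡ 𝟏 m
geom-inverse b m = trans (·-distribʳ (geom b) 𝟏 (mono (suc b)) m)
  (trans (cong (_xor (mono (suc b) · geom b) m) (𝟏·-identity (geom b) m)) (go m))
  where
  step : ∀ i → geom b (suc b ℕ.+ i) ≡ geom b i
  step i = does-⇔ (suc b ∣? (suc b ℕ.+ i)) (suc b ∣? i)
    (λ d → ℕ∣.∣m+n∣m⇒∣n d ℕ∣.∣-refl) (ℕ∣.∣m∣n⇒∣m+n ℕ∣.∣-refl)
  go : ∀ m → geom b m xor (mono (suc b) · geom b) m ≡ 𝟏 m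
  go m with suc b ℕ.≤? m
  ... | yes b<m with m ℕ.∸ suc b | ℕₚ.m+[n∸m]≡n b<m
  ...   | i | refl = trans (cong₂ _xor_ (step i) (mono-shift (suc b) (geom b) i)) (xor-same (geom b i))
  go zero    | no _   = trans (cong (_xor false) (dec-true (suc b ∣? 0) (divides 0 refl))) refl
  go (suc m) | no b≮m = cong₂ _xor_ (dec-false (suc b ∣? suc m) (λ d → b≮m (ℕ∣.∣⇒≤ d)))
    (mono-< (suc b) (geom b) (ℕₚ.≰⇒> b≮m))

-- Sets counted by power series

-- Nothing is demanded for weights from M on, so a finite sum of series can stand for an infinite
-- family.
Gen : ℕ → {A : Set} → (A → ℕ) → Ser → Set₁
Gen M wt F = ∀ m → m < M → Cnt (λ a → wt a ≡ m) (F m)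

cnt-subst : ∀ {A : Set} {P : A → Set} {b c} → b ≡ c → Cnt P b → Cnt P c
cnt-subst refl c = c

infixr 4 _⊠_
_⊠_ : {A B : Set} → (A → Set) → (B → Set) → A × B → Set
(P ⊠ Q) z = P (proj₁ z) × Q (proj₂ z)

card-× : ∀ {A B : Set} {P : A → Set} {Q : B → Set} {m n} → DecidableEquality A →
  Card P m → Card Q n → Card (P ⊠ Q) (m ℕ.* n)
card-× _≟_ (empty e) d = empty λ z pq → e (proj₁ z) (proj₁ pq)
card-× {A} {B} {P} {Q} _≟_ (insert a pa c) d = card-resp {P = λ z → R z ⊎ S z} {Q = P ⊠ Q}
  (λ { (inj₁ (refl , q)) → pa , q ; (inj₂ ((p , _) , q)) → p , q })
  (λ { {x , _} (p , q) → split x p q })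
  (card-⊎ {P = R} {Q = S} (λ { (refl , _) ((_ , ne) , _) → ne refl })
    (card-bij {P = Q} {Q = R} (a ,_) proj₂ (refl ,_) proj₂ (λ _ → refl) (λ { (refl , _) → refl }) d)
    (card-× _≟_ c d))
  where
  R S : A × B → Set
  R = (_≡ a) ⊠ Q
  S = (λ x → P x × x ≢ a) ⊠ Q
  split : ∀ x {b} → P x → Q b → R (x , b) ⊎ S (x , b)
  split x p q with x ≟ a
  ... | yes e = inj₁ (e , q)
  ... | no ne = inj₂ ((p , ne) , q)

cnt-× : ∀ {A B : Set} {P : A → Set} {Q : B → Set} {b c} → DecidableEquality A →
  Cnt P b → Cnt Q c → Cnt (P ⊠ Q) (b ∧ c)
cnt-× _≟_ (m , c , refl) (n , d , refl) = m ℕ.* n , card-× _≟_ c d , odd-* m n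

Conv : {A B : Set} → (ℕ → A → Set) → (ℕ → B → Set) → ℕ → A × B → Set
Conv P Q m z = Σ ℕ λ i → Σ ℕ λ j → i ℕ.+ j ≡ m × P i (proj₁ z) × Q j (proj₂ z)

-- Follows the recursion of `·`, peeling off the pairs whose first weight is 0; as each element has
-- a single weight, the layers are disjoint.
cnt-· : ∀ {A B : Set} (_≟_ : DecidableEquality A) (P : ℕ → A → Set) (Q : ℕ → B → Set) {F G : Ser} m →
  (∀ {i j a} → P i a → P j a → i ≡ j) →
  (∀ i → i ≤ m → Cnt (P i) (F i)) → (∀ i → i ≤ m → Cnt (Q i) (G i)) →
  Cnt (Conv P Q m) ((F · G) m)
cnt-· _≟_ P Q zero uniq cP cQ = cnt-resp {P = P 0 ⊠ Q 0} {Q = Conv P Q 0}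
  (λ { (p , q) → 0 , 0 , refl , p , q }) (λ { (0 , 0 , refl , p , q) → p , q })
  (cnt-× _≟_ (cP 0 z≤n) (cQ 0 z≤n))
cnt-· _≟_ P Q (suc m) uniq cP cQ = cnt-resp {P = λ z → (P 0 ⊠ Q (suc m)) z ⊎ Conv (P ∘ suc) Q m z} {Q = Conv P Q (suc m)}
  (λ { (inj₁ (p , q)) → 0 , suc m , refl , p , q
     ; (inj₂ (i , j , e , p , q)) → suc i , j , cong suc e , p , q })
  (λ { (zero , _ , refl , p , q) → inj₁ (p , q)
     ; (suc i , j , e , p , q) → inj₂ (i , j , ℕₚ.suc-injective e , p , q) })
  (cnt-⊎ {P = P 0 ⊠ Q (suc m)} {Q = Conv (P ∘ suc) Q m}
    (λ { (p , _) (_ , _ , _ , p′ , _) → contradiction (uniq p p′) λ () })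
    (cnt-× _≟_ (cP 0 z≤n) (cQ (suc m) ℕₚ.≤-refl))
    (cnt-· _≟_ (P ∘ suc) Q m (λ p p′ → ℕₚ.suc-injective (uniq p p′))
      (λ i i≤m → cP (suc i) (s≤s i≤m)) (λ i i≤m → cQ i (ℕₚ.m≤n⇒m≤1+n i≤m))))

gen-· : ∀ {M} {A B : Set} {wA : A → ℕ} {wB : B → ℕ} {F G} → DecidableEquality A →
  Gen M wA F → Gen M wB G → Gen M (λ z → wA (proj₁ z) ℕ.+ wB (proj₂ z)) (F · G)
gen-· {wA = wA} {wB} _≟_ gF gG m m<M =
  cnt-resp {P = Conv (λ i a → wA a ≡ i) (λ j b → wB b ≡ j) m}
  (λ { (_ , _ , refl , refl , refl) → refl }) (λ { refl → _ , _ , refl , refl , refl })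
  (cnt-· _≟_ (λ i a → wA a ≡ i) (λ j b → wB b ≡ j) m (λ { refl refl → refl })
    (λ i i≤m → gF i (ℕₚ.≤-<-trans i≤m m<M)) (λ i i≤m → gG i (ℕₚ.≤-<-trans i≤m m<M)))

gen-mono· : ∀ {M} {A : Set} {wt : A → ℕ} {F} e → Gen M wt F → Gen M (λ a → e ℕ.+ wt a) (mono e · F)
gen-mono· {F = F} e g m m<M with e ℕ.≤? m
... | no e≰m = cnt-subst (sym (mono-< e F (ℕₚ.≰⇒> e≰m))) (cnt-empty λ { a refl → e≰m (ℕₚ.m≤m+n e _) })
... | yes e≤m with m ℕ.∸ e | ℕₚ.m+[n∸m]≡n e≤m
...   | i | refl = cnt-subst (sym (mono-shift e F i))
  (cnt-resp (cong (e ℕ.+_)) (ℕₚ.+-cancelˡ-≡ e _ _) (g i (ℕₚ.≤-<-trans (ℕₚ.m≤n+m i e) m<M)))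

gen-geom : ∀ {M} b → Gen M (λ j → j ℕ.* suc b) (geom b)
gen-geom b m m<M with suc b ∣? m
... | yes (divides j e) = cnt-subst (sym (dec-true (suc b ∣? m) (divides j e)))
  (cnt-singleton j (sym e) (λ e′ → ℕₚ.*-cancelʳ-≡ _ _ (suc b) (trans e′ e)))
... | no ∤m = cnt-subst (sym (dec-false (suc b ∣? m) ∤m)) (cnt-empty λ j e → ∤m (divides j (sym e)))

Image : {A B : Set} → (A → B) → (A → Set) → B → Set
Image {A} f P y = Σ A λ x → f x ≡ y × P x

cnt-Image : ∀ {A B : Set} {P : A → Set} {b} (f : A → B) → (∀ {x x′} → f x ≡ f x′ → x ≡ x′) →
  Cnt P b → Cnt (Image f P) b
cnt-Image {P = P} f inj = cnt-image {P = P} {Q = Image f P} f (λ p → _ , refl , p) (λ _ _ → inj)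
  (λ { (x , e , p) → x , p , e })

gen-⊕ : ∀ {M} {A B : Set} {wA : A → ℕ} {wB : B → ℕ} {F G} → Gen M wA F → Gen M wB G → Gen M [ wA , wB ]′ (F ⊕ G)
gen-⊕ {A = A} {B} {wA} {wB} gF gG m m<M =
  cnt-resp {P = λ z → L z ⊎ R z} {Q = λ z → [ wA , wB ]′ z ≡ m}
  (λ { (inj₁ (_ , refl , e)) → e ; (inj₂ (_ , refl , e)) → e })
  (λ { {inj₁ a} e → inj₁ (a , refl , e) ; {inj₂ b} e → inj₂ (b , refl , e) })
  (cnt-⊎ {P = L} {Q = R} (λ { (_ , refl , _) (_ , () , _) })
    (cnt-Image inj₁ (λ { refl → refl }) (gF m m<M)) (cnt-Image inj₂ (λ { refl → refl }) (gG m m<M)))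
  where
  L R : A ⊎ B → Set
  L = Image inj₁ (λ a → wA a ≡ m)
  R = Image inj₂ (λ b → wB b ≡ m)

gen-𝟏 : ∀ {M} {A : Set} {wt : A → ℕ} {F} → (a : A) → (∀ b → b ≡ a) → (∀ m → F m ≡ mono (wt a) m) → Gen M wt F
gen-𝟏 {wt = wt} a uniq eq m m<M with wt a ℕ.≟ m
... | yes refl = cnt-subst (sym (trans (eq _) (mono-refl (wt a)))) (cnt-singleton a refl (λ {x} _ → uniq x))
... | no ne = cnt-subst (sym (trans (eq m) (mono-≢ ne))) (cnt-empty λ b e → ne (trans (cong wt (sym (uniq b))) e))

module GenSum (M : ℕ) where
  open Sums (Truncated.series M) using (∑)

  Below : {A : Set} → ℕ → (ℕ → A → Set) → ℕ × A → Set
  Below N P z = proj₁ z < N × P (proj₁ z) (proj₂ z)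

  cnt-∑ : ∀ {A : Set} N (P : ℕ → A → Set) (F : ℕ → Ser) m → (∀ k → Cnt (P k) (F k m)) →
    Cnt (Below N P) (∑ N F m)
  cnt-∑ zero    P F m c = cnt-empty λ { _ (() , _) }
  cnt-∑ {A} (suc N) P F m c = cnt-resp {P = λ z → H z ⊎ K z} {Q = Below (suc N) P}
    (λ { (inj₁ (_ , refl , e)) → s≤s z≤n , e ; (inj₂ (_ , refl , k<N , e)) → s≤s k<N , e })
    (λ { {zero , a} (_ , e) → inj₁ (a , refl , e) ; {suc k , a} (s≤s k<N , e) → inj₂ ((k , a) , refl , k<N , e) })
    (cnt-⊎ {P = H} {Q = K} (λ { (_ , refl , _) (_ , () , _) })
      (cnt-Image (0 ,_) (λ { refl → refl }) (c 0))
      (cnt-Image next (λ { refl → refl }) (cnt-∑ N (P ∘ suc) (F ∘ suc) m (c ∘ suc))))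
    where
    next : ℕ × A → ℕ × A
    next z = suc (proj₁ z) , proj₂ z
    H K : ℕ × A → Set
    H = Image (0 ,_) (P 0)
    K = Image next (Below N (P ∘ suc))

  -- Because `k ≤ wt k a`, an element of weight below M has index below M, and cutting the sum at M
  -- loses nothing.
  gen-∑ : ∀ {A : Set} (wt : ℕ → A → ℕ) (F : ℕ → Ser) → (∀ k a → k ≤ wt k a) → (∀ k → Gen M (wt k) (F k)) →
    Gen M (λ z → wt (proj₁ z) (proj₂ z)) (∑ M F)
  gen-∑ {A} wt F k≤ g m m<M = cnt-resp {P = Below M P} {Q = λ z → wt (proj₁ z) (proj₂ z) ≡ m} proj₂
    (λ { {k , a} e → ℕₚ.≤-<-trans (ℕₚ.≤-trans (k≤ k a) (ℕₚ.≤-reflexive e)) m<M , e })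
    (cnt-∑ M P F m (λ k → g k m m<M))
    where
    P : ℕ → A → Set
    P k a = wt k a ≡ m

  -- A sum over all integers, with k and -1 - k paired.
  θ : (ℤ → ℕ) → Ser
  θ w = ∑ M (λ k → mono (w (+ k)) ⊕ mono (w -[1+ k ]))

  gen-θ : ∀ w → (∀ k → k ≤ w (+ k)) → (∀ k → k ≤ w -[1+ k ]) → Gen M w (θ w)
  gen-θ w w₁ w₂ m m<M = cnt-bij {P = λ z → w (f z) ≡ m} {Q = λ κ → w κ ≡ m} f g
    id (λ {κ} e → trans (cong w (fg κ)) e) (λ {z} _ → gf z) (λ {κ} _ → fg κ)
    (cnt-resp {P = λ z → wt (proj₁ z) (proj₂ z) ≡ m} {Q = λ z → w (f z) ≡ m}
      (λ { {_ , inj₁ _} e → e ; {_ , inj₂ _} e → e }) (λ { {_ , inj₁ _} e → e ; {_ , inj₂ _} e → e })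
      (gen-∑ wt _ (λ { k (inj₁ _) → w₁ k ; k (inj₂ _) → w₂ k })
        (λ k → gen-⊕ (gen-𝟏 tt (λ _ → refl) (λ _ → refl)) (gen-𝟏 tt (λ _ → refl) (λ _ → refl))) m m<M))
    where
    wt : ℕ → ⊤ ⊎ ⊤ → ℕ
    wt k = [ (λ _ → w (+ k)) , (λ _ → w -[1+ k ]) ]′
    f : ℕ × (⊤ ⊎ ⊤) → ℤ
    f (k , inj₁ _) = + k
    f (k , inj₂ _) = -[1+ k ]
    g : ℤ → ℕ × (⊤ ⊎ ⊤)
    g (+ k)    = k , inj₁ tt
    g -[1+ k ] = k , inj₂ tt
    fg : ∀ κ → f (g κ) ≡ κ
    fg (+ k)    = refl
    fg -[1+ k ] = refl
    gf : ∀ z → g (f z) ≡ z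
    gf (k , inj₁ tt) = refl
    gf (k , inj₂ tt) = refl

-- The generating function modulo 2

-- 3κ(3κ + 1), as a natural number
w₁ : ℤ → ℕ
w₁ (+ k)    = 6 ℕ.* (Tri k ℕ.+ k ℕ.* k)
w₁ -[1+ k ] = 6 ℕ.* (Tri k ℕ.+ suc k ℕ.* suc k)

-- This is 9r² + 9r + 1, the order of the r-th term of q times the Lambert series.
lowest : ℕ → ℕ
lowest r = suc (6 ℕ.* (Tri r ℕ.+ r ℕ.* suc r))

-- The alternatives are the two geometric series in (1 - ab)/((1 - a)(1 - b)) = 1/(1 - a) + b/(1 -
-- b), where a = q^(6r+1) and b = q^(6r+5).
wL : ℕ → ℕ ⊎ ℕ → ℕ
wL r a = lowest r ℕ.+ [ (λ j → j ℕ.* suc (6 ℕ.* r)) , (λ j → suc (6 ℕ.* r ℕ.+ 4) ℕ.+ j ℕ.* suc (6 ℕ.* r ℕ.+ 4)) ]′ a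

k≤6k : ∀ k → k ≤ 6 ℕ.* k
k≤6k k = ℕₚ.m≤m+n k _

k≤k*k : ∀ k → k ≤ k ℕ.* k
k≤k*k zero    = z≤n
k≤k*k (suc k) = ℕₚ.m≤m*n (suc k) (suc k)

k≤w₁+ : ∀ k → k ≤ w₁ (+ k)
k≤w₁+ k = ℕₚ.≤-trans (k≤k*k k) (ℕₚ.≤-trans (ℕₚ.m≤n+m (k ℕ.* k) (Tri k)) (k≤6k _))

k<w₁- : ∀ k → k < w₁ -[1+ k ]
k<w₁- k = ℕₚ.≤-trans (k≤k*k (suc k)) (ℕₚ.≤-trans (ℕₚ.m≤n+m (suc k ℕ.* suc k) (Tri k)) (k≤6k _))

k≤w₁- : ∀ k → k ≤ w₁ -[1+ k ]
k≤w₁- k = ℕₚ.<⇒≤ (k<w₁- k)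

k≤wL : ∀ k a → k ≤ wL k a
k≤wL k a = ℕₚ.≤-trans (ℕₚ.m≤m*n k (suc k)) (ℕₚ.≤-trans (ℕₚ.m≤n+m (k ℕ.* suc k) (Tri k))
  (ℕₚ.≤-trans (k≤6k _) (ℕₚ.≤-trans (ℕₚ.n≤1+n _) (ℕₚ.m≤m+n (lowest k) _))))

module XiSeries (M : ℕ) (0<M : 0 < M) where
  open Truncated M using (_≈_; series)
  open CommutativeRing series using (*-cong; *-congˡ; *-congʳ; *-assoc; *-comm; *-identityˡ; +-cong; +-congˡ; +-congʳ; +-identityʳ; +-identityˡ; +-assoc; distribˡ; setoid)
  open GenSum M
  open import Relation.Binary.Reasoning.Setoid setoid

  mono-cong : ∀ {a b} → a ≡ b → mono a ≈ mono b
  mono-cong refl _ _ = refl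

  mono-* : ∀ a b → mono (a ℕ.+ b) ≈ mono a · mono b
  mono-* a b m _ = mono-+ a b m

  a b v : ℕ → Ser
  a r = mono (suc (6 ℕ.* r))
  b r = mono (suc (6 ℕ.* r ℕ.+ 4))
  v r = geom (6 ℕ.* r) · geom (6 ℕ.* r ℕ.+ 4)

  X : ℕ → Ser
  X k = mono (6 ℕ.* k)

  char2 : ∀ f → f ⊕ f ≈ 𝟎
  char2 f m _ = xor-same (f m)

  open Sums series using (∑; ∑-cong; ∑-distribˡ; solve; _:+_; _:*_; _:=_; con; module ≈)

  ab : ∀ r → X (suc (2 ℕ.* r)) ≈ a r · b r
  ab r = ≈.trans (mono-cong (e r)) (mono-* (suc (6 ℕ.* r)) _)
    where
    e : ∀ r → 6 ℕ.* suc (2 ℕ.* r) ≡ suc (6 ℕ.* r) ℕ.+ suc (6 ℕ.* r ℕ.+ 4)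
    e = ℕ-Solver.solve-∀

  v-inverse : ∀ r → (𝟏 ⊕ X (suc (2 ℕ.* r)) ⊕ X r · (mono 1 ⊕ mono 5)) · v r ≈ 𝟏
  v-inverse r = begin
    (𝟏 ⊕ X (suc (2 ℕ.* r)) ⊕ X r · (mono 1 ⊕ mono 5)) · v r
      ≈⟨ *-congʳ {v r} (+-cong {𝟏 ⊕ X (suc (2 ℕ.* r))} {𝟏 ⊕ a r · b r} (+-congˡ {𝟏} (ab r)) Xy) ⟩
    (𝟏 ⊕ a r · b r ⊕ (a r ⊕ b r)) · v r
      ≈⟨ solve 4 (λ a b g h → (con 1 :+ a :* b :+ (a :+ b)) :* (g :* h) := ((con 1 :+ a) :* g) :* ((con 1 :+ b) :* h))
           ≈.refl (a r) (b r) (geom (6 ℕ.* r)) (geom (6 ℕ.* r ℕ.+ 4)) ⟩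
    ((𝟏 ⊕ a r) · geom (6 ℕ.* r)) · ((𝟏 ⊕ b r) · geom (6 ℕ.* r ℕ.+ 4))
      ≈⟨ *-cong {(𝟏 ⊕ a r) · geom (6 ℕ.* r)} {𝟏} (λ m _ → geom-inverse (6 ℕ.* r) m) (λ m _ → geom-inverse (6 ℕ.* r ℕ.+ 4) m) ⟩
    𝟏 · 𝟏
      ≈⟨ *-identityˡ 𝟏 ⟩
    𝟏 ∎
    where
    e1 : ∀ r → 6 ℕ.* r ℕ.+ 1 ≡ suc (6 ℕ.* r)
    e1 = ℕ-Solver.solve-∀
    e5 : ∀ r → 6 ℕ.* r ℕ.+ 5 ≡ suc (6 ℕ.* r ℕ.+ 4)
    e5 = ℕ-Solver.solve-∀
    Xy : X r · (mono 1 ⊕ mono 5) ≈ a r ⊕ b r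
    Xy = ≈.trans (distribˡ (X r) (mono 1) (mono 5)) (+-cong {X r · mono 1} {a r}
      (≈.trans (≈.sym (mono-* (6 ℕ.* r) 1)) (mono-cong (e1 r)))
      (≈.trans (≈.sym (mono-* (6 ℕ.* r) 5)) (mono-cong (e5 r))))

  open Lambert series char2 X (λ _ _ → refl)
    (λ k l → ≈.trans (mono-cong (ℕₚ.*-distribˡ-+ 6 k l)) (mono-* (6 ℕ.* k) (6 ℕ.* l)))
    M (λ k M≤k m m<M → mono-≢ (λ e → ℕₚ.<-irrefl (sym e) (ℕₚ.<-≤-trans m<M (ℕₚ.≤-trans M≤k (k≤6k k)))))
    (λ k → geom (5 ℕ.+ 6 ℕ.* k))
    (λ k → ≈.trans (*-congʳ {geom (5 ℕ.+ 6 ℕ.* k)} (+-congˡ {𝟏} (mono-cong (ℕₚ.*-suc 6 k)))) (λ m _ → geom-inverse (5 ℕ.+ 6 ℕ.* k) m))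
    (mono 1 ⊕ mono 5) v v-inverse using (A; L; Pent; V; W; A*Pent)

  -- The factor q accounts for the 1 in the exponent 6n² - 6n + 1, so `qA` is S modulo 2.
  qA qL : Ser
  qA = mono 1 · A
  qL = ∑ M (λ r → mono (lowest r) · (geom (6 ℕ.* r) ⊕ b r · geom (6 ℕ.* r ℕ.+ 4)))

  Pent≈θ : Pent ≈ θ w₁
  Pent≈θ = ∑-cong M (λ r _ → ≈.trans (distribˡ (X (Tri r)) _ _)
    (+-cong {X (Tri r) · X (r ℕ.* r)} {mono (w₁ (+ r))} (merge (Tri r) (r ℕ.* r)) (merge (Tri r) (suc r ℕ.* suc r))))
    where
    merge : ∀ k l → X k · X l ≈ X (k ℕ.+ l)
    merge k l = ≈.sym (≈.trans (mono-cong (ℕₚ.*-distribˡ-+ 6 k l)) (mono-* (6 ℕ.* k) (6 ℕ.* l)))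

  qL≈ : mono 1 · L ≈ qL
  qL≈ = ≈.trans (∑-distribˡ M (mono 1) (λ r → X (Tri r ℕ.+ r ℕ.* suc r) · W r · v r)) (∑-cong M (λ r _ → term r))
    where
    term : ∀ r → mono 1 · (X (Tri r ℕ.+ r ℕ.* suc r) · W r · v r) ≈ mono (lowest r) · (geom (6 ℕ.* r) ⊕ b r · geom (6 ℕ.* r ℕ.+ 4))
    term r = begin
      mono 1 · (x · W r · v r)
        ≈⟨ *-congˡ {mono 1} (*-congʳ {v r} (*-congˡ {x} (+-congˡ {𝟏} (ab r)))) ⟩
      mono 1 · (x · (𝟏 ⊕ a r · b r) · v r)
        ≈⟨ +-identityʳ _ ⟨
      mono 1 · (x · (𝟏 ⊕ a r · b r) · v r) ⊕ 𝟎
        ≈⟨ +-congˡ {mono 1 · (x · (𝟏 ⊕ a r · b r) · v r)} (char2 (mono 1 · x · b r · v r)) ⟨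
      -- Adding b twice turns 1 + ab into (1 + b) + b(1 + a), and each summand cancels one of the
      -- two denominators.
      mono 1 · (x · (𝟏 ⊕ a r · b r) · v r) ⊕ (mono 1 · x · b r · v r ⊕ mono 1 · x · b r · v r)
        ≈⟨ solve 6 (λ o x a b g h → o :* (x :* (con 1 :+ a :* b) :* (g :* h)) :+ (o :* x :* b :* (g :* h) :+ o :* x :* b :* (g :* h)) :=
             o :* x :* (((con 1 :+ b) :* h) :* g :+ ((con 1 :+ a) :* g) :* (b :* h))) ≈.refl (mono 1) x (a r) (b r) g h ⟩
      mono 1 · x · (((𝟏 ⊕ b r) · h) · g ⊕ ((𝟏 ⊕ a r) · g) · (b r · h))
        ≈⟨ *-cong {mono 1 · x} {mono (lowest r)} (≈.sym (mono-* 1 _)) (+-cong {((𝟏 ⊕ b r) · h) · g} {𝟏 · g}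
             (*-congʳ {g} {(𝟏 ⊕ b r) · h} {𝟏} (λ m _ → geom-inverse (6 ℕ.* r ℕ.+ 4) m))
             (*-congʳ {b r · h} {(𝟏 ⊕ a r) · g} {𝟏} (λ m _ → geom-inverse (6 ℕ.* r) m))) ⟩
      mono (lowest r) · (𝟏 · g ⊕ 𝟏 · (b r · h))
        ≈⟨ *-congˡ {mono (lowest r)} (+-cong {𝟏 · g} {g} (*-identityˡ g) (*-identityˡ (b r · h))) ⟩
      mono (lowest r) · (g ⊕ b r · h) ∎
      where
      x = X (Tri r ℕ.+ r ℕ.* suc r)
      g = geom (6 ℕ.* r)
      h = geom (6 ℕ.* r ℕ.+ 4)

  ∑-square : ∀ n f → ∑ n f · ∑ n f ≈ ∑ n (λ i → f i · f i)
  ∑-square zero    f m _ = 𝟎·-zero 𝟎 m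
  ∑-square (suc n) f = begin
    (f 0 ⊕ s) · (f 0 ⊕ s)
      ≈⟨ square (f 0) s ⟩
    f 0 · f 0 ⊕ s · s
      ≈⟨ +-congˡ {f 0 · f 0} (∑-square n (f ∘ suc)) ⟩
    ∑ (suc n) (λ i → f i · f i) ∎
    where
    s = ∑ n (f ∘ suc)
    square : ∀ f g → (f ⊕ g) · (f ⊕ g) ≈ f · f ⊕ g · g
    square f g = begin
      (f ⊕ g) · (f ⊕ g)                   ≈⟨ solve 2 (λ f g → (f :+ g) :* (f :+ g) := f :* f :+ g :* g :+ (f :* g :+ f :* g)) ≈.refl f g ⟩
      f · f ⊕ g · g ⊕ (f · g ⊕ f · g)     ≈⟨ +-congˡ {f · f ⊕ g · g} (char2 (f · g)) ⟩
      f · f ⊕ g · g ⊕ 𝟎                   ≈⟨ +-identityʳ _ ⟩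
      f · f ⊕ g · g                       ∎

  -- Frobenius: mixed products occur twice and vanish, so squaring doubles the exponents.
  θ-square : ∀ w → θ w · θ w ≈ θ (λ κ → w κ ℕ.+ w κ)
  θ-square w = ≈.trans (∑-square M _) (∑-cong M (λ k _ → begin
    (p k ⊕ n k) · (p k ⊕ n k)
      ≈⟨ solve 2 (λ f g → (f :+ g) :* (f :+ g) := f :* f :+ g :* g :+ (f :* g :+ f :* g)) ≈.refl (p k) (n k) ⟩
    p k · p k ⊕ n k · n k ⊕ (p k · n k ⊕ p k · n k)
      ≈⟨ +-cong {p k · p k ⊕ n k · n k} {mono (w (+ k) ℕ.+ w (+ k)) ⊕ mono (w -[1+ k ] ℕ.+ w -[1+ k ])}
           (+-cong {p k · p k} (≈.sym (mono-* (w (+ k)) _)) (≈.sym (mono-* (w -[1+ k ]) _))) (char2 (p k · n k)) ⟩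
    mono (w (+ k) ℕ.+ w (+ k)) ⊕ mono (w -[1+ k ] ℕ.+ w -[1+ k ]) ⊕ 𝟎
      ≈⟨ +-identityʳ _ ⟩
    mono (w (+ k) ℕ.+ w (+ k)) ⊕ mono (w -[1+ k ] ℕ.+ w -[1+ k ]) ∎))
    where
    p n : ℕ → Ser
    p k = mono (w (+ k))
    n k = mono (w -[1+ k ])

  -- One factor P turns `A` into the Lambert series; the other stays beside it and supplies the
  -- variable r of the forms.
  qA-product : qA · θ (λ κ → w₁ κ ℕ.+ w₁ κ) ≈ θ w₁ · qL
  qA-product = begin
    qA · θ (λ κ → w₁ κ ℕ.+ w₁ κ)   ≈⟨ *-congˡ {qA} (≈.trans (≈.sym (θ-square w₁)) (*-cong {θ w₁} {Pent} (≈.sym Pent≈θ) (≈.sym Pent≈θ))) ⟩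
    qA · (Pent · Pent)             ≈⟨ solve 3 (λ o a p → o :* a :* (p :* p) := p :* (o :* (a :* p))) ≈.refl (mono 1) A Pent ⟩
    Pent · (mono 1 · (A · Pent))   ≈⟨ *-cong {Pent} Pent≈θ (≈.trans (*-congˡ {mono 1} (A*Pent 0<M)) qL≈) ⟩
    θ w₁ · qL                      ∎

  gen-qL : Gen M (λ z → wL (proj₁ z) (proj₂ z)) qL
  gen-qL = gen-∑ wL _ k≤wL (λ r → gen-mono· (lowest r) (gen-⊕ (gen-geom (6 ℕ.* r)) (gen-mono· (suc (6 ℕ.* r ℕ.+ 4)) (gen-geom (6 ℕ.* r ℕ.+ 4)))))

  gen-product : Gen M (λ z → w₁ (proj₁ z) ℕ.+ wL (proj₁ (proj₂ z)) (proj₂ (proj₂ z))) (qA · θ (λ κ → w₁ κ ℕ.+ w₁ κ))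
  gen-product m m<M = cnt-subst (sym (qA-product m m<M))
    (gen-· ℤ._≟_ (gen-θ w₁ k≤w₁+ k≤w₁-) gen-qL m m<M)

  V≡ : ∀ n m → oddℤ (invPoch n m) ≡ V n m
  V≡ zero    m = odd-one m
  V≡ (suc n) m = trans (odd-⊛ (invPoch n) (geomInv (6 ℕ.* n) ⊛ geomInv (6 ℕ.* n ℕ.+ 4)) m)
    (·-cong≤ m (λ i _ → V≡ n i) (λ i _ → trans (odd-⊛ (geomInv (6 ℕ.* n)) (geomInv (6 ℕ.* n ℕ.+ 4)) i)
      (·-cong≤ i (λ j _ → odd-geomInv (6 ℕ.* n) j) (λ j _ → odd-geomInv (6 ℕ.* n ℕ.+ 4) j))))

  xiTerm≡ : ∀ n m → m < M → oddℤ (xiTerm (suc n) m) ≡ (mono 1 · (X (n ℕ.* suc n) · V (suc n))) m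
  xiTerm≡ n m m<M = trans (odd-shift e (invPoch (suc n)) m) (trans (·-cong≤ m (λ i _ → cong (λ z → mono z i) e≡) (λ i _ → V≡ (suc n) i))
    (≈.trans (*-congʳ {V (suc n)} (mono-* 1 (6 ℕ.* (n ℕ.* suc n)))) (*-assoc (mono 1) (X (n ℕ.* suc n)) (V (suc n))) m m<M))
    where
    e = 6 ℕ.* suc n ℕ.* suc n ℕ.∸ 6 ℕ.* suc n ℕ.+ 1
    e1 : ∀ n → 6 ℕ.* suc n ℕ.* suc n ≡ 6 ℕ.* (n ℕ.* suc n) ℕ.+ 6 ℕ.* suc n
    e1 = ℕ-Solver.solve-∀
    e≡ : e ≡ 1 ℕ.+ 6 ℕ.* (n ℕ.* suc n)
    e≡ = trans (cong (λ z → z ℕ.∸ 6 ℕ.* suc n ℕ.+ 1) (e1 n)) (trans (cong (ℕ._+ 1) (ℕₚ.m+n∸n≡m _ (6 ℕ.* suc n))) (ℕₚ.+-comm _ 1))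

  ∑-sumBelow : ∀ n (f : ℕ → Series) (F : ℕ → Ser) m → (∀ i → oddℤ (f i m) ≡ F i m) → oddℤ (sumBelow n (λ i → f i m)) ≡ ∑ n F m
  ∑-sumBelow zero    f F m e = refl
  ∑-sumBelow (suc n) f F m e = trans (sumBelow-front n (λ i → f i m)) (cong₂ _xor_ (e 0) (∑-sumBelow n (f ∘ suc) (F ∘ suc) m (e ∘ suc)))

  qA-coefficient : ∀ m → m < M → oddℤ (sumBelow M (λ i → xiTerm (suc i) m)) ≡ qA m
  qA-coefficient m m<M = trans (∑-sumBelow M (xiTerm ∘ suc) _ m (λ i → xiTerm≡ i m m<M))
    (sym (∑-distribˡ M (mono 1) (λ n → X (n ℕ.* suc n) · V (suc n)) m m<M))

open import Data.Integer using (_+_; _*_; -_; _-_; ∣_∣)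
open import Data.Integer.DivMod using (_/ℕ_; _%ℕ_; n%ℕd<d; a≡a%ℕn+[a/ℕn]*n)
open import Data.Integer.Divisibility using (_∣_)
import Data.Integer.Divisibility.Signed as ℤ∣
open import Data.Integer.Tactic.RingSolver as ℤ-Solver using (solve)
open import Data.List using ([]; _∷_)
import Data.Product.Properties as ×ₚ

-- Integer arithmetic

-- An equation is derived from another by naming the multiplier q; what remains is a polynomial
-- identity for the ring solver.
linear : ∀ q {A B L R} → L ≡ R → A - B ≡ q * (L - R) → A ≡ B
linear q {A} {B} {L} {R} eq id = ℤₚ.i-j≡0⇒i≡j A B (trans id (trans (cong (q *_) (ℤₚ.i≡j⇒i-j≡0 eq)) (ℤₚ.*-zeroʳ q)))

linear₂ : ∀ q q′ {A B L R L′ R′} → L ≡ R → L′ ≡ R′ → A - B ≡ q * (L - R) + q′ * (L′ - R′) → A ≡ B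
linear₂ q q′ {L = L} {R} {L′} {R′} eq eq′ id = linear q eq (trans id (trans
  (cong (λ z → q * (L - R) + q′ * z) (ℤₚ.i≡j⇒i-j≡0 eq′))
  (trans (cong (_+_ (q * (L - R))) (ℤₚ.*-zeroʳ q′)) (ℤₚ.+-identityʳ _))))

-- A contradiction modulo m: the assumed equation becomes m · `E` = c, and the implicit argument has
-- already decided that m does not divide c.
clash : ∀ m c {_ : False (m ∣? c)} {L R} E q → L ≡ R → + m * E ≡ + c + q * (L - R) → ⊥
clash m c {m∤c} {L} {R} E q eq id = toWitnessFalse m∤c (divides ∣ E ∣ (begin
  c              ≡⟨ cong ∣_∣ mE≡c ⟨
  ∣ + m * E ∣    ≡⟨ ℤₚ.abs-* (+ m) E ⟩
  m ℕ.* ∣ E ∣    ≡⟨ ℕₚ.*-comm m ∣ E ∣ ⟩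
  ∣ E ∣ ℕ.* m    ∎))
  where
  open ≡-Reasoning
  mE≡c : + m * E ≡ + c
  mE≡c = trans id (trans (cong (λ z → + c + z) (trans (cong (q *_) (ℤₚ.i≡j⇒i-j≡0 eq)) (ℤₚ.*-zeroʳ q))) (ℤₚ.+-identityʳ (+ c)))

2*-cancel : ∀ {x y} → + 2 * x ≡ + 2 * y → x ≡ y
2*-cancel {x} {y} = ℤₚ.*-cancelˡ-≡ (+ 2) x y

-- Pitfall: pos 0 is false, so pos (- x) ≡ not (pos x) fails at 0.
pos : ℤ → Bool
pos +0       = false
pos +[1+ n ] = true
pos -[1+ n ] = false

pos-neg : ∀ x → x ≢ + 0 → pos (- x) ≡ not (pos x)
pos-neg +0       ne = ⊥-elim (ne refl)
pos-neg +[1+ n ] ne = refl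
pos-neg -[1+ n ] ne = refl

pos-+ : ∀ {x y} → pos x ≡ true → pos y ≡ true → pos (x + y) ≡ true
pos-+ {+[1+ m ]} {+[1+ n ]} _ _ = refl

pos-scale : ∀ k x → pos (+[1+ k ] * x) ≡ pos x
pos-scale k +0       = cong pos (ℤₚ.*-zeroʳ +[1+ k ])
pos-scale k +[1+ n ] = refl
pos-scale k -[1+ n ] = refl

¬pos⇒pos- : ∀ {x} → x ≢ + 0 → ¬ pos x ≡ true → pos (- x) ≡ true
¬pos⇒pos- {x} ne np = trans (pos-neg x ne) (cong not (Boolₚ.¬-not np))

abs : ℤ → ℤ
abs x = + ∣ x ∣

abs-pos : ∀ {x} → x ≢ + 0 → pos (abs x) ≡ true
abs-pos {+0}       ne = ⊥-elim (ne refl)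
abs-pos {+[1+ n ]} ne = refl
abs-pos { -[1+ n ]} ne = refl

abs-cases : ∀ x → (pos x ≡ true × abs x ≡ x) ⊎ (pos x ≡ false × abs x ≡ - x)
abs-cases +0       = inj₂ (refl , refl)
abs-cases +[1+ n ] = inj₁ (refl , refl)
abs-cases -[1+ n ] = inj₂ (refl , refl)

pos⇒abs : ∀ {x} → pos x ≡ true → abs x ≡ x
pos⇒abs {+[1+ n ]} _ = refl

abs-neg : ∀ x → abs (- x) ≡ abs x
abs-neg x = cong +_ (ℤₚ.∣-i∣≡∣i∣ x)

abs-≡ : ∀ {x y} → abs x ≡ abs y → x ≡ y ⊎ x ≡ - y
abs-≡ {x} {y} e with abs-cases x | abs-cases y
... | inj₁ (_ , a) | inj₁ (_ , b) = inj₁ (trans (sym a) (trans e b))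
... | inj₁ (_ , a) | inj₂ (_ , b) = inj₂ (trans (sym a) (trans e b))
... | inj₂ (_ , a) | inj₁ (_ , b) = inj₂ (trans (sym (ℤₚ.neg-involutive x)) (cong -_ (trans (sym a) (trans e b))))
... | inj₂ (_ , a) | inj₂ (_ , b) = inj₁ (ℤₚ.neg-injective (trans (sym a) (trans e b)))

abs-square : ∀ x → abs x * abs x ≡ x * x
abs-square x with abs-cases x
... | inj₁ (_ , e) = cong (λ z → z * z) e
... | inj₂ (_ , e) = trans (cong (λ z → z * z) e) (neg² x)
  where
  neg² : ∀ x → - x * - x ≡ x * x
  neg² = ℤ-Solver.solve-∀

Half : ℤ → Set
Half x = (Σ ℤ λ t → x ≡ + 2 * t) ⊎ (Σ ℤ λ t → x ≡ + 2 * t + + 1)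

half : ∀ x → Half x
half x = go (x %ℕ 2) (x /ℕ 2) (n%ℕd<d x 2) (a≡a%ℕn+[a/ℕn]*n x 2)
  where
  go : ∀ c t → c < 2 → x ≡ + c + t * + 2 → Half x
  go 0 t _ e = inj₁ (t , linear (+ 1) e (solve (x ∷ t ∷ [])))
  go 1 t _ e = inj₂ (t , linear (+ 1) e (solve (x ∷ t ∷ [])))
  go (suc (suc _)) _ (s≤s (s≤s ())) _

Third : ℤ → Set
Third x = (Σ ℤ λ t → x ≡ + 3 * t) ⊎ (Σ ℤ λ t → x ≡ + 3 * t + + 1) ⊎ (Σ ℤ λ t → x ≡ + 3 * t + + 2)

third : ∀ x → Third x
third x = go (x %ℕ 3) (x /ℕ 3) (n%ℕd<d x 3) (a≡a%ℕn+[a/ℕn]*n x 3)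
  where
  go : ∀ c t → c < 3 → x ≡ + c + t * + 3 → Third x
  go 0 t _ e = inj₁ (t , linear (+ 1) e (solve (x ∷ t ∷ [])))
  go 1 t _ e = inj₂ (inj₁ (t , linear (+ 1) e (solve (x ∷ t ∷ []))))
  go 2 t _ e = inj₂ (inj₂ (t , linear (+ 1) e (solve (x ∷ t ∷ []))))
  go (suc (suc (suc _))) _ (s≤s (s≤s (s≤s ()))) _

-- For x prime to 6 exactly one of x and -x is 1 modulo 6, and this choice replaces positivity as
-- the normalisation of signs.
data Mod6 (x : ℤ) : Set where
  even  : ∀ t → x ≡ + 2 * t → Mod6 x
  three : ∀ t → x ≡ + 3 * t → Mod6 x
  ≡1    : ∀ t → x ≡ + 6 * t + + 1 → Mod6 x
  ≡-1   : ∀ t → - x ≡ + 6 * t + + 1 → Mod6 x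

mod6 : ∀ x → Mod6 x
mod6 x = go (half x)
  where
  go′ : ∀ t → x ≡ + 2 * t + + 1 → Third t → Mod6 x
  go′ t e (inj₁ (u , refl))        = ≡1 u (linear (+ 1) e (solve (x ∷ u ∷ [])))
  go′ t e (inj₂ (inj₁ (u , refl))) = three (+ 2 * u + + 1) (linear (+ 1) e (solve (x ∷ u ∷ [])))
  go′ t e (inj₂ (inj₂ (u , refl))) = ≡-1 (- u - + 1) (linear (- (+ 1)) e (solve (x ∷ u ∷ [])))
  go : Half x → Mod6 x
  go (inj₁ (t , e)) = even t e
  go (inj₂ (t , e)) = go′ t e (third t)

pronic : ∀ t → Σ ℤ λ u → t * t + t ≡ + 2 * u
pronic t = go (half t)
  where
  go : Half t → Σ ℤ λ u → t * t + t ≡ + 2 * u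
  go (inj₁ (u , refl)) = u * (+ 2 * u + + 1) , solve (u ∷ [])
  go (inj₂ (u , refl)) = (+ 2 * u + + 1) * (u + + 1) , solve (u ∷ [])

odd-square : ∀ t → Σ ℤ λ u → (+ 2 * t + + 1) * (+ 2 * t + + 1) ≡ + 8 * u + + 1
odd-square t = go (pronic t)
  where
  go : (Σ ℤ λ u → t * t + t ≡ + 2 * u) → Σ ℤ λ u → (+ 2 * t + + 1) * (+ 2 * t + + 1) ≡ + 8 * u + + 1
  go (u , e) = u , linear (+ 4) e (solve (t ∷ u ∷ []))

six+1≢0 : ∀ κ → + 6 * κ + + 1 ≢ + 0
six+1≢0 κ e = clash 6 1 (- κ) (- (+ 1)) e (solve (κ ∷ []))

six+1-≢- : ∀ κ μ → + 6 * κ + + 1 ≢ - (+ 6 * μ + + 1)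
six+1-≢- κ μ e = clash 6 2 (- κ - μ) (- (+ 1)) e (solve (κ ∷ μ ∷ []))

-- The residue 1 modulo 6 fixes the sign, as -1 is a different residue.
abs-inj : ∀ κ μ → abs (+ 6 * κ + + 1) ≡ abs (+ 6 * μ + + 1) → + 6 * κ + + 1 ≡ + 6 * μ + + 1
abs-inj κ μ e with abs-≡ {+ 6 * κ + + 1} {+ 6 * μ + + 1} e
... | inj₁ p = p
... | inj₂ p = ⊥-elim (six+1-≢- κ μ p)

square≢8n+5 : ∀ n u → u * u ≢ + 8 * n + + 5
square≢8n+5 n u = go (half u)
  where
  go : Half u → u * u ≢ + 8 * n + + 5
  go (inj₁ (t , refl)) e = clash 4 5 (t * t - + 2 * n) (+ 1) e (solve (t ∷ n ∷ []))
  go (inj₂ (t , refl)) e = go′ (odd-square t)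
    where
    go′ : (Σ ℤ λ w → (+ 2 * t + + 1) * (+ 2 * t + + 1) ≡ + 8 * w + + 1) → ⊥
    go′ (w , f) = clash 8 4 (w - n) (+ 1) (trans (sym f) e) (solve (w ∷ n ∷ []))

-- Enumerating bounded sets of integers

Bounded : ℕ → ℤ → Set
Bounded N x = ∣ x ∣ ≤ N

card-Bounded : ∀ N → Σ ℕ λ m → Card (Bounded N) m
card-Bounded zero = 1 , insert +0 z≤n (empty λ { +0 (_ , ne) → ne refl ; +[1+ _ ] (() , _) ; -[1+ _ ] (() , _) })
card-Bounded (suc N) with card-Bounded N
... | m , c = suc (suc m) , insert +[1+ N ] ℕₚ.≤-refl (insert -[1+ N ] (ℕₚ.≤-refl , λ ())
  (card-resp {P = Bounded N}
    (λ { {x} p → (ℕₚ.m≤n⇒m≤1+n p , λ { refl → ℕₚ.1+n≰n p }) , λ { refl → ℕₚ.1+n≰n p } })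
    (λ { {x} ((p , ne₁) , ne₂) → shrink x p ne₁ ne₂ }) c))
  where
  shrink : ∀ x → ∣ x ∣ ≤ suc N → x ≢ +[1+ N ] → x ≢ -[1+ N ] → ∣ x ∣ ≤ N
  shrink (+ k)    p ne₁ ne₂ = ℕ.≤-pred (ℕₚ.≤∧≢⇒< p (λ e → ne₁ (cong +_ e)))
  shrink -[1+ k ] p ne₁ ne₂ = ℕ.≤-pred (ℕₚ.≤∧≢⇒< p (λ { refl → ne₂ refl }))

ℤ³ : Set
ℤ³ = ℤ × ℤ × ℤ

_≟²_ : DecidableEquality (ℤ × ℤ)
_≟²_ = ×ₚ.≡-dec ℤ._≟_ ℤ._≟_

_≟³_ : DecidableEquality ℤ³
_≟³_ = ×ₚ.≡-dec ℤ._≟_ _≟²_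

cnt-box : ∀ {P : ℤ³ → Set} N → Decidable P →
  (∀ {x y z} → P (x , y , z) → Bounded N x × Bounded N y × Bounded N z) → ∃ λ b → Cnt P b
cnt-box {P} N P? bound with card-Bounded N
... | m , c with cnt-filter P? (_ , card-× ℤ._≟_ c (card-× ℤ._≟_ c c) , refl)
...   | k , _ , ck , _ , _ = k , cnt-resp proj₂ (λ { {x , y , z} p → bound p , p }) ck

,-≡ : ∀ {x y z x′ y′ z′ : ℤ} → x ≡ x′ → y ≡ y′ → z ≡ z′ → (x , y , z) ≡ (x′ , y′ , z′)
,-≡ refl refl refl = refl

,,-≡ : ∀ {x y z x′ y′ z′ : ℤ} → (x , y , z) ≡ (x′ , y′ , z′) → x ≡ x′ × y ≡ y′ × z ≡ z′
,,-≡ refl = refl , refl , refl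

pos? : ∀ x b → Dec (pos x ≡ b)
pos? x b = pos x Boolₚ.≟ b

-- The fixed points of the two involutions on triples: (x, y, y) for `swap`, and (y, y, z) for
-- `reflect`, the latter being the factorisations y(y + 4z) of 8n + 5.
R MF : ℤ → ℤ × ℤ → Set
R  n (x , y) = pos x ≡ true × pos y ≡ true × x * x + + 4 * (y * y) ≡ + 8 * n + + 5
MF n (y , z) = pos y ≡ true × pos z ≡ true × y * y + + 4 * (y * z) ≡ + 8 * n + + 5

-- Heath-Brown and Zagier's involutions on the solutions of x² + 4yz = 8n + 5
module Zagier (n : ℤ) (N : ℕ) (N≡ : + N ≡ + 8 * n + + 5) where

  Z : ℤ³ → Set
  Z (x , y , z) = pos x ≡ true × pos y ≡ true × pos z ≡ true × x * x + + 4 * (y * z) ≡ + 8 * n + + 5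

  Z? : Decidable Z
  Z? (x , y , z) = pos? x true ×-dec pos? y true ×-dec pos? z true ×-dec (x * x + + 4 * (y * z) ℤ.≟ + 8 * n + + 5)

  Z-bounded : ∀ {x y z} → Z (x , y , z) → Bounded N x × Bounded N y × Bounded N z
  Z-bounded {+[1+ a ]} {+[1+ b ]} {+[1+ c ]} (_ , _ , _ , e) =
    ℕₚ.≤-trans (ℕₚ.m≤m*n (suc a) (suc a)) (ℕₚ.≤-trans (ℕₚ.m≤m+n (suc a ℕ.* suc a) _) total) ,
    ℕₚ.≤-trans (ℕₚ.m≤m*n (suc b) (suc c)) yz≤ ,
    ℕₚ.≤-trans (ℕₚ.m≤n*m (suc c) (suc b)) yz≤
    where
    total : suc a ℕ.* suc a ℕ.+ 4 ℕ.* (suc b ℕ.* suc c) ≤ N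
    total = ℕₚ.≤-reflexive (ℤₚ.+-injective (trans e (sym N≡)))
    yz≤ : suc b ℕ.* suc c ≤ N
    yz≤ = ℕₚ.≤-trans (ℕₚ.m≤n*m (suc b ℕ.* suc c) 4) (ℕₚ.≤-trans (ℕₚ.m≤n+m _ (suc a ℕ.* suc a)) total)

  cnt-Z : ∃ λ b → Cnt Z b
  cnt-Z = cnt-box N Z? (λ {x} {y} {z} → Z-bounded {x} {y} {z})

  swap : ℤ³ → ℤ³
  swap (x , y , z) = x , z , y

  cnt-R : ∀ {b} → Cnt Z b → Cnt (R n) b
  cnt-R c = cnt-preimage {P = R n} {Q = λ p → Z p × swap p ≡ p} (λ { (x , y) → x , y , y })
    (λ { (px , py , e) → (px , py , py , e) , refl })
    (λ { {_ , _} {_ , _} _ _ refl → refl })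
    (λ { {x , y , z} ((px , py , pz , e) , s) → onto x y z px py e (proj₁ (proj₂ (,,-≡ s))) })
    (cnt-fixed _≟³_ {P = Z} swap
      (λ { {x , y , z} (px , py , pz , e) → px , pz , py , trans (cong (λ w → x * x + + 4 * w) (ℤₚ.*-comm z y)) e })
      (λ _ → refl) c)
    where
    onto : ∀ x y z → pos x ≡ true → pos y ≡ true → x * x + + 4 * (y * z) ≡ + 8 * n + + 5 → z ≡ y →
      Σ (ℤ × ℤ) λ { (x′ , y′) → R n (x′ , y′) × (x′ , y′ , y′) ≡ (x , y , z) }
    onto x y z px py e refl = (x , y) , (px , py , e) , refl

  -- Their signs separate the three cases of Zagier's involution, and they reappear as the new
  -- coordinates in the middle case.
  ζ τ : ℤ³ → ℤ
  ζ (x , y , z) = z + x - y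
  τ (x , y , z) = + 2 * y - x

  -- On the wall y = x + z the equation reads (x + 2z)² = 8n + 5, and odd squares are 1 modulo 8.
  ζ≢0 : ∀ {p} → Z p → ζ p ≢ + 0
  ζ≢0 {x , y , z} (_ , _ , _ , e) ζ≡0 = square≢8n+5 n (x + + 2 * z) (go y (linear (- (+ 1)) {L = z + x - y} ζ≡0 (solve (x ∷ y ∷ z ∷ []))) e)
    where
    go : ∀ y → y ≡ z + x → x * x + + 4 * (y * z) ≡ + 8 * n + + 5 → (x + + 2 * z) * (x + + 2 * z) ≡ + 8 * n + + 5
    go _ refl e = linear (+ 1) e (solve (x ∷ z ∷ n ∷ []))

  τ≢0 : ∀ {p} → Z p → τ p ≢ + 0
  τ≢0 {x , y , z} (_ , _ , _ , e) τ≡0 = go x (linear (- (+ 1)) {L = + 2 * y - x} τ≡0 (solve (x ∷ y ∷ []))) e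
    where
    go : ∀ x → x ≡ + 2 * y → x * x + + 4 * (y * z) ≡ + 8 * n + + 5 → ⊥
    go _ refl e = clash 4 5 (y * y + y * z - + 2 * n) (+ 1) e (solve (y ∷ z ∷ n ∷ []))

  Low High Mid : ℤ³ → Set
  Low  p = Z p × ¬ pos (ζ p) ≡ true
  High p = (Z p × pos (ζ p) ≡ true) × ¬ pos (τ p) ≡ true
  Mid  p = (Z p × pos (ζ p) ≡ true) × pos (τ p) ≡ true

  raise lower reflect : ℤ³ → ℤ³
  raise (x , y , z) = x + + 2 * z , z , y - x - z
  lower (x , y , z) = x - + 2 * y , x - y + z , y
  reflect (x , y , z) = + 2 * y - x , y , z + x - y

  pos-≡ : ∀ {x y b} → x ≡ y → pos y ≡ b → pos x ≡ b
  pos-≡ refl p = p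

  neg⇒¬pos : ∀ {x y} → x ≡ - y → pos y ≡ true → ¬ pos x ≡ true
  neg⇒¬pos { y = +[1+ n ]} refl _ ()

  -- Zagier's involution exchanges the outer regions, so these cancel modulo 2 and only the middle
  -- one can contain fixed points.
  Low≅High : ∀ {b} → Cnt Low b → Cnt High b
  Low≅High = cnt-bij {P = Low} {Q = High} raise lower
    (λ { {x , y , z} ((px , py , pz , e) , ζ<0) →
      ((pos-+ px (trans (pos-scale 1 z) pz) , pz , pos-≡ (id₁ x y z) (¬pos⇒pos- (ζ≢0 {x , y , z} (px , py , pz , e)) ζ<0)
        , trans (id₂ x y z) e) , pos-≡ (id₃ x y z) py) , neg⇒¬pos (id₄ x z) px })
    (λ { {x , y , z} (((px , py , pz , e) , ζ>0) , τ<0) →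
      (pos-≡ (id₅ x y) (¬pos⇒pos- (τ≢0 {x , y , z} (px , py , pz , e)) τ<0) , pos-≡ (id₆ x y z) ζ>0 , py
        , trans (id₇ x y z) e) , neg⇒¬pos (id₈ x y z) pz })
    (λ { {x , y , z} _ → ,-≡ (id₉ x z) (id₁₀ x y z) refl })
    (λ { {x , y , z} _ → ,-≡ (id₁₁ x y) refl (id₁₂ x y z) })
    where
    id₁ : ∀ x y z → y - x - z ≡ - (z + x - y)
    id₁ = ℤ-Solver.solve-∀
    id₂ : ∀ x y z → (x + + 2 * z) * (x + + 2 * z) + + 4 * (z * (y - x - z)) ≡ x * x + + 4 * (y * z)
    id₂ = ℤ-Solver.solve-∀
    id₃ : ∀ x y z → y - x - z + (x + + 2 * z) - z ≡ y
    id₃ = ℤ-Solver.solve-∀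
    id₄ : ∀ x z → + 2 * z - (x + + 2 * z) ≡ - x
    id₄ = ℤ-Solver.solve-∀
    id₅ : ∀ x y → x - + 2 * y ≡ - (+ 2 * y - x)
    id₅ = ℤ-Solver.solve-∀
    id₆ : ∀ x y z → x - y + z ≡ z + x - y
    id₆ = ℤ-Solver.solve-∀
    id₇ : ∀ x y z → (x - + 2 * y) * (x - + 2 * y) + + 4 * ((x - y + z) * y) ≡ x * x + + 4 * (y * z)
    id₇ = ℤ-Solver.solve-∀
    id₈ : ∀ x y z → y + (x - + 2 * y) - (x - y + z) ≡ - z
    id₈ = ℤ-Solver.solve-∀
    id₉ : ∀ x z → x + + 2 * z - + 2 * z ≡ x
    id₉ = ℤ-Solver.solve-∀
    id₁₀ : ∀ x y z → x + + 2 * z - z + (y - x - z) ≡ y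
    id₁₀ = ℤ-Solver.solve-∀
    id₁₁ : ∀ x y → x - + 2 * y + + 2 * y ≡ x
    id₁₁ = ℤ-Solver.solve-∀
    id₁₂ : ∀ x y z → x - y + z - (x - + 2 * y) - y ≡ z
    id₁₂ = ℤ-Solver.solve-∀

  Mid-fixed : ∀ {b} → Cnt Mid b → Cnt (MF n) b
  Mid-fixed c = cnt-preimage {P = MF n} {Q = λ p → Mid p × reflect p ≡ p} (λ { (y , z) → y , y , z })
    (λ { {y , z} (py , pz , e) → (((py , py , pz , e) , pos-≡ (id₁ y z) pz) , pos-≡ (id₂ y) py) , ,-≡ (id₂ y) refl (id₁ y z) })
    (λ { {_ , _} {_ , _} _ _ refl → refl })
    (λ { {x , y , z} ((((px , py , pz , e) , _) , _) , s) → onto x y z py pz e (proj₁ (,,-≡ s)) })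
    (cnt-fixed _≟³_ {P = Mid} reflect
      (λ { {x , y , z} (((px , py , pz , e) , ζ>0) , τ>0) →
        ((τ>0 , py , ζ>0 , trans (id₃ x y z) e) , pos-≡ (id₄ x y z) pz) , pos-≡ (id₅ x y) px })
      (λ { {x , y , z} _ → ,-≡ (id₅ x y) refl (id₄ x y z) }) c)
    where
    id₁ : ∀ y z → z + y - y ≡ z
    id₁ = ℤ-Solver.solve-∀
    id₂ : ∀ y → + 2 * y - y ≡ y
    id₂ = ℤ-Solver.solve-∀
    id₃ : ∀ x y z → (+ 2 * y - x) * (+ 2 * y - x) + + 4 * (y * (z + x - y)) ≡ x * x + + 4 * (y * z)
    id₃ = ℤ-Solver.solve-∀
    id₄ : ∀ x y z → z + x - y + (+ 2 * y - x) - y ≡ z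
    id₄ = ℤ-Solver.solve-∀
    id₅ : ∀ x y → + 2 * y - (+ 2 * y - x) ≡ x
    id₅ = ℤ-Solver.solve-∀
    onto : ∀ x y z → pos y ≡ true → pos z ≡ true → x * x + + 4 * (y * z) ≡ + 8 * n + + 5 → + 2 * y - x ≡ x →
      Σ (ℤ × ℤ) λ { (y′ , z′) → MF n (y′ , z′) × (y′ , y′ , z′) ≡ (x , y , z) }
    onto x y z py pz e s = go (2*-cancel (linear (+ 1) s (solve (x ∷ y ∷ []))))
      where
      go : y ≡ x → Σ (ℤ × ℤ) λ { (y′ , z′) → MF n (y′ , z′) × (y′ , y′ , z′) ≡ (x , y , z) }
      go refl = (y , z) , (py , pz , e) , refl

  -- For a prime 8n + 5 there is one factorisation and this is Zagier's proof of the two-square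
  -- theorem; in general it equates two parities, through that of all the triples.
  zagier : ∃ λ b → Cnt (R n) b × Cnt (MF n) b
  zagier with cnt-Z
  ... | b , c = b , cnt-R c , Mid-fixed mid
    where
    mid : Cnt Mid b
    mid with cnt-filter {Q = λ p → pos (ζ p) ≡ true} (λ p → pos? (ζ p) true) c
    ... | k , l , ck , cl , refl with cnt-filter {Q = λ p → pos (τ p) ≡ true} (λ p → pos? (τ p) true) ck
    ...   | i , j , ci , cj , refl = cnt-subst (lemma i j l (cnt-unique _≟³_ cj (Low≅High cl))) ci
      where
      lemma : ∀ i j l → j ≡ l → i ≡ (i xor j) xor l
      lemma i j .j refl = sym (trans (xor-assoc i j j) (trans (cong (i xor_) (xor-same j)) (xor-identityʳ i)))

-- The forms counted by the product of the theta function and the Lambert series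

-- The left side r² + s(s + 4v) is a quarter of the discriminant of the form with coefficients s,
-- 2r, -(s + 4v).
Form : ℤ → ℤ³ → Set
Form n (r , s , v) = (Σ ℤ λ κ → r ≡ + 6 * κ + + 1) × (Σ ℤ λ μ → s ≡ + 6 * μ + + 1) ×
  r * r + s * s + + 4 * (s * v) ≡ + 16 * n + + 10

-- A form is the geodesic s|z|² + 2r Re z - (s + 4v) = 0; up to scaling its values at ∞ and i are s and - v,
-- and at the third vertex of the mirror triangle it takes the value - δ (or - ε for the triangle with a cusp at -1).
δ ε : ℤ³ → ℤ
δ (r , s , v) = r + + 2 * v - s
ε (r , s , v) = r + + 2 * v

sPart vPart : ℤ³ → ℤ
sPart (r , s , v) = s
vPart (r , s , v) = v

-- Crossing a side means opposite values at its ends. As the values at i and at the third vertex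
-- carry a minus sign, the sides from ∞ are crossed under `Same` and the side opposite to ∞ under
-- `Diff`.
Same Diff : ℤ → (ℤ³ → ℤ) → (ℤ³ → ℤ) → ℤ³ → Set
Same n f g p = Form n p × pos (f p) ≡ pos (g p)
Diff n f g p = Form n p × ¬ pos (f p) ≡ pos (g p)

-- Forms are normalised by r ≡ s ≡ 1 (mod 6) instead of s > 0.  Since pos 0 is false,
-- a form with v = 0 is counted exactly when s < 0, as in the Lambert series.
X : ℤ → ℤ³ → Set
X n = Same n sPart vPart

six+1? : ∀ x → Dec (Σ ℤ λ κ → x ≡ + 6 * κ + + 1)
six+1? x = go (mod6 x)
  where
  go : Mod6 x → Dec (Σ ℤ λ κ → x ≡ + 6 * κ + + 1)
  go (even t refl)  = no λ { (κ , e) → clash 2 1 (t - + 3 * κ) (+ 1) e (solve (t ∷ κ ∷ [])) }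
  go (three t refl) = no λ { (κ , e) → clash 3 1 (t - + 2 * κ) (+ 1) e (solve (t ∷ κ ∷ [])) }
  go (≡1 t e)      = yes (t , e)
  go (≡-1 t e)     = no λ { (κ , e′) → clash 6 2 (- κ - t) (+ 1) (trans (sym (cong -_ e′)) e) (solve (κ ∷ t ∷ [])) }

Form? : ∀ n → Decidable (Form n)
Form? n (r , s , v) = six+1? r ×-dec six+1? s ×-dec (r * r + s * s + + 4 * (s * v) ℤ.≟ + 16 * n + + 10)

Same? : ∀ n f g → Decidable (Same n f g)
Same? n f g p = Form? n p ×-dec (pos (f p) Boolₚ.≟ pos (g p))

-- A geodesic leaves the triangle as often as it enters: if g and h have the same sign, f agrees
-- with both or with neither, and otherwise with exactly one of them.
cnt-triangle : ∀ n f g h {b c} → Cnt (Same n f g) b → Cnt (Same n f h) c → Cnt (Diff n g h) (b xor c)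
cnt-triangle n f g h cb cc = cnt-Δ _≟³_ (Same? n f g) (Same? n f h) cb cc
  (λ { (t , e) ne → t , λ e′ → ne (t , trans e e′) })
  (λ { (t , e) ne → t , λ e′ → ne (t , trans e (sym e′)) })
  (λ { {p} (t , ne) → cases t (pos (f p)) (pos (g p)) (pos (h p)) refl refl refl ne })
  where
  cases : ∀ {p} → Form n p → ∀ a b c → pos (f p) ≡ a → pos (g p) ≡ b → pos (h p) ≡ c → ¬ pos (g p) ≡ pos (h p) →
    (Same n f g p × ¬ Same n f h p) ⊎ (Same n f h p × ¬ Same n f g p)
  cases t true  true  true  ea eb ec ne = ⊥-elim (ne (trans eb (sym ec)))
  cases t true  true  false ea eb ec ne = inj₁ ((t , trans ea (sym eb)) , λ { (_ , e) → contradiction (trans (sym ea) (trans e ec)) λ () })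
  cases t true  false true  ea eb ec ne = inj₂ ((t , trans ea (sym ec)) , λ { (_ , e) → contradiction (trans (sym ea) (trans e eb)) λ () })
  cases t true  false false ea eb ec ne = ⊥-elim (ne (trans eb (sym ec)))
  cases t false true  true  ea eb ec ne = ⊥-elim (ne (trans eb (sym ec)))
  cases t false true  false ea eb ec ne = inj₂ ((t , trans ea (sym ec)) , λ { (_ , e) → contradiction (trans (sym ea) (trans e eb)) λ () })
  cases t false false true  ea eb ec ne = inj₁ ((t , trans ea (sym eb)) , λ { (_ , e) → contradiction (trans (sym ea) (trans e ec)) λ () })
  cases t false false false ea eb ec ne = ⊥-elim (ne (trans eb (sym ec)))

-- Finiteness

same-sign : ∀ s d → s ≢ + 0 → pos s ≡ pos d → Σ ℕ λ c → s * d ≡ + c × ∣ d ∣ ≤ c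
same-sign +0       d        ne _ = ⊥-elim (ne refl)
same-sign +[1+ a ] +[1+ b ] _  _ = suc a ℕ.* suc b , refl , ℕₚ.m≤n*m (suc b) (suc a)
same-sign -[1+ a ] +0       _  _ = 0 , ℤₚ.*-zeroʳ -[1+ a ] , z≤n
same-sign -[1+ a ] -[1+ b ] _  _ = suc a ℕ.* suc b , refl , ℕₚ.m≤n*m (suc b) (suc a)

square-ℕ : ∀ x → Σ ℕ λ c → x * x ≡ + c × ∣ x ∣ ≤ c
square-ℕ +0       = 0 , refl , z≤n
square-ℕ +[1+ a ] = suc a ℕ.* suc a , refl , ℕₚ.m≤m*n (suc a) (suc a)
square-ℕ -[1+ a ] = suc a ℕ.* suc a , refl , ℕₚ.m≤m*n (suc a) (suc a)

s≢0 : ∀ {s} → (Σ ℤ λ μ → s ≡ + 6 * μ + + 1) → s ≢ + 0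
s≢0 (μ , refl) = six+1≢0 μ

2∣∣ : ∀ v → ∣ v ∣ ≤ ∣ + 2 * v ∣
2∣∣ v = ℕₚ.≤-trans (ℕₚ.m≤n*m ∣ v ∣ 2) (ℕₚ.≤-reflexive (sym (ℤₚ.abs-* (+ 2) v)))

∣-∣≤ : ∀ x y → ∣ x - y ∣ ≤ ∣ x ∣ ℕ.+ ∣ y ∣
∣-∣≤ x y = ℤₚ.∣i-j∣≤∣i∣+∣j∣ x y

∣x∣≤ : ∀ {x y z a b} → x ≡ y - z → ∣ y ∣ ≤ a → ∣ z ∣ ≤ b → ∣ x ∣ ≤ a ℕ.+ b
∣x∣≤ {y = y} {z} refl p q = ℕₚ.≤-trans (∣-∣≤ y z) (ℕₚ.+-mono-≤ p q)

module Finite (n : ℤ) (N : ℕ) (N≡ : + N ≡ + 16 * n + + 10) where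

  N≤3N : N ≤ 3 ℕ.* N
  N≤3N = ℕₚ.m≤n*m N 3
  2N≤3N : N ℕ.+ N ≤ 3 ℕ.* N
  2N≤3N = ℕₚ.+-monoʳ-≤ N (ℕₚ.m≤m+n N _)
  3N≤3N : N ℕ.+ (N ℕ.+ N) ≤ 3 ℕ.* N
  3N≤3N = ℕₚ.≤-reflexive (cong (λ z → N ℕ.+ (N ℕ.+ z)) (sym (ℕₚ.+-identityʳ N)))

  box : ∀ r s v d → ∣ r - s ∣ ≤ N → ∣ s ∣ ≤ N → ∣ d ∣ ≤ N →
    (+ 2 * v ≡ d - (r - s) ⊎ + 2 * v ≡ d - r) → Bounded (3 ℕ.* N) r × Bounded (3 ℕ.* N) s × Bounded (3 ℕ.* N) v
  box r s v d p q u e = ℕₚ.≤-trans r≤ 2N≤3N , ℕₚ.≤-trans q N≤3N , ℕₚ.≤-trans (2∣∣ v) (v≤ e)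
    where
    id₁ : ∀ r s → r ≡ r - s - - s
    id₁ = ℤ-Solver.solve-∀
    r≤ : ∣ r ∣ ≤ N ℕ.+ N
    r≤ = ∣x∣≤ {r} {r - s} { - s } (id₁ r s) p (ℕₚ.≤-trans (ℕₚ.≤-reflexive (ℤₚ.∣-i∣≡∣i∣ s)) q)
    v≤ : (+ 2 * v ≡ d - (r - s) ⊎ + 2 * v ≡ d - r) → ∣ + 2 * v ∣ ≤ 3 ℕ.* N
    v≤ (inj₁ e) = ℕₚ.≤-trans (∣x∣≤ {+ 2 * v} {d} {r - s} e u p) 2N≤3N
    v≤ (inj₂ e) = ℕₚ.≤-trans (∣x∣≤ {+ 2 * v} {d} {r} e u r≤) 3N≤3N

  -- The equation is (r - s)² + 2s² + 2s`δ` = 16n + 10, and all three terms are nonnegative when the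
  -- signs of s and `δ` agree.
  cnt-V : ∃ λ b → Cnt (Same n sPart δ) b
  cnt-V = cnt-box (3 ℕ.* N) (Same? n sPart δ) (λ {r} {s} {v} p → bound r s v p)
    where
    id₁ : ∀ r s v → (r - s) * (r - s) + + 2 * (s * s + s * (r + + 2 * v - s)) ≡ r * r + s * s + + 4 * (s * v)
    id₁ = ℤ-Solver.solve-∀
    id₂ : ∀ r s v → + 2 * v ≡ r + + 2 * v - s - (r - s)
    id₂ = ℤ-Solver.solve-∀
    bound : ∀ r s v → Same n sPart δ (r , s , v) → Bounded (3 ℕ.* N) r × Bounded (3 ℕ.* N) s × Bounded (3 ℕ.* N) v
    bound r s v ((_ , sμ , e) , ss) = go (square-ℕ (r - s)) (square-ℕ s) (same-sign s (r + + 2 * v - s) (s≢0 sμ) ss)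
      where
      go : (Σ ℕ λ c → (r - s) * (r - s) ≡ + c × ∣ r - s ∣ ≤ c) → (Σ ℕ λ c → s * s ≡ + c × ∣ s ∣ ≤ c) →
        (Σ ℕ λ c → s * (r + + 2 * v - s) ≡ + c × ∣ r + + 2 * v - s ∣ ≤ c) →
        Bounded (3 ℕ.* N) r × Bounded (3 ℕ.* N) s × Bounded (3 ℕ.* N) v
      go (a , ea , a≤) (b , eb , b≤) (c , ec , c≤) = box r s v (r + + 2 * v - s)
        (ℕₚ.≤-trans a≤ (ℕₚ.≤-trans (ℕₚ.m≤m+n a _) total))
        (ℕₚ.≤-trans b≤ (ℕₚ.≤-trans (ℕₚ.m≤m+n b c) bc≤))
        (ℕₚ.≤-trans c≤ (ℕₚ.≤-trans (ℕₚ.m≤n+m c b) bc≤)) (inj₁ (id₂ r s v))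
        where
        total : a ℕ.+ 2 ℕ.* (b ℕ.+ c) ≤ N
        total = ℕₚ.≤-reflexive (ℤₚ.+-injective (trans (sym (trans (sym (id₁ r s v))
          (trans (cong₂ _+_ ea (cong (+ 2 *_) (cong₂ _+_ eb ec))) (cong (_+_ (+ a)) (sym (ℤₚ.pos-* 2 (b ℕ.+ c))))))) (trans e (sym N≡))))
        bc≤ : b ℕ.+ c ≤ N
        bc≤ = ℕₚ.≤-trans (ℕₚ.m≤n*m (b ℕ.+ c) 2) (ℕₚ.≤-trans (ℕₚ.m≤n+m _ a) total)

  -- The equation is (r - s)² + 2s`ε` = 16n + 10, without a square of s. It still bounds s because
  -- `ε` is odd, hence nonzero.
  cnt-V₀ : ∃ λ b → Cnt (Same n sPart ε) b
  cnt-V₀ = cnt-box (3 ℕ.* N) (Same? n sPart ε) (λ {r} {s} {v} p → bound r s v p)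
    where
    id₁ : ∀ r s v → (r - s) * (r - s) + + 2 * (s * (r + + 2 * v)) ≡ r * r + s * s + + 4 * (s * v)
    id₁ = ℤ-Solver.solve-∀
    id₂ : ∀ r v → + 2 * v ≡ r + + 2 * v - r
    id₂ = ℤ-Solver.solve-∀
    ε≢0 : ∀ {r v} → (Σ ℤ λ κ → r ≡ + 6 * κ + + 1) → r + + 2 * v ≢ + 0
    ε≢0 {v = v} (κ , refl) e = clash 2 1 (- (+ 3) * κ - v) (- (+ 1)) e (solve (κ ∷ v ∷ []))
    bound : ∀ r s v → Same n sPart ε (r , s , v) → Bounded (3 ℕ.* N) r × Bounded (3 ℕ.* N) s × Bounded (3 ℕ.* N) v
    bound r s v ((rκ , sμ , e) , ss) = go (square-ℕ (r - s)) (same-sign s (r + + 2 * v) (s≢0 sμ) ss) (same-sign (r + + 2 * v) s (ε≢0 {r} {v} rκ) (sym ss))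
      where
      go : (Σ ℕ λ c → (r - s) * (r - s) ≡ + c × ∣ r - s ∣ ≤ c) →
        (Σ ℕ λ c → s * (r + + 2 * v) ≡ + c × ∣ r + + 2 * v ∣ ≤ c) → (Σ ℕ λ c → (r + + 2 * v) * s ≡ + c × ∣ s ∣ ≤ c) →
        Bounded (3 ℕ.* N) r × Bounded (3 ℕ.* N) s × Bounded (3 ℕ.* N) v
      go (a , ea , a≤) (c , ec , c≤) (d , ed , d≤) = box r s v (r + + 2 * v)
        (ℕₚ.≤-trans a≤ (ℕₚ.≤-trans (ℕₚ.m≤m+n a _) total))
        (ℕₚ.≤-trans d≤ (ℕₚ.≤-trans (ℕₚ.≤-reflexive (ℤₚ.+-injective (trans (sym ed) (trans (ℤₚ.*-comm (r + + 2 * v) s) ec)))) c≤N))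
        (ℕₚ.≤-trans c≤ c≤N) (inj₂ (id₂ r v))
        where
        total : a ℕ.+ 2 ℕ.* c ≤ N
        total = ℕₚ.≤-reflexive (ℤₚ.+-injective (trans (sym (trans (sym (id₁ r s v))
          (trans (cong₂ _+_ ea (cong (+ 2 *_) ec)) (cong (_+_ (+ a)) (sym (ℤₚ.pos-* 2 c)))))) (trans e (sym N≡))))
        c≤N : c ≤ N
        c≤N = ℕₚ.≤-trans (ℕₚ.m≤n*m c 2) (ℕₚ.≤-trans (ℕₚ.m≤n+m _ a) total)

-- Reflections

-- On geodesics these are the reflections in Re z = -1, in |z + 1|² = 2 for both `γ` and `γ̄`, which
-- differ by negating the form, and in |z| = 1.
α γ γ̄ γ₀ : ℤ³ → ℤ³
α  (r , s , v) = + 2 * s - r , s , v + r - s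
γ  (r , s , v) = - (s + + 2 * v) , - (r + + 2 * v) , v
γ̄  (r , s , v) = s + + 2 * v , r + + 2 * v , - v
γ₀ (r , s , v) = r , - s - + 4 * v , v

α-Form : ∀ n {p} → Form n p → Form n (α p)
α-Form n {r , s , v} ((κ , refl) , (μ , refl) , e) =
  (+ 2 * μ - κ , id₁ κ μ) , (μ , refl) , trans (id₂ (+ 6 * κ + + 1) (+ 6 * μ + + 1) v) e
  where
  id₁ : ∀ κ μ → + 2 * (+ 6 * μ + + 1) - (+ 6 * κ + + 1) ≡ + 6 * (+ 2 * μ - κ) + + 1
  id₁ = ℤ-Solver.solve-∀
  id₂ : ∀ r s v → (+ 2 * s - r) * (+ 2 * s - r) + s * s + + 4 * (s * (v + r - s)) ≡ r * r + s * s + + 4 * (s * v)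
  id₂ = ℤ-Solver.solve-∀

α-ε : ∀ r s v → ε (α (r , s , v)) ≡ ε (r , s , v)
α-ε = lemma
  where
  lemma : ∀ r s v → + 2 * s - r + + 2 * (v + r - s) ≡ r + + 2 * v
  lemma = ℤ-Solver.solve-∀

α-δ : ∀ r s v → δ (α (r , s , v)) ≡ δ (r , s , v)
α-δ r s v = cong (_- s) (α-ε r s v)

α-α : ∀ p → α (α p) ≡ p
α-α (r , s , v) = ,-≡ (id₁ r s) refl (id₂ r s v)
  where
  id₁ : ∀ r s → + 2 * s - (+ 2 * s - r) ≡ r
  id₁ = ℤ-Solver.solve-∀
  id₂ : ∀ r s v → v + r - s + (+ 2 * s - r) - s ≡ v
  id₂ = ℤ-Solver.solve-∀

α-fixed : ∀ {r s v} → α (r , s , v) ≡ (r , s , v) → r ≡ s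
α-fixed {r} {s} {v} e = go (proj₁ (,,-≡ e))
  where
  go : + 2 * s - r ≡ r → r ≡ s
  go e = sym (2*-cancel (linear (+ 1) e (solve (r ∷ s ∷ []))))

-- What survives are the geodesics orthogonal to the mirror Re z = -1, namely those with r = s.
cnt-α-δ : ∀ n {b} → Cnt (Same n sPart δ) b → Cnt (λ p → Same n sPart δ p × α p ≡ p) b
cnt-α-δ n = cnt-fixed _≟³_ α
  (λ { {r , s , v} (t , e) → α-Form n t , trans e (sym (cong pos (α-δ r s v))) }) (λ {p} _ → α-α p)

cnt-α-ε : ∀ n {b} → Cnt (Same n sPart ε) b → Cnt (λ p → Same n sPart ε p × α p ≡ p) b
cnt-α-ε n = cnt-fixed _≟³_ α
  (λ { {r , s , v} (t , e) → α-Form n t , trans e (sym (cong pos (α-ε r s v))) }) (λ {p} _ → α-α p)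

-- With c = 1 this excludes δ = 0, and with c = -1 the fixed points of γ.
no-mirror : ∀ n κ μ c → (c ≡ + 1 ⊎ c ≡ - (+ 1)) →
  + 18 * ((κ - μ) * (κ - μ)) + c * ((+ 6 * μ + + 1) * (+ 6 * μ + + 1)) ≢ + 8 * n + + 5
-- Modulo 8 the odd square is 1 and 18(κ - μ)² is 0 or 2, so the left side is c or c + 2, which is
-- never 5.
no-mirror n κ μ c c± e = go (half (κ - μ)) (odd-square (+ 3 * μ)) c± e
  where
  sq : ∀ {w} → (+ 2 * (+ 3 * μ) + + 1) * (+ 2 * (+ 3 * μ) + + 1) ≡ + 8 * w + + 1 → (+ 6 * μ + + 1) * (+ 6 * μ + + 1) ≡ + 8 * w + + 1
  sq {w} e = linear (+ 1) e (solve (μ ∷ w ∷ []))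
  reduce : ∀ {t u m} → t ≡ m → (+ 6 * μ + + 1) * (+ 6 * μ + + 1) ≡ u → + 18 * (t * t) + c * ((+ 6 * μ + + 1) * (+ 6 * μ + + 1)) ≡ + 8 * n + + 5 →
    + 18 * (m * m) + c * u ≡ + 8 * n + + 5
  reduce {t} refl e f = trans (cong (λ z → + 18 * (t * t) + c * z) (sym e)) f
  Odd² : Set
  Odd² = Σ ℤ λ w → (+ 2 * (+ 3 * μ) + + 1) * (+ 2 * (+ 3 * μ) + + 1) ≡ + 8 * w + + 1
  last : ∀ t w → (Σ ℤ λ x → (+ 2 * t + + 1) * (+ 2 * t + + 1) ≡ + 8 * x + + 1) → (c ≡ + 1 ⊎ c ≡ - (+ 1)) →
    + 18 * ((+ 2 * t + + 1) * (+ 2 * t + + 1)) + c * (+ 8 * w + + 1) ≡ + 8 * n + + 5 → ⊥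
  last t w (x , f) (inj₁ refl) e = go′ (trans (cong (λ z → + 18 * z + + 1 * (+ 8 * w + + 1)) (sym f)) e)
    where
    go′ : + 18 * (+ 8 * x + + 1) + + 1 * (+ 8 * w + + 1) ≡ + 8 * n + + 5 → ⊥
    go′ e = clash 8 14 (n - + 18 * x - w) (- (+ 1)) e (solve (x ∷ w ∷ n ∷ []))
  last t w (x , f) (inj₂ refl) e = go′ (trans (cong (λ z → + 18 * z + - (+ 1) * (+ 8 * w + + 1)) (sym f)) e)
    where
    go′ : + 18 * (+ 8 * x + + 1) + - (+ 1) * (+ 8 * w + + 1) ≡ + 8 * n + + 5 → ⊥
    go′ e = clash 8 12 (n - + 18 * x + w) (- (+ 1)) e (solve (x ∷ w ∷ n ∷ []))
  first : ∀ t w → (c ≡ + 1 ⊎ c ≡ - (+ 1)) → + 18 * (+ 2 * t * (+ 2 * t)) + c * (+ 8 * w + + 1) ≡ + 8 * n + + 5 → ⊥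
  first t w (inj₁ refl) e = clash 8 4 (+ 9 * (t * t) + w - n) (+ 1) e (solve (t ∷ w ∷ n ∷ []))
  first t w (inj₂ refl) e = clash 8 6 (+ 9 * (t * t) - w - n) (+ 1) e (solve (t ∷ w ∷ n ∷ []))
  go : Half (κ - μ) → Odd² → (c ≡ + 1 ⊎ c ≡ - (+ 1)) →
    + 18 * ((κ - μ) * (κ - μ)) + c * ((+ 6 * μ + + 1) * (+ 6 * μ + + 1)) ≡ + 8 * n + + 5 → ⊥
  go (inj₁ (t , f)) (w , g) c± e = first t w c± (reduce f (sq {w} g) e)
  go (inj₂ (t , f)) (w , g) c± e = last t w (odd-square t) c± (reduce f (sq {w} g) e)

δ≢0 : ∀ n {p} → Form n p → δ p ≢ + 0
δ≢0 n {r , s , v} ((κ , refl) , (μ , refl) , e) δ≡0 = no-mirror n κ μ (+ 1) (inj₁ refl) (2*-cancel (combine e δ≡0))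
  where
  combine : (+ 6 * κ + + 1) * (+ 6 * κ + + 1) + (+ 6 * μ + + 1) * (+ 6 * μ + + 1) + + 4 * ((+ 6 * μ + + 1) * v) ≡ + 16 * n + + 10 →
    + 6 * κ + + 1 + + 2 * v - (+ 6 * μ + + 1) ≡ + 0 →
    + 2 * (+ 18 * ((κ - μ) * (κ - μ)) + + 1 * ((+ 6 * μ + + 1) * (+ 6 * μ + + 1))) ≡ + 2 * (+ 8 * n + + 5)
  combine e f = linear₂ (+ 1) (- (+ 2 * (+ 6 * μ + + 1))) e f (solve (κ ∷ μ ∷ v ∷ n ∷ []))

γ-eq : ∀ r s v → - (s + + 2 * v) * - (s + + 2 * v) + - (r + + 2 * v) * - (r + + 2 * v) + + 4 * (- (r + + 2 * v) * v)
  ≡ r * r + s * s + + 4 * (s * v)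
γ-eq = ℤ-Solver.solve-∀

γ̄-eq : ∀ r s v → (s + + 2 * v) * (s + + 2 * v) + (r + + 2 * v) * (r + + 2 * v) + + 4 * ((r + + 2 * v) * - v)
  ≡ r * r + s * s + + 4 * (s * v)
γ̄-eq = ℤ-Solver.solve-∀

γ₀-eq : ∀ r s v → r * r + (- s - + 4 * v) * (- s - + 4 * v) + + 4 * ((- s - + 4 * v) * v) ≡ r * r + s * s + + 4 * (s * v)
γ₀-eq = ℤ-Solver.solve-∀

-- `γ` preserves v and `δ`. For n ≡ 0 (mod 3) the equation gives v ≡ 2 (mod 3), exactly what makes
-- -(s + 2v) and -(r + 2v) again 1 modulo 6.
γ-even : ∀ k {b} → Cnt (Diff (+ 3 * k) vPart δ) b → b ≡ false
γ-even k = cnt-even _≟³_ γ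
  (λ { {r , s , v} (t , ne) → γ-Form t , λ e → ne (trans e (cong pos (id₁ r s v))) })
  (λ { {r , s , v} _ → ,-≡ (id₂ r v) (id₂ s v) refl })
  (λ { {r , s , v} (t , _) e → γ-fixed t (proj₁ (,,-≡ e)) })
  where
  id₁ : ∀ r s v → - (s + + 2 * v) + + 2 * v - - (r + + 2 * v) ≡ r + + 2 * v - s
  id₁ = ℤ-Solver.solve-∀
  id₂ : ∀ r v → - (- (r + + 2 * v) + + 2 * v) ≡ r
  id₂ = ℤ-Solver.solve-∀
  id₃ : ∀ μ m → - (+ 6 * μ + + 1 + + 2 * (+ 3 * m + + 2)) ≡ + 6 * (- μ - m - + 1) + + 1
  id₃ = ℤ-Solver.solve-∀
  γ-Form : ∀ {p} → Form (+ 3 * k) p → Form (+ 3 * k) (γ p)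
  γ-Form {r , s , v} ((κ , refl) , (μ , refl) , e) = go v
    -- Writing v as 4v - 3v and replacing 4v by means of the equation exhibits v - 2 as a multiple
    -- of 3.
    (+ 16 * k + + 2 - v - + 8 * (μ * v) - + 4 * (+ 3 * (κ * κ) + κ + + 3 * (μ * μ) + μ))
    (linear (+ 1) e (solve (k ∷ v ∷ κ ∷ μ ∷ []))) e
    where
    go : ∀ v m → v ≡ + 3 * m + + 2 →
      (+ 6 * κ + + 1) * (+ 6 * κ + + 1) + (+ 6 * μ + + 1) * (+ 6 * μ + + 1) + + 4 * ((+ 6 * μ + + 1) * v) ≡ + 16 * (+ 3 * k) + + 10 →
      Form (+ 3 * k) (γ (+ 6 * κ + + 1 , + 6 * μ + + 1 , v))
    go v m refl e = (- μ - m - + 1 , id₃ μ m) , (- κ - m - + 1 , id₃ κ m) , trans (γ-eq (+ 6 * κ + + 1) (+ 6 * μ + + 1) v) e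
  γ-fixed : ∀ {r s v} → Form (+ 3 * k) (r , s , v) → - (s + + 2 * v) ≢ r
  γ-fixed {r} {s} {v} ((κ , refl) , (μ , refl) , e) f = no-mirror (+ 3 * k) κ μ (- (+ 1)) (inj₂ refl) (2*-cancel (combine e f))
    where
    combine : (+ 6 * κ + + 1) * (+ 6 * κ + + 1) + (+ 6 * μ + + 1) * (+ 6 * μ + + 1) + + 4 * ((+ 6 * μ + + 1) * v) ≡ + 16 * (+ 3 * k) + + 10 →
      - (+ 6 * μ + + 1 + + 2 * v) ≡ + 6 * κ + + 1 →
      + 2 * (+ 18 * ((κ - μ) * (κ - μ)) + - (+ 1) * ((+ 6 * μ + + 1) * (+ 6 * μ + + 1))) ≡ + 2 * (+ 8 * (+ 3 * k) + + 5)
    combine e f = linear₂ (+ 1) (+ 2 * (+ 6 * μ + + 1)) e f (solve (κ ∷ μ ∷ v ∷ k ∷ []))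

-- For n ≡ 1 (mod 3) the residue v ≡ 0 makes the negated reflection the admissible one. It reverses
-- the signs of v and `δ`, which `pos` reflects only away from 0: `δ` never vanishes, and the forms
-- with v = 0 are left to `cnt-Z₀`.
γ̄-even : ∀ k {b} → Cnt (λ p → Diff (+ 3 * k + + 1) vPart δ p × ¬ vPart p ≡ + 0) b → b ≡ false
γ̄-even k = cnt-even _≟³_ γ̄
  (λ { {r , s , v} ((t , ne) , v≢0) → (γ̄-Form t , λ e → ne (not-injective (trans (sym (pos-neg v v≢0)) (trans e
          (trans (cong pos (id₁ r s v)) (pos-neg (r + + 2 * v - s) (δ≢0 (+ 3 * k + + 1) {r , s , v} t))))))) ,
       λ e → v≢0 (ℤₚ.neg-injective e) })
  (λ { {r , s , v} _ → ,-≡ (id₂ r v) (id₂ s v) (ℤₚ.neg-involutive v) })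
  (λ { {r , s , v} (_ , v≢0) e → v≢0 (zero-only v (proj₂ (proj₂ (,,-≡ e)))) })
  where
  not-injective : ∀ {a b} → not a ≡ not b → a ≡ b
  not-injective {a} {b} e = trans (sym (not-involutive a)) (trans (cong not e) (not-involutive b))
  zero-only : ∀ v → - v ≡ v → v ≡ + 0
  zero-only v e = 2*-cancel (linear (- (+ 1)) e (solve (v ∷ [])))
  id₁ : ∀ r s v → s + + 2 * v + + 2 * - v - (r + + 2 * v) ≡ - (r + + 2 * v - s)
  id₁ = ℤ-Solver.solve-∀
  id₂ : ∀ r v → r + + 2 * v + + 2 * - v ≡ r
  id₂ = ℤ-Solver.solve-∀
  id₃ : ∀ μ m → + 6 * μ + + 1 + + 2 * (+ 3 * m) ≡ + 6 * (μ + m) + + 1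
  id₃ = ℤ-Solver.solve-∀
  γ̄-Form : ∀ {p} → Form (+ 3 * k + + 1) p → Form (+ 3 * k + + 1) (γ̄ p)
  γ̄-Form {r , s , v} ((κ , refl) , (μ , refl) , e) = go v
    (+ 16 * k + + 8 - v - + 8 * (μ * v) - + 4 * (+ 3 * (κ * κ) + κ + + 3 * (μ * μ) + μ))
    (linear (+ 1) e (solve (k ∷ v ∷ κ ∷ μ ∷ []))) e
    where
    go : ∀ v m → v ≡ + 3 * m →
      (+ 6 * κ + + 1) * (+ 6 * κ + + 1) + (+ 6 * μ + + 1) * (+ 6 * μ + + 1) + + 4 * ((+ 6 * μ + + 1) * v) ≡ + 16 * (+ 3 * k + + 1) + + 10 →
      Form (+ 3 * k + + 1) (γ̄ (+ 6 * κ + + 1 , + 6 * μ + + 1 , v))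
    go v m refl e = (μ + m , id₃ μ m) , (κ + m , id₃ κ m) , trans (γ̄-eq (+ 6 * κ + + 1) (+ 6 * μ + + 1) v) e

-- For n ≡ 2 (mod 3) one has v ≡ 1 (mod 3), and inversion in the unit circle preserves r and v,
-- hence `ε`. A fixed form would have the even entry s = -2v.
γ₀-even : ∀ k {b} → Cnt (Diff (+ 3 * k + + 2) vPart ε) b → b ≡ false
γ₀-even k = cnt-even _≟³_ γ₀
  (λ { {r , s , v} (t , ne) → γ₀-Form t , ne })
  (λ { {r , s , v} _ → ,-≡ refl (id₂ s v) refl })
  (λ { {r , s , v} (t , _) e → γ₀-fixed t (proj₁ (proj₂ (,,-≡ e))) })
  where
  id₂ : ∀ s v → - (- s - + 4 * v) - + 4 * v ≡ s
  id₂ = ℤ-Solver.solve-∀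
  id₃ : ∀ μ m → - (+ 6 * μ + + 1) - + 4 * (+ 3 * m + + 1) ≡ + 6 * (- μ - + 2 * m - + 1) + + 1
  id₃ = ℤ-Solver.solve-∀
  γ₀-Form : ∀ {p} → Form (+ 3 * k + + 2) p → Form (+ 3 * k + + 2) (γ₀ p)
  γ₀-Form {r , s , v} ((κ , refl) , (μ , refl) , e) = go v
    (+ 16 * k + + 13 - v - + 8 * (μ * v) - + 4 * (+ 3 * (κ * κ) + κ + + 3 * (μ * μ) + μ))
    (linear (+ 1) e (solve (k ∷ v ∷ κ ∷ μ ∷ []))) e
    where
    go : ∀ v m → v ≡ + 3 * m + + 1 →
      (+ 6 * κ + + 1) * (+ 6 * κ + + 1) + (+ 6 * μ + + 1) * (+ 6 * μ + + 1) + + 4 * ((+ 6 * μ + + 1) * v) ≡ + 16 * (+ 3 * k + + 2) + + 10 →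
      Form (+ 3 * k + + 2) (γ₀ (+ 6 * κ + + 1 , + 6 * μ + + 1 , v))
    go v m refl e = (κ , refl) , (- μ - + 2 * m - + 1 , id₃ μ m) , trans (γ₀-eq (+ 6 * κ + + 1) (+ 6 * μ + + 1) v) e
  γ₀-fixed : ∀ {r s v} → Form (+ 3 * k + + 2) (r , s , v) → - s - + 4 * v ≢ s
  γ₀-fixed {r} {s} {v} (_ , (μ , refl) , _) f = clash 4 2 (- v - + 3 * μ) (+ 1) f (solve (v ∷ μ ∷ []))

-- Fixed points of α: factorisations of 8n + 5

-- For r = s the equation halves to s(s + 2v) = 8n + 5, where v turns out to be even; here v = 2z.
F : ℤ → ℤ × ℤ → Set
F n (s , z) = (Σ ℤ λ μ → s ≡ + 6 * μ + + 1) × s * s + + 4 * (s * z) ≡ + 8 * n + + 5 × pos s ≡ pos z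

cnt-F⇒fixed : ∀ n {b} → Cnt (F n) b → Cnt (λ p → Same n sPart δ p × α p ≡ p) b
cnt-F⇒fixed n = cnt-image {P = F n} (λ { (s , z) → s , s , + 2 * z })
  (λ { {s , z} (sμ , e , ss) → ((sμ , sμ , eq s z e) , trans ss (sym (trans (cong pos (id₁ s z)) (pos-scale 3 z)))) ,
       ,-≡ (id₂ s) refl (id₃ s z) })
  (λ { {s , z} {s′ , z′} _ _ e → inj (,,-≡ e) })
  (λ { {r , s , v} ((t , ss) , fx) → onto t ss (α-fixed {r} {s} {v} fx) })
  where
  id₁ : ∀ s z → s + + 2 * (+ 2 * z) - s ≡ + 4 * z
  id₁ = ℤ-Solver.solve-∀
  id₂ : ∀ s → + 2 * s - s ≡ s
  id₂ = ℤ-Solver.solve-∀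
  id₃ : ∀ s z → + 2 * z + s - s ≡ + 2 * z
  id₃ = ℤ-Solver.solve-∀
  eq : ∀ s z → s * s + + 4 * (s * z) ≡ + 8 * n + + 5 → s * s + s * s + + 4 * (s * (+ 2 * z)) ≡ + 16 * n + + 10
  eq s z e = linear (+ 2) e (solve (s ∷ z ∷ n ∷ []))
  inj : ∀ {s z s′ z′} → s ≡ s′ × s ≡ s′ × + 2 * z ≡ + 2 * z′ → (s , z) ≡ (s′ , z′)
  inj (refl , _ , e) = cong (_ ,_) (2*-cancel e)
  onto : ∀ {r s v} → Form n (r , s , v) → pos s ≡ pos (r + + 2 * v - s) → r ≡ s →
    Σ (ℤ × ℤ) λ { (s′ , z) → F n (s′ , z) × (s′ , s′ , + 2 * z) ≡ (r , s , v) }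
  -- Modulo 4, s² = 1 and 8n + 5 = 1, so 2sv is divisible by 4 and v is even; the witness is v/2
  -- with the equation substituted.
  onto {s = s} {v} (_ , (μ , refl) , e) ss refl = go v (+ 2 * n + + 1 - + 9 * (μ * μ) - + 3 * μ - + 3 * (μ * v))
    (ℤₚ.*-cancelˡ-≡ (+ 4) v _ (linear (+ 1) e (solve (n ∷ μ ∷ v ∷ [])))) e ss
    where
    go : ∀ v z → v ≡ + 2 * z →
      (+ 6 * μ + + 1) * (+ 6 * μ + + 1) + (+ 6 * μ + + 1) * (+ 6 * μ + + 1) + + 4 * ((+ 6 * μ + + 1) * v) ≡ + 16 * n + + 10 →
      pos (+ 6 * μ + + 1) ≡ pos (+ 6 * μ + + 1 + + 2 * v - (+ 6 * μ + + 1)) →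
      Σ (ℤ × ℤ) λ { (s′ , z) → F n (s′ , z) × (s′ , s′ , + 2 * z) ≡ (+ 6 * μ + + 1 , + 6 * μ + + 1 , v) }
    go _ z refl e ss = (+ 6 * μ + + 1 , z) , ((μ , refl) , 2*-cancel (linear (+ 1) e (solve (μ ∷ z ∷ n ∷ []))) ,
      trans ss (trans (cong pos (id₁ (+ 6 * μ + + 1) z)) (pos-scale 3 z))) , refl

pos-* : ∀ {s g m} → s * g ≡ +[1+ m ] → pos s ≡ pos g
pos-* {+0}       {g}       ()
pos-* {+[1+ a ]} {+0}      e = contradiction (trans (sym (ℤₚ.*-zeroʳ +[1+ a ])) e) λ ()
pos-* {+[1+ a ]} {+[1+ b ]} e = refl
pos-* {+[1+ a ]} { -[1+ b ]} ()
pos-* { -[1+ a ]} {+0}      e = refl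
pos-* { -[1+ a ]} {+[1+ b ]} ()
pos-* { -[1+ a ]} { -[1+ b ]} e = refl

abs-* : ∀ s z → z ≢ + 0 → pos s ≡ pos z → abs s * abs z ≡ s * z
abs-* s z z≢0 ss = go (abs-cases s) (abs-cases z)
  where
  neg² : ∀ s z → - s * - z ≡ s * z
  neg² = ℤ-Solver.solve-∀
  go : (pos s ≡ true × abs s ≡ s) ⊎ (pos s ≡ false × abs s ≡ - s) →
    (pos z ≡ true × abs z ≡ z) ⊎ (pos z ≡ false × abs z ≡ - z) → abs s * abs z ≡ s * z
  go (inj₁ (_ , e)) (inj₁ (_ , f)) = cong₂ _*_ e f
  go (inj₁ (p , _)) (inj₂ (q , _)) = contradiction (trans (sym p) (trans ss q)) λ ()
  go (inj₂ (p , _)) (inj₁ (q , _)) = contradiction (trans (sym p) (trans ss q)) λ ()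
  go (inj₂ (_ , e)) (inj₂ (_ , f)) = trans (cong₂ _*_ e f) (neg² s z)

pos-neg-true : ∀ {x} → pos x ≡ true → pos (- x) ≡ false
pos-neg-true {+[1+ n ]} _ = refl

,₂-≡ : ∀ {x y x′ y′ : ℤ} → x ≡ x′ → y ≡ y′ → (x , y) ≡ (x′ , y′)
,₂-≡ refl refl = refl

,,₂-≡ : ∀ {x y x′ y′ : ℤ} → (x , y) ≡ (x′ , y′) → x ≡ x′ × y ≡ y′
,,₂-≡ refl = refl , refl

-- Under the first hypothesis y is prime to 6, so exactly one of the pairs (y, z) and (-y, -z)
-- starts with a number that is 1 modulo 6.
cnt-F : ∀ n {b} → (∀ t z → + 3 * t * (+ 3 * t) + + 4 * (+ 3 * t * z) ≢ + 8 * n + + 5) → Cnt (MF n) b → Cnt (F n) b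
cnt-F n no3 = cnt-preimage {P = F n} {Q = MF n} (λ { (s , z) → abs s , abs z })
  (λ { {s , z} (sμ , e , ss) → abs-pos (s≢0 sμ) , abs-pos (z≢0 s z e) ,
       trans (cong₂ (λ a b → a + + 4 * b) (abs-square s) (abs-* s z (z≢0 s z e) ss)) e })
  (λ { {s , z} {s′ , z′} ((μ , refl) , _ , ss) ((μ′ , refl) , _ , ss′) e → inj μ μ′ z z′ ss ss′ (,,₂-≡ e) })
  (λ { {y , z} (py , pz , e) → onto y z py pz e (mod6 y) })
  where
  z≢0 : ∀ s z → s * s + + 4 * (s * z) ≡ + 8 * n + + 5 → z ≢ + 0
  z≢0 s z e refl = square≢8n+5 n s (linear (+ 1) e (solve (s ∷ n ∷ [])))
  inj : ∀ μ μ′ z z′ → pos (+ 6 * μ + + 1) ≡ pos z → pos (+ 6 * μ′ + + 1) ≡ pos z′ →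
    abs (+ 6 * μ + + 1) ≡ abs (+ 6 * μ′ + + 1) × abs z ≡ abs z′ → (+ 6 * μ + + 1 , z) ≡ (+ 6 * μ′ + + 1 , z′)
  inj μ μ′ z z′ ss ss′ (e , f) = ,₂-≡ s≡ (z≡ (abs-cases z) (abs-cases z′))
    where
    s≡ = abs-inj μ μ′ e
    pz≡ : pos z ≡ pos z′
    pz≡ = trans (sym ss) (trans (cong pos s≡) ss′)
    z≡ : (pos z ≡ true × abs z ≡ z) ⊎ (pos z ≡ false × abs z ≡ - z) →
      (pos z′ ≡ true × abs z′ ≡ z′) ⊎ (pos z′ ≡ false × abs z′ ≡ - z′) → z ≡ z′
    z≡ (inj₁ (_ , a)) (inj₁ (_ , b)) = trans (sym a) (trans f b)
    z≡ (inj₁ (p , _)) (inj₂ (q , _)) = contradiction (trans (sym p) (trans pz≡ q)) λ ()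
    z≡ (inj₂ (p , _)) (inj₁ (q , _)) = contradiction (trans (sym p) (trans pz≡ q)) λ ()
    z≡ (inj₂ (_ , a)) (inj₂ (_ , b)) = ℤₚ.neg-injective (trans (sym a) (trans f b))
  onto : ∀ y z → pos y ≡ true → pos z ≡ true → y * y + + 4 * (y * z) ≡ + 8 * n + + 5 → Mod6 y →
    Σ (ℤ × ℤ) λ { (s , z′) → F n (s , z′) × (abs s , abs z′) ≡ (y , z) }
  onto y z py pz e (even t refl)  = ⊥-elim (clash 2 5 (+ 2 * (t * t) + + 4 * (t * z) - + 4 * n) (+ 1) e (solve (t ∷ z ∷ n ∷ [])))
  onto y z py pz e (three t refl) = ⊥-elim (no3 t z e)
  onto y z py pz e (≡1 t f)      = (y , z) , ((t , f) , e , trans py (sym pz)) , ,₂-≡ (pos⇒abs py) (pos⇒abs pz)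
  onto y z py pz e (≡-1 t f)     = (- y , - z) ,
    ((t , f) , trans (id₁ y z) e , trans (pos-neg-true py) (sym (pos-neg-true pz))) ,
    ,₂-≡ (trans (abs-neg y) (pos⇒abs py)) (trans (abs-neg z) (pos⇒abs pz))
    where
    id₁ : ∀ y z → - y * - y + + 4 * (- y * - z) ≡ y * y + + 4 * (y * z)
    id₁ = ℤ-Solver.solve-∀

-- The divisors prime to 6 of 8n + 5, when 3 divides it

F₀ : ℤ → ℤ × ℤ → Set
F₀ n (s , g) = (Σ ℤ λ μ → s ≡ + 6 * μ + + 1) × s * g ≡ + 8 * n + + 5

-- For r = s the cofactor s + 2v is `ε` itself; since its product with s is positive, both have the
-- same sign, as `Same` demands.
cnt-fixed⇒F₀ : ∀ n {b} → (Σ ℕ λ N → + 8 * n + + 5 ≡ +[1+ N ]) → Cnt (λ p → Same n sPart ε p × α p ≡ p) b → Cnt (F₀ n) b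
cnt-fixed⇒F₀ n (N , N≡) = cnt-image {Q = F₀ n} (λ { (r , s , v) → s , s + + 2 * v })
  (λ { {r , s , v} ((t , _) , fx) → image t (α-fixed {r} {s} {v} fx) })
  (λ { {r , s , v} {r′ , s′ , v′} (_ , fx) (_ , fx′) e → inj (α-fixed {r} {s} {v} fx) (α-fixed {r′} {s′} {v′} fx′) (,,₂-≡ e) })
  (λ { {s , g} ((μ , refl) , e) → onto μ g e (half g) })
  where
  image : ∀ {r s v} → Form n (r , s , v) → r ≡ s → F₀ n (s , s + + 2 * v)
  image {s = s} {v} (_ , sμ , e) refl = sμ , 2*-cancel (linear (+ 1) e (solve (s ∷ v ∷ n ∷ [])))
  inj : ∀ {r s v r′ s′ v′} → r ≡ s → r′ ≡ s′ → s ≡ s′ × s + + 2 * v ≡ s′ + + 2 * v′ → (r , s , v) ≡ (r′ , s′ , v′)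
  inj {s = s} {v} {v′ = v′} refl refl (refl , e) = ,-≡ refl refl (2*-cancel (linear (+ 1) e (solve (s ∷ v ∷ v′ ∷ []))))
  id₂ : ∀ s → + 2 * s - s ≡ s
  id₂ = ℤ-Solver.solve-∀
  id₃ : ∀ s v → v + s - s ≡ v
  id₃ = ℤ-Solver.solve-∀
  onto : ∀ μ g → (+ 6 * μ + + 1) * g ≡ + 8 * n + + 5 → Half g →
    Σ ℤ³ λ { (r , s , v) → (Same n sPart ε (r , s , v) × α (r , s , v) ≡ (r , s , v)) × (s , s + + 2 * v) ≡ (+ 6 * μ + + 1 , g) }
  onto μ g e (inj₁ (a , refl)) = ⊥-elim (clash 2 5 ((+ 6 * μ + + 1) * a - + 4 * n) (+ 1) e (solve (μ ∷ a ∷ n ∷ [])))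
  onto μ g e (inj₂ (a , refl)) = (+ 6 * μ + + 1 , + 6 * μ + + 1 , a - + 3 * μ) ,
    ((((μ , refl) , (μ , refl) , linear (+ 2) e (solve (μ ∷ a ∷ n ∷ []))) ,
      trans (pos-* {+ 6 * μ + + 1} {+ 2 * a + + 1} (trans e N≡)) (cong pos (sym (g≡ μ a)))) ,
     ,-≡ (id₂ (+ 6 * μ + + 1)) refl (id₃ (+ 6 * μ + + 1) (a - + 3 * μ))) ,
    ,₂-≡ refl (g≡ μ a)
    where
    g≡ : ∀ μ a → + 6 * μ + + 1 + + 2 * (a - + 3 * μ) ≡ + 2 * a + + 1
    g≡ = ℤ-Solver.solve-∀

Fact : ℤ → ℤ × ℤ → Set
Fact m (s , g) = pos s ≡ true × s * g ≡ m

pos-factor : ∀ {s g N} → pos s ≡ true → s * g ≡ +[1+ N ] → pos g ≡ true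
pos-factor {s} {g} ps e = trans (sym (pos-* {s} {g} e)) ps

cnt-Fact : ∀ m → (Σ ℕ λ N → m ≡ +[1+ N ]) → ∃ λ b → Cnt (Fact m) b
cnt-Fact m (N , refl) = go (cnt-box {P = P} (suc N) P? (λ {x} {y} {z} → bound x y z))
  where
  P : ℤ³ → Set
  P (x , y , z) = Fact m (x , y) × z ≡ + 0
  P? : Decidable P
  P? (x , y , z) = (pos? x true ×-dec (x * y ℤ.≟ m)) ×-dec (z ℤ.≟ + 0)
  bound : ∀ x y z → P (x , y , z) → Bounded (suc N) x × Bounded (suc N) y × Bounded (suc N) z
  bound +[1+ a ] +0 z ((_ , e) , _) = contradiction (trans (sym (ℤₚ.*-zeroʳ +[1+ a ])) e) λ ()
  bound +[1+ a ] +[1+ b ] z ((_ , e) , refl) =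
    ℕₚ.≤-trans (ℕₚ.m≤m*n (suc a) (suc b)) (ℕₚ.≤-reflexive (ℤₚ.+-injective e)) ,
    ℕₚ.≤-trans (ℕₚ.m≤n*m (suc b) (suc a)) (ℕₚ.≤-reflexive (ℤₚ.+-injective e)) , z≤n
  bound +[1+ a ] -[1+ b ] z ((_ , ()) , _)
  go : (∃ λ b → Cnt P b) → ∃ λ b → Cnt (Fact m) b
  go (b , c) = b , cnt-preimage {P = Fact m} {Q = P} (λ { (x , y) → x , y , + 0 }) (λ f → f , refl)
    (λ { {_ , _} {_ , _} _ _ refl → refl }) (λ { {x , y , z} (f , refl) → (x , y) , f , refl }) c

-- Exchanging the two factors moves every factorisation of a nonsquare.
Fact-even : ∀ m {b} → (Σ ℕ λ N → m ≡ +[1+ N ]) → (∀ u → u * u ≢ m) → Cnt (Fact m) b → b ≡ false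
Fact-even m (N , N≡) nonsq = cnt-even _≟²_ (λ { (s , g) → g , s })
  (λ { {s , g} (ps , e) → pos-factor {s} {g} ps (trans e N≡) , trans (ℤₚ.*-comm g s) e })
  (λ { {_ , _} _ → refl })
  (λ { {s , g} (_ , e) f → nonsq s (trans (cong (s *_) (sym (proj₁ (,,₂-≡ f)))) e) })

-- Here 8n + 5 = 3(8k + 7), and neither this number nor 8k + 7 is a square, so both have an even
-- number of divisors. Divisors of the former that are multiples of 3 correspond to those of the
-- latter; the remaining ones, signed to be 1 modulo 6, are thus even in number.
F₀-even : ∀ k {b} → (Σ ℕ λ N → + 8 * (+ 3 * k + + 2) + + 5 ≡ +[1+ N ]) → (Σ ℕ λ N → + 8 * k + + 7 ≡ +[1+ N ]) →
  Cnt (F₀ (+ 3 * k + + 2)) b → b ≡ false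
F₀-even k {b} hN hN′ cF₀ = go (cnt-Fact (+ 8 * (+ 3 * k + + 2) + + 5) hN)
  where
  Triple : ℤ × ℤ → Set
  Triple (s , g) = Σ ℤ λ t → s ≡ + 3 * t
  triple? : ∀ s → Third s → Dec (Σ ℤ λ t → s ≡ + 3 * t)
  triple? s (inj₁ t) = yes t
  triple? s (inj₂ (inj₁ (t , refl))) = no λ { (u , e) → clash 3 1 (u - t) (- (+ 1)) e (solve (t ∷ u ∷ [])) }
  triple? s (inj₂ (inj₂ (t , refl))) = no λ { (u , e) → clash 3 2 (u - t) (- (+ 1)) e (solve (t ∷ u ∷ [])) }
  nonsq : ∀ u → u * u ≢ + 8 * k + + 7
  nonsq u = go (half u)
    where
    go′ : ∀ t → (Σ ℤ λ w → (+ 2 * t + + 1) * (+ 2 * t + + 1) ≡ + 8 * w + + 1) → (+ 2 * t + + 1) * (+ 2 * t + + 1) ≡ + 8 * k + + 7 → ⊥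
    go′ t (w , f) e = clash 8 6 (w - k) (+ 1) (trans (sym f) e) (solve (w ∷ k ∷ []))
    go : Half u → u * u ≢ + 8 * k + + 7
    go (inj₁ (t , refl)) e = clash 4 7 (t * t - + 2 * k) (+ 1) e (solve (t ∷ k ∷ []))
    go (inj₂ (t , refl)) e = go′ t (odd-square t) e
  onto : ∀ y g → Fact (+ 8 * (+ 3 * k + + 2) + + 5) (y , g) → ¬ Triple (y , g) → Mod6 y → Σ (ℤ × ℤ) λ { (s , g′) → F₀ (+ 3 * k + + 2) (s , g′) × (abs s , abs g′) ≡ (y , g) }
  onto y g (py , e) n3 (even t refl)  = ⊥-elim (clash 2 21 (t * g - + 12 * k) (+ 1) e (solve (t ∷ g ∷ k ∷ [])))
  onto y g (py , e) n3 (three t f) = ⊥-elim (n3 (t , f))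
  onto y g (py , e) n3 (≡1 t f)  = (y , g) , ((t , f) , e) , ,₂-≡ (pos⇒abs py) (pos⇒abs (pos-factor {y} {g} py (trans e (proj₂ hN))))
  onto y g (py , e) n3 (≡-1 t f) = (- y , - g) , ((t , f) , trans (id₁ y g) e) ,
    ,₂-≡ (trans (abs-neg y) (pos⇒abs py)) (trans (abs-neg g) (pos⇒abs (pos-factor {y} {g} py (trans e (proj₂ hN)))))
    where
    id₁ : ∀ y z → - y * - z ≡ y * z
    id₁ = ℤ-Solver.solve-∀
  prime-to-3 : ∀ {c} → Cnt (λ p → Fact (+ 8 * (+ 3 * k + + 2) + + 5) p × ¬ Triple p) c → Cnt (F₀ (+ 3 * k + + 2)) c
  prime-to-3 = cnt-preimage {P = F₀ (+ 3 * k + + 2)} {Q = λ p → Fact (+ 8 * (+ 3 * k + + 2) + + 5) p × ¬ Triple p} (λ { (s , g) → abs s , abs g })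
    (λ { {s , g} ((μ , refl) , e) → (abs-pos (six+1≢0 μ) , trans (abs-* (+ 6 * μ + + 1) g (g≢0 (+ 6 * μ + + 1) g e) (pos-* {+ 6 * μ + + 1} {g} (trans e (proj₂ hN)))) e) ,
         λ { (t , f) → no3 μ t f (abs-cases (+ 6 * μ + + 1)) } })
    (λ { {s , g} {s′ , g′} ((μ , refl) , e) ((μ′ , refl) , e′) eq → inj μ μ′ g g′ e e′ (abs-inj μ μ′ (proj₁ (,,₂-≡ eq))) })
    (λ { {y , g} (f , n3) → onto y g f n3 (mod6 y) })
    where
    g≢0 : ∀ s g → s * g ≡ + 8 * (+ 3 * k + + 2) + + 5 → g ≢ + 0
    g≢0 s _ e refl = contradiction (trans (sym (ℤₚ.*-zeroʳ s)) (trans e (proj₂ hN))) λ ()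
    no3 : ∀ μ t → abs (+ 6 * μ + + 1) ≡ + 3 * t → (pos (+ 6 * μ + + 1) ≡ true × abs (+ 6 * μ + + 1) ≡ + 6 * μ + + 1) ⊎
      (pos (+ 6 * μ + + 1) ≡ false × abs (+ 6 * μ + + 1) ≡ - (+ 6 * μ + + 1)) → ⊥
    no3 μ t f (inj₁ (_ , a)) = clash 3 1 (t - + 2 * μ) (- (+ 1)) (trans (sym a) f) (solve (t ∷ μ ∷ []))
    no3 μ t f (inj₂ (_ , a)) = clash 3 1 (- t - + 2 * μ) (+ 1) (trans (sym a) f) (solve (t ∷ μ ∷ []))
    inj : ∀ μ μ′ g g′ → (+ 6 * μ + + 1) * g ≡ + 8 * (+ 3 * k + + 2) + + 5 → (+ 6 * μ′ + + 1) * g′ ≡ + 8 * (+ 3 * k + + 2) + + 5 → + 6 * μ + + 1 ≡ + 6 * μ′ + + 1 →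
      (+ 6 * μ + + 1 , g) ≡ (+ 6 * μ′ + + 1 , g′)
    inj μ μ′ g g′ e e′ f = ,₂-≡ f (ℤₚ.*-cancelˡ-≡ (+ 6 * μ + + 1) g g′ {{ℤ.≢-nonZero (six+1≢0 μ)}}
      (trans e (trans (sym e′) (cong (_* g′) (sym f)))))
  triples : ∀ {c} → Cnt (λ p → Fact (+ 8 * (+ 3 * k + + 2) + + 5) p × Triple p) c → Cnt (Fact (+ 8 * k + + 7)) c
  triples = cnt-preimage {P = Fact (+ 8 * k + + 7)} {Q = λ p → Fact (+ 8 * (+ 3 * k + + 2) + + 5) p × Triple p} (λ { (t , g) → + 3 * t , g })
    (λ { {t , g} (pt , e) → (trans (pos-scale 2 t) pt , up t g e) , t , refl })
    (λ { {t , g} {t′ , g′} _ _ e → ,₂-≡ (ℤₚ.*-cancelˡ-≡ (+ 3) t t′ (proj₁ (,,₂-≡ e))) (proj₂ (,,₂-≡ e)) })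
    (λ { {s , g} ((ps , e) , (t , refl)) → (t , g) , (trans (sym (pos-scale 2 t)) ps , down t g e) , refl })
    where
    up : ∀ t g → t * g ≡ + 8 * k + + 7 → + 3 * t * g ≡ + 8 * (+ 3 * k + + 2) + + 5
    up t g e = linear (+ 3) e (solve (t ∷ g ∷ k ∷ []))
    down : ∀ t g → + 3 * t * g ≡ + 8 * (+ 3 * k + + 2) + + 5 → t * g ≡ + 8 * k + + 7
    down t g e = ℤₚ.*-cancelˡ-≡ (+ 3) (t * g) (+ 8 * k + + 7) (linear (+ 1) e (solve (t ∷ g ∷ k ∷ [])))
  go : (∃ λ c → Cnt (Fact (+ 8 * (+ 3 * k + + 2) + + 5)) c) → b ≡ false
  go (c , cF) with cnt-filter {Q = Triple} (λ { (s , g) → triple? s (third s) }) cF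
  ... | i , j , ci , cj , refl = trans (cnt-unique _≟²_ cF₀ (prime-to-3 cj))
    (trans (cong (_xor j) (sym (Fact-even (+ 8 * k + + 7) hN′ nonsq (triples ci))))
      (Fact-even (+ 8 * (+ 3 * k + + 2) + + 5) hN (square≢8n+5 (+ 3 * k + + 2)) cF))

-- Representations of 8n + 5 by x² + 4y²

Y : ℤ → ℤ × ℤ → Set
Y n (a , b) = (Σ ℤ λ κ → a ≡ + 6 * κ + + 1) × (Σ ℤ λ μ → b ≡ + 6 * μ + + 1) × a * a + + 4 * (b * b) ≡ + 8 * n + + 5

square-mod3 : ∀ x → Σ ℤ λ w → (x * x ≡ + 3 * w) ⊎ (x * x ≡ + 3 * w + + 1)
square-mod3 x = go (third x)
  where
  go : Third x → Σ ℤ λ w → (x * x ≡ + 3 * w) ⊎ (x * x ≡ + 3 * w + + 1)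
  go (inj₁ (t , refl))        = + 3 * (t * t) , inj₁ (solve (t ∷ []))
  go (inj₂ (inj₁ (t , refl))) = + 3 * (t * t) + + 2 * t , inj₂ (solve (t ∷ []))
  go (inj₂ (inj₂ (t , refl))) = + 3 * (t * t) + + 4 * t + + 1 , inj₂ (solve (t ∷ []))

even-y : ∀ n x t → x * x + + 4 * ((+ 2 * t) * (+ 2 * t)) ≢ + 8 * n + + 5
even-y n x t = go (half x)
  where
  go′ : ∀ u → (Σ ℤ λ w → (+ 2 * u + + 1) * (+ 2 * u + + 1) ≡ + 8 * w + + 1) →
    (+ 2 * u + + 1) * (+ 2 * u + + 1) + + 4 * ((+ 2 * t) * (+ 2 * t)) ≡ + 8 * n + + 5 → ⊥
  go′ u (w , f) e = clash 8 4 (w + + 2 * (t * t) - n) (+ 1) (trans (cong (λ z → z + + 4 * ((+ 2 * t) * (+ 2 * t))) (sym f)) e) (solve (w ∷ t ∷ n ∷ []))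
  go : Half x → x * x + + 4 * ((+ 2 * t) * (+ 2 * t)) ≢ + 8 * n + + 5
  go (inj₁ (u , refl)) e = clash 4 5 (u * u + + 4 * (t * t) - + 2 * n) (+ 1) e (solve (u ∷ t ∷ n ∷ []))
  go (inj₂ (u , refl)) e = go′ u (odd-square u) e

-- For n ≡ 0 (mod 3) the right side is 2 modulo 3, so neither x nor y is a multiple of 3; modulo 8
-- both are odd. Hence each has a unique sign making it 1 modulo 6.
cnt-Y : ∀ k {b} → Cnt (R (+ 3 * k)) b → Cnt (Y (+ 3 * k)) b
cnt-Y k = cnt-preimage {P = Y (+ 3 * k)} {Q = R (+ 3 * k)} (λ { (a , b) → abs a , abs b })
  (λ { {a , b} (aκ , bμ , e) → abs-pos (s≢0 aκ) , abs-pos (s≢0 bμ) , trans (cong₂ (λ u w → u + + 4 * w) (abs-square a) (abs-square b)) e })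
  (λ { {a , b} {a′ , b′} ((κ , refl) , (μ , refl) , _) ((κ′ , refl) , (μ′ , refl) , _) e →
       ,₂-≡ (abs-inj κ κ′ (proj₁ (,,₂-≡ e))) (abs-inj μ μ′ (proj₂ (,,₂-≡ e))) })
  (λ { {x , y} (px , py , e) → onto x y px py e (sign x px (no-even-x y x e) (no-three-x y x e) (mod6 x)) (sign y py (λ { t refl → even-y (+ 3 * k) x t e }) (no-three-y x y e) (mod6 y)) })
  where
  Sign : ℤ → Set
  Sign x = Σ ℤ λ a → (Σ ℤ λ κ → a ≡ + 6 * κ + + 1) × abs a ≡ x × a * a ≡ x * x
  no-even-x : ∀ y x → x * x + + 4 * (y * y) ≡ + 8 * (+ 3 * k) + + 5 → ∀ t → x ≢ + 2 * t
  no-even-x y _ e t refl = clash 4 5 (t * t + y * y - + 6 * k) (+ 1) e (solve (t ∷ y ∷ k ∷ []))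
  no-three-x : ∀ y x → x * x + + 4 * (y * y) ≡ + 8 * (+ 3 * k) + + 5 → ∀ t → x ≢ + 3 * t
  no-three-x y _ e t refl = go (square-mod3 y)
    where
    go : (Σ ℤ λ w → (y * y ≡ + 3 * w) ⊎ (y * y ≡ + 3 * w + + 1)) → ⊥
    go (w , inj₁ f) = clash 3 5 (+ 3 * (t * t) + + 4 * w - + 8 * k) (+ 1)
      (trans (cong (λ z → + 3 * t * (+ 3 * t) + + 4 * z) (sym f)) e) (solve (t ∷ w ∷ k ∷ []))
    go (w , inj₂ f) = clash 3 1 (+ 3 * (t * t) + + 4 * w - + 8 * k) (+ 1)
      (trans (cong (λ z → + 3 * t * (+ 3 * t) + + 4 * z) (sym f)) e) (solve (t ∷ w ∷ k ∷ []))
  no-three-y : ∀ x y → x * x + + 4 * (y * y) ≡ + 8 * (+ 3 * k) + + 5 → ∀ t → y ≢ + 3 * t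
  no-three-y x _ e t refl = go (square-mod3 x)
    where
    go : (Σ ℤ λ w → (x * x ≡ + 3 * w) ⊎ (x * x ≡ + 3 * w + + 1)) → ⊥
    go (w , inj₁ f) = clash 3 5 (+ 12 * (t * t) + w - + 8 * k) (+ 1)
      (trans (cong (λ z → z + + 4 * (+ 3 * t * (+ 3 * t))) (sym f)) e) (solve (t ∷ w ∷ k ∷ []))
    go (w , inj₂ f) = clash 3 4 (+ 12 * (t * t) + w - + 8 * k) (+ 1)
      (trans (cong (λ z → z + + 4 * (+ 3 * t * (+ 3 * t))) (sym f)) e) (solve (t ∷ w ∷ k ∷ []))
  neg² : ∀ x → - x * - x ≡ x * x
  neg² = ℤ-Solver.solve-∀
  sign : ∀ x → pos x ≡ true → (∀ t → x ≢ + 2 * t) → (∀ t → x ≢ + 3 * t) → Mod6 x → Sign x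
  sign x px n2 n3 (even t f)  = ⊥-elim (n2 t f)
  sign x px n2 n3 (three t f) = ⊥-elim (n3 t f)
  sign x px n2 n3 (≡1 t f)   = x , (t , f) , pos⇒abs px , refl
  sign x px n2 n3 (≡-1 t f)  = - x , (t , f) , trans (abs-neg x) (pos⇒abs px) , neg² x
  onto : ∀ x y → pos x ≡ true → pos y ≡ true → x * x + + 4 * (y * y) ≡ + 8 * (+ 3 * k) + + 5 → Sign x → Sign y →
    Σ (ℤ × ℤ) λ { (a , b) → Y (+ 3 * k) (a , b) × (abs a , abs b) ≡ (x , y) }
  onto x y px py e (a , aκ , f , g) (b , bμ , f′ , g′) = (a , b) , (aκ , bμ , trans (cong₂ (λ u w → u + + 4 * w) g g′) e) , ,₂-≡ f f′

-- With a and b prime to 3 the left side is 2 modulo 3, while 8n + 5 is 1 here and 0 in `Y-empty₂`.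
Y-empty₁ : ∀ k p → ¬ Y (+ 3 * k + + 1) p
Y-empty₁ k (a , b) ((κ , refl) , (μ , refl) , e) =
  clash 3 8 (+ 12 * (κ * κ) + + 4 * κ + + 48 * (μ * μ) + + 16 * μ - + 8 * k) (+ 1) e (solve (κ ∷ μ ∷ k ∷ []))

Y-empty₂ : ∀ k p → ¬ Y (+ 3 * k + + 2) p
Y-empty₂ k (a , b) ((κ , refl) , (μ , refl) , e) =
  clash 3 16 (+ 12 * (κ * κ) + + 4 * κ + + 48 * (μ * μ) + + 16 * μ - + 8 * k) (+ 1) e (solve (κ ∷ μ ∷ k ∷ []))

-- The forms with v = 0: r = A + B and s = A - B with A² + B² = 8n + 5 and 3 dividing B;
-- P₁ has A odd and B even, P₂ has A even and B odd.
module _ (k : ℤ) where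
  P₁ P₂ : ℤ × ℤ → Set
  P₁ (ω , ν) = pos ν ≡ true × (+ 6 * ω + + 1) * (+ 6 * ω + + 1) + + 36 * (ν * ν) ≡ + 8 * (+ 3 * k + + 1) + + 5
  P₂ (ω , ν) = pos (+ 6 * ν + + 3) ≡ true × (+ 6 * ν + + 3) * (+ 6 * ν + + 3) + + 4 * ((+ 3 * ω + + 2) * (+ 3 * ω + + 2)) ≡ + 8 * (+ 3 * k + + 1) + + 5

  Z₀ : ℤ³ → Set
  Z₀ p = Diff (+ 3 * k + + 1) vPart δ p × vPart p ≡ + 0

  -- As 8n + 5 ≡ 1 (mod 3), a solution of x² + 4y² = 8n + 5 has exactly one entry divisible by 3. If
  -- it is y, then B = 2y and the solution belongs to `P₁`; if it is x, then B = x and it belongs to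
  -- `P₂`.
  Three : ℤ × ℤ → Set
  Three (x , y) = Σ ℤ λ t → y ≡ + 3 * t

  three? : Decidable Three
  three? (x , y) = go (third y)
    where
    go : Third y → Dec (Three (x , y))
    go (inj₁ t) = yes t
    go (inj₂ (inj₁ (t , refl))) = no λ { (u , e) → clash 3 1 (u - t) (- (+ 1)) e (solve (t ∷ u ∷ [])) }
    go (inj₂ (inj₂ (t , refl))) = no λ { (u , e) → clash 3 2 (u - t) (- (+ 1)) e (solve (t ∷ u ∷ [])) }

  cnt-P₁ : ∀ {b} → Cnt (λ p → R (+ 3 * k + + 1) p × Three p) b → Cnt P₁ b
  cnt-P₁ = cnt-preimage {P = P₁} {Q = λ p → R (+ 3 * k + + 1) p × Three p} (λ { (ω , ν) → abs (+ 6 * ω + + 1) , + 3 * ν })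
    (λ { {ω , ν} (pν , e) → (abs-pos (six+1≢0 ω) , trans (pos-scale 2 ν) pν ,
         trans (cong (λ z → z + + 4 * (+ 3 * ν * (+ 3 * ν))) (abs-square (+ 6 * ω + + 1))) (eq₁ ω ν e)) , ν , refl })
    (λ { {ω , ν} {ω′ , ν′} _ _ e → inj ω ω′ ν ν′ (abs-inj ω ω′ (proj₁ (,,₂-≡ e))) (proj₂ (,,₂-≡ e)) })
    (λ { {x , y} ((px , py , e) , (t , refl)) → onto x t px (trans (sym (pos-scale 2 t)) py) e (mod6 x) })
    where
    eq₁ : ∀ ω ν → (+ 6 * ω + + 1) * (+ 6 * ω + + 1) + + 36 * (ν * ν) ≡ + 8 * (+ 3 * k + + 1) + + 5 →
      (+ 6 * ω + + 1) * (+ 6 * ω + + 1) + + 4 * (+ 3 * ν * (+ 3 * ν)) ≡ + 8 * (+ 3 * k + + 1) + + 5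
    eq₁ ω ν e = linear (+ 1) e (solve (ω ∷ ν ∷ k ∷ []))
    inj : ∀ ω ω′ ν ν′ → + 6 * ω + + 1 ≡ + 6 * ω′ + + 1 → + 3 * ν ≡ + 3 * ν′ → (ω , ν) ≡ (ω′ , ν′)
    inj ω ω′ ν ν′ e f = ,₂-≡ (ℤₚ.*-cancelˡ-≡ (+ 6) ω ω′ (linear (+ 1) e (solve (ω ∷ ω′ ∷ [])))) (ℤₚ.*-cancelˡ-≡ (+ 3) ν ν′ f)
    onto : ∀ x t → pos x ≡ true → pos t ≡ true → x * x + + 4 * (+ 3 * t * (+ 3 * t)) ≡ + 8 * (+ 3 * k + + 1) + + 5 → Mod6 x →
      Σ (ℤ × ℤ) λ { (ω , ν) → P₁ (ω , ν) × (abs (+ 6 * ω + + 1) , + 3 * ν) ≡ (x , + 3 * t) }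
    onto x t px pt e (even u refl) = ⊥-elim (clash 4 5 (u * u + + 9 * (t * t) - + 2 * (+ 3 * k + + 1)) (+ 1) e (solve (u ∷ t ∷ k ∷ [])))
    onto x t px pt e (three u refl) = ⊥-elim (clash 3 13 (+ 3 * (u * u) + + 12 * (t * t) - + 8 * k) (+ 1) e (solve (u ∷ t ∷ k ∷ [])))
    onto x t px pt e (≡1 ω refl) = (ω , t) , (pt , linear (+ 1) e (solve (ω ∷ t ∷ k ∷ []))) , ,₂-≡ (pos⇒abs px) refl
    onto x t px pt e (≡-1 ω f) = (ω , t) ,
      (pt , trans (cong (λ z → z * z + + 36 * (t * t)) (sym f)) (linear (+ 1) e (solve (x ∷ t ∷ k ∷ [])))) ,
      ,₂-≡ (trans (cong abs (sym f)) (trans (abs-neg x) (pos⇒abs px))) refl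

  cnt-P₂ : ∀ {b} → Cnt (λ p → R (+ 3 * k + + 1) p × ¬ Three p) b → Cnt P₂ b
  cnt-P₂ = cnt-preimage {P = P₂} {Q = λ p → R (+ 3 * k + + 1) p × ¬ Three p} (λ { (ω , ν) → + 6 * ν + + 3 , abs (+ 3 * ω + + 2) })
    (λ { {ω , ν} (pν , e) → (pν , abs-pos (3ω+2≢0 ω) ,
         trans (cong (λ z → (+ 6 * ν + + 3) * (+ 6 * ν + + 3) + + 4 * z) (abs-square (+ 3 * ω + + 2))) e) ,
         λ { (t , f) → no-three ω t f (abs-cases (+ 3 * ω + + 2)) } })
    (λ { {ω , ν} {ω′ , ν′} _ _ e → inj ω ω′ ν ν′ (abs-≡ (proj₂ (,,₂-≡ e))) (proj₁ (,,₂-≡ e)) })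
    (λ { {x , y} ((px , py , e) , n3) → onto x y px py e n3 (third y) })
    where
    3ω+2≢0 : ∀ ω → + 3 * ω + + 2 ≢ + 0
    3ω+2≢0 ω e = clash 3 2 (- ω) (- (+ 1)) e (solve (ω ∷ []))
    no-three : ∀ ω t → abs (+ 3 * ω + + 2) ≡ + 3 * t → (pos (+ 3 * ω + + 2) ≡ true × abs (+ 3 * ω + + 2) ≡ + 3 * ω + + 2) ⊎
      (pos (+ 3 * ω + + 2) ≡ false × abs (+ 3 * ω + + 2) ≡ - (+ 3 * ω + + 2)) → ⊥
    no-three ω t f (inj₁ (_ , a)) = clash 3 2 (t - ω) (- (+ 1)) (trans (sym a) f) (solve (t ∷ ω ∷ []))
    no-three ω t f (inj₂ (_ , a)) = clash 3 2 (- t - ω) (+ 1) (trans (sym a) f) (solve (t ∷ ω ∷ []))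
    inj : ∀ ω ω′ ν ν′ → + 3 * ω + + 2 ≡ + 3 * ω′ + + 2 ⊎ + 3 * ω + + 2 ≡ - (+ 3 * ω′ + + 2) → + 6 * ν + + 3 ≡ + 6 * ν′ + + 3 → (ω , ν) ≡ (ω′ , ν′)
    inj ω ω′ ν ν′ (inj₁ e) f = ,₂-≡ (ℤₚ.*-cancelˡ-≡ (+ 3) ω ω′ (linear (+ 1) e (solve (ω ∷ ω′ ∷ []))))
      (ℤₚ.*-cancelˡ-≡ (+ 6) ν ν′ (linear (+ 1) f (solve (ν ∷ ν′ ∷ []))))
    inj ω ω′ ν ν′ (inj₂ e) f = ⊥-elim (clash 3 4 (- ω - ω′) (- (+ 1)) e (solve (ω ∷ ω′ ∷ [])))
    x≡ : ∀ x y → (Σ ℤ λ w → y * y ≡ + 3 * w + + 1) → x * x + + 4 * (y * y) ≡ + 8 * (+ 3 * k + + 1) + + 5 → Mod6 x → Σ ℤ λ ν → x ≡ + 6 * ν + + 3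
    x≡ x y (w , f) e (even t refl) = ⊥-elim (clash 4 5 (t * t + y * y - + 2 * (+ 3 * k + + 1)) (+ 1) e (solve (t ∷ y ∷ k ∷ [])))
    x≡ x y (w , f) e (≡1 t refl) = ⊥-elim (clash 3 8 (+ 12 * (t * t) + + 4 * t + + 4 * w - + 8 * k) (+ 1)
      (trans (cong (λ z → (+ 6 * t + + 1) * (+ 6 * t + + 1) + + 4 * z) (sym f)) e) (solve (t ∷ w ∷ k ∷ [])))
    x≡ x y (w , f) e (≡-1 t g) = ⊥-elim (clash 3 8 (+ 12 * (t * t) + + 4 * t + + 4 * w - + 8 * k) (+ 1)
      (trans (cong₂ (λ u z → u * u + + 4 * z) (sym g) (sym f)) (trans (neg² x (y * y)) e)) (solve (t ∷ w ∷ k ∷ [])))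
      where
      neg² : ∀ x z → - x * - x + + 4 * z ≡ x * x + + 4 * z
      neg² = ℤ-Solver.solve-∀
    x≡ x y (w , f) e (three t refl) = go (half t)
      where
      go : Half t → Σ ℤ λ ν → + 3 * t ≡ + 6 * ν + + 3
      go (inj₁ (u , refl)) = ⊥-elim (clash 4 5 (+ 9 * (u * u) + y * y - + 2 * (+ 3 * k + + 1)) (+ 1) e (solve (u ∷ y ∷ k ∷ [])))
      go (inj₂ (u , refl)) = u , solve (u ∷ [])
    build : ∀ x y ω → pos x ≡ true → pos y ≡ true → x * x + + 4 * (y * y) ≡ + 8 * (+ 3 * k + + 1) + + 5 →
      y ≡ + 3 * ω + + 2 ⊎ y ≡ - (+ 3 * ω + + 2) → (Σ ℤ λ ν → x ≡ + 6 * ν + + 3) →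
      Σ (ℤ × ℤ) λ { (ω , ν) → P₂ (ω , ν) × (+ 6 * ν + + 3 , abs (+ 3 * ω + + 2)) ≡ (x , y) }
    build x y ω px py e (inj₁ refl) (ν , refl) = (ω , ν) , (px , e) , ,₂-≡ refl (pos⇒abs py)
    build x y ω px py e (inj₂ refl) (ν , refl) = (ω , ν) , (px , linear (+ 1) e (solve (ν ∷ ω ∷ k ∷ []))) ,
      ,₂-≡ refl (trans (sym (abs-neg (+ 3 * ω + + 2))) (pos⇒abs py))
    onto : ∀ x y → pos x ≡ true → pos y ≡ true → x * x + + 4 * (y * y) ≡ + 8 * (+ 3 * k + + 1) + + 5 → ¬ Three (x , y) → Third y →
      Σ (ℤ × ℤ) λ { (ω , ν) → P₂ (ω , ν) × (+ 6 * ν + + 3 , abs (+ 3 * ω + + 2)) ≡ (x , y) }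
    onto x y px py e n3 (inj₁ t) = ⊥-elim (n3 t)
    onto x y px py e n3 (inj₂ (inj₁ (t , f))) = build x y (- t - + 1) px py e (inj₂ (linear (+ 1) f (solve (y ∷ t ∷ []))))
      (x≡ x y (+ 3 * (t * t) + + 2 * t , trans (cong (λ z → z * z) f) (id₁ t)) e (mod6 x))
      where
      id₁ : ∀ t → (+ 3 * t + + 1) * (+ 3 * t + + 1) ≡ + 3 * (+ 3 * (t * t) + + 2 * t) + + 1
      id₁ = ℤ-Solver.solve-∀
    onto x y px py e n3 (inj₂ (inj₂ (t , f))) = build x y t px py e (inj₁ f)
      (x≡ x y (+ 3 * (t * t) + + 4 * t + + 1 , trans (cong (λ z → z * z) f) (id₁ t)) e (mod6 x))
      where
      id₁ : ∀ t → (+ 3 * t + + 2) * (+ 3 * t + + 2) ≡ + 3 * (+ 3 * (t * t) + + 4 * t + + 1) + + 1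
      id₁ = ℤ-Solver.solve-∀

  f₁ f₂ : ℤ × ℤ → ℤ³
  f₁ (ω , ν) = + 6 * ω + + 1 + + 6 * ν , + 6 * ω + + 1 - + 6 * ν , + 0
  f₂ (ω , ν) = + 6 * ω + + 4 + (+ 6 * ν + + 3) , + 6 * ω + + 4 - (+ 6 * ν + + 3) , + 0

  -- At v = 0 the condition `Diff` says r > s, which fixes the sign of B = (r - s)/2 = 3(κ - μ); the
  -- parity of κ - μ decides between `f₁` and `f₂`.
  cnt-Z₀ : ∀ {b} → Cnt (R (+ 3 * k + + 1)) b → Cnt Z₀ b
  cnt-Z₀ cR with cnt-filter {Q = Three} three? cR
  ... | i , j , ci , cj , refl = cnt-resp {P = λ p → Image f₁ P₁ p ⊎ Image f₂ P₂ p} {Q = Z₀}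
    (λ { (inj₁ ((ω , ν) , refl , pν , e)) → (((ω + ν , id₁ ω ν) , (ω - ν , id₂ ω ν) , eq₁ ω ν e) ,
           diff {+ 6 * ω + + 1 + + 6 * ν} {+ 6 * ω + + 1 - + 6 * ν} (trans (cong pos (id₃ ω ν)) (trans (pos-scale 11 ν) pν))) , refl
       ; (inj₂ ((ω , ν) , refl , pν , e)) → (((ω + ν + + 1 , id₄ ω ν) , (ω - ν , id₅ ω ν) , eq₂ ω ν e) ,
           diff {+ 6 * ω + + 4 + (+ 6 * ν + + 3)} {+ 6 * ω + + 4 - (+ 6 * ν + + 3)} (trans (cong pos (id₆ ω ν)) (trans (pos-scale 1 (+ 6 * ν + + 3)) pν))) , refl })
    (λ { {r , s , v} ((((κ , refl) , (μ , refl) , e) , ne) , refl) →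
         back κ μ e (undiff {+ 6 * κ + + 1} {+ 6 * μ + + 1} ne) (half (κ - μ)) })
    (cnt-⊎ {P = Image f₁ P₁} {Q = Image f₂ P₂}
      (λ { ((ω , ν) , refl , _) ((ω′ , ν′) , e , _) → disjoint ω ν ω′ ν′ (,,-≡ e) })
      (cnt-Image f₁ (λ { {ω , ν} {ω′ , ν′} e → inj₁′ ω ν ω′ ν′ (,,-≡ e) }) (cnt-P₁ ci))
      (cnt-Image f₂ (λ { {ω , ν} {ω′ , ν′} e → inj₂′ ω ν ω′ ν′ (,,-≡ e) }) (cnt-P₂ cj)))
    where
    id₁ : ∀ ω ν → + 6 * ω + + 1 + + 6 * ν ≡ + 6 * (ω + ν) + + 1
    id₁ = ℤ-Solver.solve-∀
    id₂ : ∀ ω ν → + 6 * ω + + 1 - + 6 * ν ≡ + 6 * (ω - ν) + + 1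
    id₂ = ℤ-Solver.solve-∀
    id₃ : ∀ ω ν → + 6 * ω + + 1 + + 6 * ν + + 0 - (+ 6 * ω + + 1 - + 6 * ν) ≡ + 12 * ν
    id₃ = ℤ-Solver.solve-∀
    id₄ : ∀ ω ν → + 6 * ω + + 4 + (+ 6 * ν + + 3) ≡ + 6 * (ω + ν + + 1) + + 1
    id₄ = ℤ-Solver.solve-∀
    id₅ : ∀ ω ν → + 6 * ω + + 4 - (+ 6 * ν + + 3) ≡ + 6 * (ω - ν) + + 1
    id₅ = ℤ-Solver.solve-∀
    id₆ : ∀ ω ν → + 6 * ω + + 4 + (+ 6 * ν + + 3) + + 0 - (+ 6 * ω + + 4 - (+ 6 * ν + + 3)) ≡ + 2 * (+ 6 * ν + + 3)
    id₆ = ℤ-Solver.solve-∀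
    diff : ∀ {r s} → pos (r + + 0 - s) ≡ true → ¬ false ≡ pos (r + + 0 - s)
    diff p q = contradiction (trans q p) λ ()
    undiff : ∀ {r s} → ¬ false ≡ pos (r + + 0 - s) → pos (r + + 0 - s) ≡ true
    undiff {r} {s} ne with pos (r + + 0 - s)
    ... | true  = refl
    ... | false = ⊥-elim (ne refl)
    eq₁ : ∀ ω ν → (+ 6 * ω + + 1) * (+ 6 * ω + + 1) + + 36 * (ν * ν) ≡ + 8 * (+ 3 * k + + 1) + + 5 →
      (+ 6 * ω + + 1 + + 6 * ν) * (+ 6 * ω + + 1 + + 6 * ν) + (+ 6 * ω + + 1 - + 6 * ν) * (+ 6 * ω + + 1 - + 6 * ν)
        + + 4 * ((+ 6 * ω + + 1 - + 6 * ν) * + 0) ≡ + 16 * (+ 3 * k + + 1) + + 10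
    eq₁ ω ν e = linear (+ 2) e (solve (ω ∷ ν ∷ k ∷ []))
    eq₂ : ∀ ω ν → (+ 6 * ν + + 3) * (+ 6 * ν + + 3) + + 4 * ((+ 3 * ω + + 2) * (+ 3 * ω + + 2)) ≡ + 8 * (+ 3 * k + + 1) + + 5 →
      (+ 6 * ω + + 4 + (+ 6 * ν + + 3)) * (+ 6 * ω + + 4 + (+ 6 * ν + + 3)) + (+ 6 * ω + + 4 - (+ 6 * ν + + 3)) * (+ 6 * ω + + 4 - (+ 6 * ν + + 3))
        + + 4 * ((+ 6 * ω + + 4 - (+ 6 * ν + + 3)) * + 0) ≡ + 16 * (+ 3 * k + + 1) + + 10
    eq₂ ω ν e = linear (+ 2) e (solve (ω ∷ ν ∷ k ∷ []))
    disjoint : ∀ ω ν ω′ ν′ → + 6 * ω′ + + 4 + (+ 6 * ν′ + + 3) ≡ + 6 * ω + + 1 + + 6 * ν ×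
      + 6 * ω′ + + 4 - (+ 6 * ν′ + + 3) ≡ + 6 * ω + + 1 - + 6 * ν × + 0 ≡ + 0 → ⊥
    disjoint ω ν ω′ ν′ (e , f , _) = clash 12 6 (ω - ω′) (- (+ 1)) (cong₂ _+_ e f) (solve (ω ∷ ν ∷ ω′ ∷ ν′ ∷ []))
    inj₁′ : ∀ ω ν ω′ ν′ → + 6 * ω + + 1 + + 6 * ν ≡ + 6 * ω′ + + 1 + + 6 * ν′ ×
      + 6 * ω + + 1 - + 6 * ν ≡ + 6 * ω′ + + 1 - + 6 * ν′ × + 0 ≡ + 0 → (ω , ν) ≡ (ω′ , ν′)
    inj₁′ ω ν ω′ ν′ (e , f , _) = ,₂-≡
      (ℤₚ.*-cancelˡ-≡ (+ 12) ω ω′ (linear₂ (+ 1) (+ 1) e f (solve (ω ∷ ν ∷ ω′ ∷ ν′ ∷ []))))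
      (ℤₚ.*-cancelˡ-≡ (+ 12) ν ν′ (linear₂ (+ 1) (- (+ 1)) e f (solve (ω ∷ ν ∷ ω′ ∷ ν′ ∷ []))))
    inj₂′ : ∀ ω ν ω′ ν′ → + 6 * ω + + 4 + (+ 6 * ν + + 3) ≡ + 6 * ω′ + + 4 + (+ 6 * ν′ + + 3) ×
      + 6 * ω + + 4 - (+ 6 * ν + + 3) ≡ + 6 * ω′ + + 4 - (+ 6 * ν′ + + 3) × + 0 ≡ + 0 → (ω , ν) ≡ (ω′ , ν′)
    inj₂′ ω ν ω′ ν′ (e , f , _) = ,₂-≡
      (ℤₚ.*-cancelˡ-≡ (+ 12) ω ω′ (linear₂ (+ 1) (+ 1) e f (solve (ω ∷ ν ∷ ω′ ∷ ν′ ∷ []))))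
      (ℤₚ.*-cancelˡ-≡ (+ 12) ν ν′ (linear₂ (+ 1) (- (+ 1)) e f (solve (ω ∷ ν ∷ ω′ ∷ ν′ ∷ []))))
    back : ∀ κ μ → (+ 6 * κ + + 1) * (+ 6 * κ + + 1) + (+ 6 * μ + + 1) * (+ 6 * μ + + 1) + + 4 * ((+ 6 * μ + + 1) * + 0) ≡ + 16 * (+ 3 * k + + 1) + + 10 →
      pos (+ 6 * κ + + 1 + + 0 - (+ 6 * μ + + 1)) ≡ true → Half (κ - μ) →
      Image f₁ P₁ (+ 6 * κ + + 1 , + 6 * μ + + 1 , + 0) ⊎ Image f₂ P₂ (+ 6 * κ + + 1 , + 6 * μ + + 1 , + 0)
    back κ μ e pd (inj₁ (ν , f)) = go κ (linear (+ 1) f (solve (κ ∷ μ ∷ ν ∷ []))) e pd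
      where
      a : ∀ μ ν → + 6 * (μ + ν) + + 1 + + 6 * ν ≡ + 6 * (μ + + 2 * ν) + + 1
      a = ℤ-Solver.solve-∀
      b : ∀ μ ν → + 6 * (μ + ν) + + 1 - + 6 * ν ≡ + 6 * μ + + 1
      b = ℤ-Solver.solve-∀
      c : ∀ μ ν → + 6 * (μ + + 2 * ν) + + 1 + + 0 - (+ 6 * μ + + 1) ≡ + 12 * ν
      c = ℤ-Solver.solve-∀
      go : ∀ κ → κ ≡ μ + + 2 * ν → (+ 6 * κ + + 1) * (+ 6 * κ + + 1) + (+ 6 * μ + + 1) * (+ 6 * μ + + 1) + + 4 * ((+ 6 * μ + + 1) * + 0) ≡ + 16 * (+ 3 * k + + 1) + + 10 →
        pos (+ 6 * κ + + 1 + + 0 - (+ 6 * μ + + 1)) ≡ true →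
        Image f₁ P₁ (+ 6 * κ + + 1 , + 6 * μ + + 1 , + 0) ⊎ Image f₂ P₂ (+ 6 * κ + + 1 , + 6 * μ + + 1 , + 0)
      go _ refl e pd = inj₁ ((μ + ν , ν) , ,-≡ (a μ ν) (b μ ν) refl ,
        trans (sym (pos-scale 11 ν)) (trans (cong pos (sym (c μ ν))) pd) , 2*-cancel (linear (+ 1) e (solve (μ ∷ ν ∷ k ∷ []))))
    back κ μ e pd (inj₂ (ν , f)) = go κ (linear (+ 1) f (solve (κ ∷ μ ∷ ν ∷ []))) e pd
      where
      a : ∀ μ ν → + 6 * (μ + ν) + + 4 + (+ 6 * ν + + 3) ≡ + 6 * (μ + + 2 * ν + + 1) + + 1
      a = ℤ-Solver.solve-∀
      b : ∀ μ ν → + 6 * (μ + ν) + + 4 - (+ 6 * ν + + 3) ≡ + 6 * μ + + 1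
      b = ℤ-Solver.solve-∀
      c : ∀ μ ν → + 6 * (μ + + 2 * ν + + 1) + + 1 + + 0 - (+ 6 * μ + + 1) ≡ + 2 * (+ 6 * ν + + 3)
      c = ℤ-Solver.solve-∀
      go : ∀ κ → κ ≡ μ + + 2 * ν + + 1 → (+ 6 * κ + + 1) * (+ 6 * κ + + 1) + (+ 6 * μ + + 1) * (+ 6 * μ + + 1) + + 4 * ((+ 6 * μ + + 1) * + 0) ≡ + 16 * (+ 3 * k + + 1) + + 10 →
        pos (+ 6 * κ + + 1 + + 0 - (+ 6 * μ + + 1)) ≡ true →
        Image f₁ P₁ (+ 6 * κ + + 1 , + 6 * μ + + 1 , + 0) ⊎ Image f₂ P₂ (+ 6 * κ + + 1 , + 6 * μ + + 1 , + 0)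
      go _ refl e pd = inj₂ ((μ + ν , ν) , ,-≡ (a μ ν) (b μ ν) refl ,
        trans (sym (pos-scale 1 (+ 6 * ν + + 3))) (trans (cong pos (sym (c μ ν))) pd) , 2*-cancel (linear (+ 1) e (solve (μ ∷ ν ∷ k ∷ []))))

-- Both counts agree modulo 2

xor-false : ∀ x {y} → x xor y ≡ false → x ≡ y
xor-false true  {true}  e = refl
xor-false false {false} e = refl

pos-suc : ∀ {x} → pos x ≡ true → Σ ℕ λ N → x ≡ +[1+ N ]
pos-suc {+[1+ n ]} _ = n , refl

-- Modulo 2, `γ` carries the count from one side of the triangle to the other, `α` reduces it to
-- factorisations, and Zagier's involution turns these into representations.
parity₀ : ∀ k {x y v b} → Cnt (X (+ 3 * k)) x → Cnt (Y (+ 3 * k)) y → Cnt (Same (+ 3 * k) sPart δ) v →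
  Cnt (R (+ 3 * k)) b → Cnt (MF (+ 3 * k)) b → x ≡ y
parity₀ k cX cY cV cR cMF = trans (xor-false _ (γ-even k (cnt-triangle n sPart vPart δ cX cV)))
  (trans (cnt-unique _≟³_ (cnt-α-δ n cV) (cnt-F⇒fixed n (cnt-F n no3 cMF))) (cnt-unique _≟²_ (cnt-Y k cR) cY))
  where
  n = + 3 * k
  no3 : ∀ t z → + 3 * t * (+ 3 * t) + + 4 * (+ 3 * t * z) ≢ + 8 * (+ 3 * k) + + 5
  no3 t z e = clash 3 5 (+ 3 * (t * t) + + 4 * (t * z) - + 8 * k) (+ 1) e (solve (t ∷ z ∷ k ∷ []))

-- The crossings of the two mirrors are congruent to the factorisations and to the forms with v = 0.
-- Both agree modulo 2 with the solutions `R`, so they cancel.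
parity₁ : ∀ k {x y v b} → Cnt (X (+ 3 * k + + 1)) x → Cnt (Y (+ 3 * k + + 1)) y → Cnt (Same (+ 3 * k + + 1) sPart δ) v →
  Cnt (R (+ 3 * k + + 1)) b → Cnt (MF (+ 3 * k + + 1)) b → x ≡ y
parity₁ k {x} {v = v} {b} cX cY cV cR cMF = trans
  (split (cnt-filter {Q = λ p → vPart p ≡ + 0} (λ p → vPart p ℤ.≟ + 0) (cnt-triangle n sPart vPart δ cX cV)))
  (cnt-unique _≟²_ (cnt-empty (Y-empty₁ k)) cY)
  where
  n = + 3 * k + + 1
  no3 : ∀ t z → + 3 * t * (+ 3 * t) + + 4 * (+ 3 * t * z) ≢ + 8 * (+ 3 * k + + 1) + + 5
  no3 t z e = clash 3 13 (+ 3 * (t * t) + + 4 * (t * z) - + 8 * k) (+ 1) e (solve (t ∷ z ∷ k ∷ []))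
  v≡b : v ≡ b
  v≡b = cnt-unique _≟³_ (cnt-α-δ n cV) (cnt-F⇒fixed n (cnt-F n no3 cMF))
  cancel : ∀ x b → x xor b ≡ b xor false → x ≡ false
  cancel true  true  ()
  cancel true  false ()
  cancel false _     _ = refl
  split : (Σ Bool λ i → Σ Bool λ j → Cnt (Z₀ k) i × Cnt (λ p → Diff n vPart δ p × ¬ vPart p ≡ + 0) j × x xor v ≡ i xor j) → x ≡ false
  split (i , j , ci , cj , e) = cancel x b (trans (cong (x xor_) (sym v≡b)) (trans e
    (cong₂ _xor_ (cnt-unique _≟³_ ci (cnt-Z₀ k cR)) (γ̄-even k cj))))

-- The crossings of either mirror are even in number, and there are no representations.
parity₂ : ∀ k N {x y v} → +[1+ N ] ≡ + 8 * (+ 3 * k + + 2) + + 5 → Cnt (X (+ 3 * k + + 2)) x → Cnt (Y (+ 3 * k + + 2)) y →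
  Cnt (Same (+ 3 * k + + 2) sPart ε) v → x ≡ y
parity₂ k N N≡ cX cY cV = trans (xor-false _ (γ₀-even k (cnt-triangle n sPart vPart ε cX cV)))
  (trans (F₀-even k hN hN′ (cnt-fixed⇒F₀ n hN (cnt-α-ε n cV))) (cnt-unique _≟²_ (cnt-empty (Y-empty₂ k)) cY))
  where
  n = + 3 * k + + 2
  hN : Σ ℕ λ N → + 8 * n + + 5 ≡ +[1+ N ]
  hN = N , sym N≡
  id₁ : ∀ k → + 3 * (+ 8 * k + + 7) ≡ + 8 * (+ 3 * k + + 2) + + 5
  id₁ = ℤ-Solver.solve-∀
  hN′ : Σ ℕ λ N → + 8 * k + + 7 ≡ +[1+ N ]
  hN′ = pos-suc {+ 8 * k + + 7} (trans (sym (pos-scale 2 (+ 8 * k + + 7))) (cong pos (trans (id₁ k) (sym N≡))))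

parity : ∀ {n : ℤ} {N N′ : ℕ} → + N ≡ + 16 * n + + 10 → +[1+ N′ ] ≡ + 8 * n + + 5 → Third n →
  ∀ {x y} → Cnt (X n) x → Cnt (Y n) y → x ≡ y
parity {n} {N} {N′} N≡ N′≡ (inj₁ (k , refl)) cX cY = go (Zagier.zagier n (suc N′) N′≡)
  where
  go : (∃ λ b → Cnt (R n) b × Cnt (MF n) b) → _
  go (_ , cR , cMF) = parity₀ k cX cY (proj₂ (Finite.cnt-V n N N≡)) cR cMF
parity {n} {N} {N′} N≡ N′≡ (inj₂ (inj₁ (k , refl))) cX cY = go (Zagier.zagier n (suc N′) N′≡)
  where
  go : (∃ λ b → Cnt (R n) b × Cnt (MF n) b) → _
  go (_ , cR , cMF) = parity₁ k cX cY (proj₂ (Finite.cnt-V n N N≡)) cR cMF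
parity {n} {N} {N′} N≡ N′≡ (inj₂ (inj₂ (k , refl))) cX cY = parity₂ k N′ N′≡ cX cY (proj₂ (Finite.cnt-V₀ n N N≡))

-- Weights

T-double : ∀ r → + 2 * + Tri r ≡ + r * + r + + r
T-double zero    = refl
T-double (suc r) = trans (cong (+ 2 *_) (ℤₚ.pos-+ (suc r) (Tri r))) (go (+ r) (+ Tri r) (T-double r))
  where
  go : ∀ r t → + 2 * t ≡ r * r + r → + 2 * (+ 1 + r + t) ≡ (+ 1 + r) * (+ 1 + r) + (+ 1 + r)
  go r t e = linear (+ 1) e (solve (r ∷ t ∷ []))

-[1+]≡ : ∀ k → -[1+ k ] ≡ - (+ 1) - + k
-[1+]≡ zero    = refl
-[1+]≡ (suc k) = refl

w₁-square : ∀ κ → + 4 * + w₁ κ ≡ (+ 6 * κ + + 1) * (+ 6 * κ + + 1) - + 1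
w₁-square (+ k) = trans (cong (+ 4 *_) (trans (ℤₚ.pos-* 6 (Tri k ℕ.+ k ℕ.* k)) (cong (λ z → + 6 * (+ Tri k + z)) (ℤₚ.pos-* k k))))
  (go (+ k) (+ Tri k) (T-double k))
  where
  go : ∀ k t → + 2 * t ≡ k * k + k → + 4 * (+ 6 * (t + k * k)) ≡ (+ 6 * k + + 1) * (+ 6 * k + + 1) - + 1
  go k t e = linear (+ 12) e (solve (k ∷ t ∷ []))
w₁-square -[1+ k ] = trans (cong (+ 4 *_) (trans (ℤₚ.pos-* 6 (Tri k ℕ.+ suc k ℕ.* suc k)) (cong (λ z → + 6 * (+ Tri k + z)) (ℤₚ.pos-* (suc k) (suc k)))))
  (trans (go (+ k) (+ Tri k) (T-double k)) (cong (λ z → (+ 6 * z + + 1) * (+ 6 * z + + 1) - + 1) (sym (-[1+]≡ k))))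
  where
  go : ∀ k t → + 2 * t ≡ k * k + k → + 4 * (+ 6 * (t + (+ 1 + k) * (+ 1 + k))) ≡
    (+ 6 * (- (+ 1) - k) + + 1) * (+ 6 * (- (+ 1) - k) + + 1) - + 1
  go k t e = linear (+ 12) e (solve (k ∷ t ∷ []))

-- The starting points differ: j = 0 means v = 1 in the first series, where s > 0, but v = 0 in the
-- second, where s < 0.
sv : ℕ → ℕ ⊎ ℕ → ℤ × ℤ
sv ρ (inj₁ j) = + 6 * + ρ + + 1 , +[1+ j ]
sv ρ (inj₂ j) = + 6 * -[1+ ρ ] + + 1 , - + j

lowest-ℤ : ∀ ρ → + lowest ρ ≡ + 1 + + 6 * (+ Tri ρ + + ρ * (+ 1 + + ρ))
lowest-ℤ ρ = cong (λ z → + 1 + z) (trans (ℤₚ.pos-* 6 (Tri ρ ℕ.+ ρ ℕ.* suc ρ)) (cong (λ z → + 6 * (+ Tri ρ + z)) (ℤₚ.pos-* ρ (suc ρ))))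

wL-form : ∀ ρ a → let s = proj₁ (sv ρ a) ; v = proj₂ (sv ρ a) in + 4 * + wL ρ a + + 1 ≡ s * s + + 4 * (s * v)
wL-form ρ (inj₁ j) = trans (cong (λ z → + 4 * z + + 1) (cong₂ _+_ (lowest-ℤ ρ) (trans (ℤₚ.pos-* j (suc (6 ℕ.* ρ))) (cong (λ z → + j * (+ 1 + z)) (ℤₚ.pos-* 6 ρ)))))
  (go (+ ρ) (+ Tri ρ) (+ j) (T-double ρ))
  where
  go : ∀ ρ t j → + 2 * t ≡ ρ * ρ + ρ → + 4 * (+ 1 + + 6 * (t + ρ * (+ 1 + ρ)) + j * (+ 1 + + 6 * ρ)) + + 1 ≡
    (+ 6 * ρ + + 1) * (+ 6 * ρ + + 1) + + 4 * ((+ 6 * ρ + + 1) * (+ 1 + j))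
  go ρ t j e = linear (+ 12) e (solve (ρ ∷ t ∷ j ∷ []))
wL-form ρ (inj₂ j) = trans (cong (λ z → + 4 * z + + 1) (cong₂ _+_ (lowest-ℤ ρ)
    (cong₂ _+_ d≡ (trans (ℤₚ.pos-* j (suc (6 ℕ.* ρ ℕ.+ 4))) (cong (+ j *_) d≡)))))
  (trans (go (+ ρ) (+ Tri ρ) (+ j) (T-double ρ)) (cong (λ z → (+ 6 * z + + 1) * (+ 6 * z + + 1) + + 4 * ((+ 6 * z + + 1) * - + j)) (sym (-[1+]≡ ρ))))
  where
  d≡ : + suc (6 ℕ.* ρ ℕ.+ 4) ≡ + 1 + (+ 6 * + ρ + + 4)
  d≡ = cong (λ z → + 1 + (z + + 4)) (ℤₚ.pos-* 6 ρ)
  go : ∀ ρ t j → + 2 * t ≡ ρ * ρ + ρ →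
    + 4 * (+ 1 + + 6 * (t + ρ * (+ 1 + ρ)) + (+ 1 + (+ 6 * ρ + + 4) + j * (+ 1 + (+ 6 * ρ + + 4)))) + + 1 ≡
    (+ 6 * (- (+ 1) - ρ) + + 1) * (+ 6 * (- (+ 1) - ρ) + + 1) + + 4 * ((+ 6 * (- (+ 1) - ρ) + + 1) * - j)
  go ρ t j e = linear (+ 12) e (solve (ρ ∷ t ∷ j ∷ []))

pos-6ρ+1 : ∀ ρ → pos (+ 6 * + ρ + + 1) ≡ true
pos-6ρ+1 zero    = refl
pos-6ρ+1 (suc ρ) = refl

pos-6ρ-5 : ∀ ρ → pos (+ 6 * -[1+ ρ ] + + 1) ≡ false
pos-6ρ-5 ρ = trans (cong pos (trans (cong (λ z → + 6 * z + + 1) (-[1+]≡ ρ)) (id₁ (+ ρ)))) (pos-neg-true {+ 6 * + ρ + + 5} (five ρ))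
  where
  id₁ : ∀ ρ → + 6 * (- (+ 1) - ρ) + + 1 ≡ - (+ 6 * ρ + + 5)
  id₁ = ℤ-Solver.solve-∀
  five : ∀ ρ → pos (+ 6 * + ρ + + 5) ≡ true
  five zero    = refl
  five (suc ρ) = refl

sv-pos : ∀ ρ a → pos (proj₁ (sv ρ a)) ≡ pos (proj₂ (sv ρ a))
sv-pos ρ (inj₁ j)       = pos-6ρ+1 ρ
sv-pos ρ (inj₂ zero)    = pos-6ρ-5 ρ
sv-pos ρ (inj₂ (suc j)) = pos-6ρ-5 ρ

sv-six : ∀ ρ a → Σ ℤ λ μ → proj₁ (sv ρ a) ≡ + 6 * μ + + 1
sv-six ρ (inj₁ j) = + ρ , refl
sv-six ρ (inj₂ j) = -[1+ ρ ] , refl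

six+1-injective : ∀ κ μ → + 6 * κ + + 1 ≡ + 6 * μ + + 1 → κ ≡ μ
six+1-injective κ μ e = ℤₚ.*-cancelˡ-≡ (+ 6) κ μ (linear (+ 1) e (solve (κ ∷ μ ∷ [])))

sv-injective : ∀ ρ a ρ′ a′ → sv ρ a ≡ sv ρ′ a′ → (ρ , a) ≡ (ρ′ , a′)
sv-injective ρ (inj₁ j) ρ′ (inj₁ j′) e = go (six+1-injective (+ ρ) (+ ρ′) (proj₁ (,,₂-≡ e))) (proj₂ (,,₂-≡ e))
  where
  go : + ρ ≡ + ρ′ → +[1+ j ] ≡ +[1+ j′ ] → (ρ , inj₁ j) ≡ (ρ′ , inj₁ j′)
  go refl refl = refl
sv-injective ρ (inj₁ j) ρ′ (inj₂ j′) e = contradiction (six+1-injective (+ ρ) -[1+ ρ′ ] (proj₁ (,,₂-≡ e))) λ ()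
sv-injective ρ (inj₂ j) ρ′ (inj₁ j′) e = contradiction (six+1-injective -[1+ ρ ] (+ ρ′) (proj₁ (,,₂-≡ e))) λ ()
sv-injective ρ (inj₂ j) ρ′ (inj₂ j′) e = go (six+1-injective -[1+ ρ ] -[1+ ρ′ ] (proj₁ (,,₂-≡ e))) (ℤₚ.neg-injective {+ j} {+ j′} (proj₂ (,,₂-≡ e)))
  where
  go : -[1+ ρ ] ≡ -[1+ ρ′ ] → + j ≡ + j′ → (ρ , inj₂ j) ≡ (ρ′ , inj₂ j′)
  go refl refl = refl

sv-onto : ∀ μ v → pos (+ 6 * μ + + 1) ≡ pos v → Σ (ℕ × (ℕ ⊎ ℕ)) λ { (ρ , a) → sv ρ a ≡ (+ 6 * μ + + 1 , v) }
sv-onto (+ ρ)    +0       ss = contradiction (trans (sym (pos-6ρ+1 ρ)) ss) λ ()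
sv-onto (+ ρ)    +[1+ j ] ss = (ρ , inj₁ j) , refl
sv-onto (+ ρ)    -[1+ j ] ss = contradiction (trans (sym (pos-6ρ+1 ρ)) ss) λ ()
sv-onto -[1+ ρ ] +0       ss = (ρ , inj₂ 0) , refl
sv-onto -[1+ ρ ] +[1+ j ] ss = contradiction (trans (sym (pos-6ρ-5 ρ)) ss) λ ()
sv-onto -[1+ ρ ] -[1+ j ] ss = (ρ , inj₂ (suc j)) , refl

-- Four times the weights are r² - 1 and s² + 4sv - 1, so total weight 4n + 2 amounts to r² + s² +
-- 4sv = 16n + 10.
cnt-X : ∀ n {b} → Cnt (λ z → w₁ (proj₁ z) ℕ.+ wL (proj₁ (proj₂ z)) (proj₂ (proj₂ z)) ≡ 4 ℕ.* n ℕ.+ 2) b → Cnt (X (+ n)) b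
cnt-X n = cnt-image {Q = X (+ n)} (λ { (κ , ρ , a) → + 6 * κ + + 1 , sv ρ a })
  (λ { {κ , ρ , a} e → ((κ , refl) , sv-six ρ a ,
       assoc (+ 6 * κ + + 1) (proj₁ (sv ρ a)) (proj₂ (sv ρ a)) (up (+ w₁ κ) (+ wL ρ a) (+ n) {R = ((+ 6 * κ + + 1) * (+ 6 * κ + + 1))} (w₁-square κ) (wL-form ρ a) (trans (cong +_ e) (cast n)))) , sv-pos ρ a })
  (λ { {κ , ρ , a} {κ′ , ρ′ , a′} _ _ e → inj κ κ′ (six+1-injective κ κ′ (cong proj₁ e)) (sv-injective ρ a ρ′ a′ (cong proj₂ e)) })
  (λ { {r , s , v} (((κ , refl) , (μ , refl) , e) , ss) → onto κ μ v (trans (sym (ℤₚ.+-assoc ((+ 6 * κ + + 1) * (+ 6 * κ + + 1)) ((+ 6 * μ + + 1) * (+ 6 * μ + + 1)) (+ 4 * ((+ 6 * μ + + 1) * v)))) e) (sv-onto μ v ss) })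
  where
  cast : ∀ n → + (4 ℕ.* n ℕ.+ 2) ≡ + 4 * + n + + 2
  cast n = cong (_+ + 2) (ℤₚ.pos-* 4 n)
  up : ∀ w l n {R S} → + 4 * w ≡ R - + 1 → + 4 * l + + 1 ≡ S → w + l ≡ + 4 * n + + 2 → R + S ≡ + 16 * n + + 10
  up w l n {R} e refl f = linear₂ (- (+ 1)) (+ 4) e f (solve (w ∷ l ∷ n ∷ R ∷ []))
  down : ∀ w l n {R S} → + 4 * w ≡ R - + 1 → + 4 * l + + 1 ≡ S → R + S ≡ + 16 * n + + 10 → w + l ≡ + 4 * n + + 2
  down w l n {R} e refl f = ℤₚ.*-cancelˡ-≡ (+ 4) (w + l) (+ 4 * n + + 2) (linear₂ (+ 1) (+ 1) e f (solve (w ∷ l ∷ n ∷ R ∷ [])))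
  assoc : ∀ r s v {k} → r * r + (s * s + + 4 * (s * v)) ≡ k → r * r + s * s + + 4 * (s * v) ≡ k
  assoc r s v = trans (ℤₚ.+-assoc (r * r) (s * s) (+ 4 * (s * v)))
  inj : ∀ κ κ′ {y y′ : ℕ × (ℕ ⊎ ℕ)} → κ ≡ κ′ → y ≡ y′ → (κ , y) ≡ (κ′ , y′)
  inj κ κ′ refl refl = refl
  onto : ∀ κ μ v → (+ 6 * κ + + 1) * (+ 6 * κ + + 1) + ((+ 6 * μ + + 1) * (+ 6 * μ + + 1) + + 4 * ((+ 6 * μ + + 1) * v)) ≡ + 16 * + n + + 10 →
    (Σ (ℕ × (ℕ ⊎ ℕ)) λ { (ρ , a) → sv ρ a ≡ (+ 6 * μ + + 1 , v) }) →
    Σ (ℤ × ℕ × (ℕ ⊎ ℕ)) λ z → w₁ (proj₁ z) ℕ.+ wL (proj₁ (proj₂ z)) (proj₂ (proj₂ z)) ≡ 4 ℕ.* n ℕ.+ 2 ×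
      (+ 6 * proj₁ z + + 1 , sv (proj₁ (proj₂ z)) (proj₂ (proj₂ z))) ≡ (+ 6 * κ + + 1 , + 6 * μ + + 1 , v)
  onto κ μ v e ((ρ , a) , f) = (κ , ρ , a) ,
    ℤₚ.+-injective (trans (down (+ w₁ κ) (+ wL ρ a) (+ n) {R = ((+ 6 * κ + + 1) * (+ 6 * κ + + 1))} (w₁-square κ) (wL-form ρ a)
      (trans (cong (λ z → (+ 6 * κ + + 1) * (+ 6 * κ + + 1) + (proj₁ z * proj₁ z + + 4 * (proj₁ z * proj₂ z))) f) e)) (sym (cast n))) ,
    cong (+ 6 * κ + + 1 ,_) f

-- 2(6λ + 1)², as a natural number
wB : ℤ → ℕ
wB (+ k)    = 2 ℕ.* ((6 ℕ.* k ℕ.+ 1) ℕ.* (6 ℕ.* k ℕ.+ 1))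
wB -[1+ k ] = 2 ℕ.* ((6 ℕ.* k ℕ.+ 5) ℕ.* (6 ℕ.* k ℕ.+ 5))

wB-square : ∀ λ′ → + wB λ′ ≡ + 2 * ((+ 6 * λ′ + + 1) * (+ 6 * λ′ + + 1))
wB-square (+ k) = trans (ℤₚ.pos-* 2 ((6 ℕ.* k ℕ.+ 1) ℕ.* (6 ℕ.* k ℕ.+ 1))) (cong (+ 2 *_) (trans (ℤₚ.pos-* (6 ℕ.* k ℕ.+ 1) (6 ℕ.* k ℕ.+ 1)) (cong₂ _*_ e e)))
  where
  e : + (6 ℕ.* k ℕ.+ 1) ≡ + 6 * + k + + 1
  e = cong (_+ + 1) (ℤₚ.pos-* 6 k)
wB-square -[1+ k ] = trans (ℤₚ.pos-* 2 ((6 ℕ.* k ℕ.+ 5) ℕ.* (6 ℕ.* k ℕ.+ 5))) (trans (cong (+ 2 *_) (trans (ℤₚ.pos-* (6 ℕ.* k ℕ.+ 5) (6 ℕ.* k ℕ.+ 5)) (cong₂ _*_ e e)))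
  (trans (id₁ (+ k)) (cong (λ z → + 2 * ((+ 6 * z + + 1) * (+ 6 * z + + 1))) (sym (-[1+]≡ k)))))
  where
  e : + (6 ℕ.* k ℕ.+ 5) ≡ + 6 * + k + + 5
  e = cong (_+ + 5) (ℤₚ.pos-* 6 k)
  id₁ : ∀ k → + 2 * ((+ 6 * k + + 5) * (+ 6 * k + + 5)) ≡ + 2 * ((+ 6 * (- (+ 1) - k) + + 1) * (+ 6 * (- (+ 1) - k) + + 1))
  id₁ = ℤ-Solver.solve-∀

k≤wB+ : ∀ k → k ≤ wB (+ k)
k≤wB+ k = ℕₚ.≤-trans (k≤6k k) (ℕₚ.≤-trans (ℕₚ.m≤m+n _ 1) (ℕₚ.≤-trans (k≤k*k _) (ℕₚ.m≤n*m _ 2)))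

k≤wB- : ∀ k → k ≤ wB -[1+ k ]
k≤wB- k = ℕₚ.≤-trans (k≤6k k) (ℕₚ.≤-trans (ℕₚ.m≤m+n _ 5) (ℕₚ.≤-trans (k≤k*k _) (ℕₚ.m≤n*m _ 2)))

w₂ : ℤ → ℕ
w₂ κ = w₁ κ ℕ.+ w₁ κ

-- The weights are 2b² and (a² - 1)/2, so total weight 4n + 2 amounts to a² + 4b² = 8n + 5.
cnt-Y′ : ∀ n {b} → Cnt (λ z → wB (proj₁ z) ℕ.+ w₂ (proj₂ z) ≡ 4 ℕ.* n ℕ.+ 2) b → Cnt (Y (+ n)) b
cnt-Y′ n = cnt-image {Q = Y (+ n)} (λ { (μ , κ) → + 6 * κ + + 1 , + 6 * μ + + 1 })
  (λ { {μ , κ} e → (κ , refl) , (μ , refl) , up (+ w₁ κ) (+ n) {A = ((+ 6 * κ + + 1) * (+ 6 * κ + + 1))} {((+ 6 * μ + + 1) * (+ 6 * μ + + 1))} (w₁-square κ) (wB-square μ) (trans (cong +_ e) (cast n)) })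
  (λ { {μ , κ} {μ′ , κ′} _ _ e → ,₂-≡ (six+1-injective μ μ′ (proj₂ (,,₂-≡ e))) (six+1-injective κ κ′ (proj₁ (,,₂-≡ e))) })
  (λ { {a , b} ((κ , refl) , (μ , refl) , e) → (μ , κ) ,
       ℤₚ.+-injective (trans (down (+ w₁ κ) (+ n) {A = ((+ 6 * κ + + 1) * (+ 6 * κ + + 1))} {((+ 6 * μ + + 1) * (+ 6 * μ + + 1))} (w₁-square κ) (wB-square μ) e) (sym (cast n))) , refl })
  where
  cast : ∀ n → + (4 ℕ.* n ℕ.+ 2) ≡ + 4 * + n + + 2
  cast n = cong (_+ + 2) (ℤₚ.pos-* 4 n)
  up : ∀ w n {A B W} → + 4 * w ≡ A - + 1 → W ≡ + 2 * B → W + (w + w) ≡ + 4 * n + + 2 → A + + 4 * B ≡ + 8 * n + + 5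
  up w n {A} {B} e refl f = linear₂ (- (+ 1)) (+ 2) e f (solve (w ∷ n ∷ A ∷ B ∷ []))
  down : ∀ w n {A B W} → + 4 * w ≡ A - + 1 → W ≡ + 2 * B → A + + 4 * B ≡ + 8 * n + + 5 → W + (w + w) ≡ + 4 * n + + 2
  down w n {A} {B} e refl f = 2*-cancel (linear₂ (+ 1) (+ 1) e f (solve (w ∷ n ∷ A ∷ B ∷ [])))

-- Cancelling the theta factor

·-zero : ∀ (f g : Ser) m → (∀ i j → i ℕ.+ j ≡ m → f i ∧ g j ≡ false) → (f · g) m ≡ false
·-zero f g zero    e = e 0 0 refl
·-zero f g (suc m) e = cong₂ _xor_ (e 0 (suc m) refl) (·-zero (f ∘ suc) g m (λ i j p → e (suc i) j (cong suc p)))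

remove-multiple : ∀ i j k → i ℕ.+ j ≡ 4 ℕ.* k ℕ.+ 2 → (Σ ℕ λ l → i ≡ 4 ℕ.* suc l) → Σ ℕ λ m → m < k × j ≡ 4 ℕ.* m ℕ.+ 2
remove-multiple i j zero    e (l , refl) = contradiction (ℕₚ.≤-trans (ℕₚ.m≤m+n (4 ℕ.* suc l) j) (ℕₚ.≤-reflexive e)) (λ p → ℕₚ.<⇒≱ (s≤s (s≤s (s≤s z≤n))) (ℕₚ.≤-trans (ℕₚ.m≤m*n 4 (suc l)) p))
remove-multiple i j (suc k) e (zero  , refl) = k , ℕₚ.n<1+n k , ℕₚ.+-cancelˡ-≡ 4 _ _ (trans e (id₁ k))
  where
  id₁ : ∀ k → 4 ℕ.* suc k ℕ.+ 2 ≡ 4 ℕ.+ (4 ℕ.* k ℕ.+ 2)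
  id₁ = ℕ-Solver.solve-∀
remove-multiple i j (suc k) e (suc l , refl) = let (m , m<k , f) = remove-multiple (4 ℕ.* suc l) j k (ℕₚ.+-cancelˡ-≡ 4 _ _ (trans (id₁ l j) (trans e (id₂ k)))) (l , refl)
  in m , ℕₚ.m<n⇒m<1+n m<k , f
  where
  id₁ : ∀ l j → 4 ℕ.+ (4 ℕ.* suc l ℕ.+ j) ≡ 4 ℕ.* suc (suc l) ℕ.+ j
  id₁ = ℕ-Solver.solve-∀
  id₂ : ∀ k → 4 ℕ.* suc k ℕ.+ 2 ≡ 4 ℕ.+ (4 ℕ.* k ℕ.+ 2)
  id₂ = ℕ-Solver.solve-∀

-- A factor supported on multiples of 4 does not mix residue classes modulo 4, and its constant term
-- 1 isolates the top coefficient of `H` for a strong induction inside the class of 2.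
cancel-θ : ∀ (θ H : Ser) M → θ 0 ≡ true → (∀ m → m < M → θ m ≡ true → Σ ℕ λ l → m ≡ 4 ℕ.* l) →
  (∀ k → 4 ℕ.* k ℕ.+ 2 < M → (θ · H) (4 ℕ.* k ℕ.+ 2) ≡ false) → ∀ k → 4 ℕ.* k ℕ.+ 2 < M → H (4 ℕ.* k ℕ.+ 2) ≡ false
cancel-θ θ H M θ0 supp prod = <-rec _ step
  where
  split : ∀ m → (∀ i j → suc i ℕ.+ j ≡ m → θ (suc i) ∧ H j ≡ false) → (θ · H) m ≡ H m
  split zero    _ = cong (_∧ H 0) θ0
  split (suc m) z = trans (cong₂ _xor_ (cong (_∧ H (suc m)) θ0) (·-zero (θ ∘ suc) H m (λ i j e → z i j (cong suc e)))) (xor-identityʳ _)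
  step : ∀ k → (∀ {l} → l < k → 4 ℕ.* l ℕ.+ 2 < M → H (4 ℕ.* l ℕ.+ 2) ≡ false) → 4 ℕ.* k ℕ.+ 2 < M → H (4 ℕ.* k ℕ.+ 2) ≡ false
  step k rec k<M = trans (sym (split (4 ℕ.* k ℕ.+ 2) zeros)) (prod k k<M)
    where
    zeros : ∀ i j → suc i ℕ.+ j ≡ 4 ℕ.* k ℕ.+ 2 → θ (suc i) ∧ H j ≡ false
    zeros i j e with θ (suc i) in θi
    ... | false = refl
    ... | true with supp (suc i) (ℕₚ.≤-<-trans (ℕₚ.≤-trans (ℕₚ.m≤m+n (suc i) j) (ℕₚ.≤-reflexive e)) k<M) θi
    ...   | suc l , f = let (m , m<k , g) = remove-multiple (suc i) j k e (l , f) in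
            trans (cong H g) (rec m<k (ℕₚ.≤-<-trans (ℕₚ.≤-trans (ℕₚ.≤-reflexive (sym g)) (ℕₚ.≤-trans (ℕₚ.m≤n+m j (suc i)) (ℕₚ.≤-reflexive e))) k<M))

parity-ℕ : ∀ n {x y} → Cnt (X (+ n)) x → Cnt (Y (+ n)) y → x ≡ y
parity-ℕ n = parity {+ n} {16 ℕ.* n ℕ.+ 10} {8 ℕ.* n ℕ.+ 4}
  (cong (_+ + 10) (ℤₚ.pos-* 16 n))
  (trans (cong +_ (sym (ℕₚ.+-suc (8 ℕ.* n) 4))) (cong (_+ + 5) (ℤₚ.pos-* 8 n)))
  (third (+ n))

module Coefficient (M : ℕ) (0<M : 0 < M) where
  open XiSeries M 0<M using (qA; gen-product)
  open Truncated M using (series)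
  open GenSum M using (θ; gen-θ)
  open CommutativeRing series using (distribˡ; *-comm)

  k≤w₂+ : ∀ k → k ≤ w₂ (+ k)
  k≤w₂+ k = ℕₚ.≤-trans (k≤w₁+ k) (ℕₚ.m≤m+n _ _)

  k≤w₂- : ∀ k → k ≤ w₂ -[1+ k ]
  k≤w₂- k = ℕₚ.≤-trans (k≤w₁- k) (ℕₚ.m≤m+n _ _)

  θ-0 : θ w₂ 0 ≡ true
  θ-0 = cnt-unique ℤ._≟_ (gen-θ w₂ k≤w₂+ k≤w₂- 0 0<M)
    (cnt-singleton (+ 0) refl (λ {κ} → zero-only κ))
    where
    zero-only : ∀ κ → w₂ κ ≡ 0 → κ ≡ + 0
    zero-only (+ zero)  e = refl
    zero-only +[1+ k ]  e = contradiction (ℕₚ.≤-trans (k≤w₂+ (suc k)) (ℕₚ.≤-reflexive e)) λ ()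
    zero-only -[1+ k ]  e = contradiction (ℕₚ.≤-trans (ℕₚ.≤-trans (k<w₁- k) (ℕₚ.m≤m+n _ _)) (ℕₚ.≤-reflexive e)) λ ()

  4∣w₂ : ∀ κ → Σ ℕ λ l → w₂ κ ≡ 4 ℕ.* l
  4∣w₂ (+ k)    = 3 ℕ.* (Tri k ℕ.+ k ℕ.* k) , id₁ (Tri k ℕ.+ k ℕ.* k)
    where
    id₁ : ∀ z → 6 ℕ.* z ℕ.+ 6 ℕ.* z ≡ 4 ℕ.* (3 ℕ.* z)
    id₁ = ℕ-Solver.solve-∀
  4∣w₂ -[1+ k ] = 3 ℕ.* (Tri k ℕ.+ suc k ℕ.* suc k) , id₁ (Tri k ℕ.+ suc k ℕ.* suc k)
    where
    id₁ : ∀ z → 6 ℕ.* z ℕ.+ 6 ℕ.* z ≡ 4 ℕ.* (3 ℕ.* z)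
    id₁ = ℕ-Solver.solve-∀

  θ-support : ∀ m → m < M → θ w₂ m ≡ true → Σ ℕ λ l → m ≡ 4 ℕ.* l
  θ-support m m<M e with 4 ∣? m
  ... | yes (divides l f) = l , trans f (ℕₚ.*-comm l 4)
  ... | no 4∤m = contradiction (trans (sym e) (cnt-unique ℤ._≟_ (gen-θ w₂ k≤w₂+ k≤w₂- m m<M)
          (cnt-empty λ κ f → 4∤m (divides (proj₁ (4∣w₂ κ)) (trans (sym f) (trans (proj₂ (4∣w₂ κ)) (ℕₚ.*-comm 4 (proj₁ (4∣w₂ κ))))))))) λ ()

  products-agree : ∀ k → 4 ℕ.* k ℕ.+ 2 < M → (qA · θ w₂) (4 ℕ.* k ℕ.+ 2) ≡ (θ wB · θ w₂) (4 ℕ.* k ℕ.+ 2)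
  products-agree k k<M = parity-ℕ k (cnt-X k (gen-product _ k<M))
    (cnt-Y′ k (gen-· ℤ._≟_ (gen-θ wB k≤wB+ k≤wB-) (gen-θ w₂ k≤w₂+ k≤w₂-) _ k<M))

  qA≡θ : ∀ k → 4 ℕ.* k ℕ.+ 2 < M → qA (4 ℕ.* k ℕ.+ 2) ≡ θ wB (4 ℕ.* k ℕ.+ 2)
  qA≡θ k k<M = xor-false _ (cancel-θ (θ w₂) (qA ⊕ θ wB) M θ-0 θ-support (λ i i<M → begin
    (θ w₂ · (qA ⊕ θ wB)) (4 ℕ.* i ℕ.+ 2)
      ≡⟨ distribˡ (θ w₂) qA (θ wB) _ i<M ⟩
    (θ w₂ · qA) (4 ℕ.* i ℕ.+ 2) xor (θ w₂ · θ wB) (4 ℕ.* i ℕ.+ 2)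
      ≡⟨ cong₂ _xor_ (*-comm (θ w₂) qA _ i<M) (*-comm (θ w₂) (θ wB) _ i<M) ⟩
    (qA · θ w₂) (4 ℕ.* i ℕ.+ 2) xor (θ wB · θ w₂) (4 ℕ.* i ℕ.+ 2)
      ≡⟨ cong (_xor (θ wB · θ w₂) (4 ℕ.* i ℕ.+ 2)) (products-agree i i<M) ⟩
    (θ wB · θ w₂) (4 ℕ.* i ℕ.+ 2) xor (θ wB · θ w₂) (4 ℕ.* i ℕ.+ 2)
      ≡⟨ xor-same ((θ wB · θ w₂) (4 ℕ.* i ℕ.+ 2)) ⟩
    false ∎) k k<M)
    where open ≡-Reasoning

-- From the parity of S to residues modulo 4

ξ-sum : ℕ → ℤ
ξ-sum m = sumBelow (suc m) (λ i → xiTerm (suc i) m)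

ξ-sum-odd : ∀ n → Cnt (λ μ → wB μ ≡ 4 ℕ.* n ℕ.+ 2) (oddℤ (ξ-sum (4 ℕ.* n ℕ.+ 2)))
ξ-sum-odd n = cnt-subst (sym (trans (XiSeries.qA-coefficient M (s≤s z≤n) m (ℕₚ.n<1+n m)) (Coefficient.qA≡θ M (s≤s z≤n) n (ℕₚ.n<1+n m))))
  (GenSum.gen-θ M wB k≤wB+ k≤wB- m (ℕₚ.n<1+n m))
  where
  m = 4 ℕ.* n ℕ.+ 2
  M = suc m

-- In (a - b)(a + b) = 0 the second factor is 2 modulo 6 and so nonzero. Hence each exponent occurs
-- at most once, and the parity of the count decides whether it occurs.
wB-injective : ∀ μ μ′ → wB μ ≡ wB μ′ → μ ≡ μ′
wB-injective μ μ′ e = [ (λ d → ℤₚ.i-j≡0⇒i≡j μ μ′ (ℤₚ.*-cancelˡ-≡ (+ 6) (μ - μ′) (+ 0) (trans (id₂ μ μ′) d)))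
                      , (λ d → ⊥-elim (nonzero d)) ]′
  (ℤₚ.i*j≡0⇒i≡0∨j≡0 (a - b) (trans (id₁ a b) (ℤₚ.i≡j⇒i-j≡0 (2*-cancel (trans (sym (wB-square μ)) (trans (cong +_ e) (wB-square μ′)))))))
  where
  a = + 6 * μ + + 1
  b = + 6 * μ′ + + 1
  nonzero : + 6 * μ + + 1 + (+ 6 * μ′ + + 1) ≢ + 0
  nonzero e = clash 6 2 (- μ - μ′) (- (+ 1)) e (solve (μ ∷ μ′ ∷ []))
  id₁ : ∀ a b → (a - b) * (a + b) ≡ a * a - b * b
  id₁ = ℤ-Solver.solve-∀
  id₂ : ∀ μ μ′ → + 6 * (μ - μ′) ≡ + 6 * μ + + 1 - (+ 6 * μ′ + + 1)
  id₂ = ℤ-Solver.solve-∀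

-- The theta series runs over 6μ + 1, the statement over 6k - 1; hence μ = -k.
wB-index : ∀ n k → + n ≡ + 6 * k * (+ 3 * k - + 1) → wB (- k) ≡ 4 ℕ.* n ℕ.+ 2
wB-index n k e = ℤₚ.+-injective (trans (wB-square (- k)) (sym (trans (cong (_+ + 2) (ℤₚ.pos-* 4 n)) (go (+ n) e))))
  where
  go : ∀ n → n ≡ + 6 * k * (+ 3 * k - + 1) → + 4 * n + + 2 ≡ + 2 * ((+ 6 * - k + + 1) * (+ 6 * - k + + 1))
  go n e = linear (+ 4) e (solve (n ∷ k ∷ []))

index-wB : ∀ n μ → wB μ ≡ 4 ℕ.* n ℕ.+ 2 → + n ≡ + 6 * (- μ) * (+ 3 * (- μ) - + 1)
index-wB n μ e = go (+ n) (trans (sym (wB-square μ)) (trans (cong +_ e) (cong (_+ + 2) (ℤₚ.pos-* 4 n))))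
  where
  go : ∀ n → + 2 * ((+ 6 * μ + + 1) * (+ 6 * μ + + 1)) ≡ + 4 * n + + 2 → n ≡ + 6 * (- μ) * (+ 3 * (- μ) - + 1)
  go n e = ℤₚ.*-cancelˡ-≡ (+ 4) n _ (linear (- (+ 1)) e (solve (n ∷ μ ∷ [])))

half-odd : ∀ {x} → oddℤ x ≡ true → Σ ℤ λ t → x ≡ + 2 * t + + 1
half-odd {x} o = go (half x)
  where
  go : Half x → Σ ℤ λ t → x ≡ + 2 * t + + 1
  go (inj₁ (t , refl)) = contradiction (trans (sym o) (oddℤ-* (+ 2) t)) λ ()
  go (inj₂ h) = h

half-even : ∀ {x} → oddℤ x ≡ false → Σ ℤ λ t → x ≡ + 2 * t
half-even {x} o = go (half x)
  where
  go : Half x → Σ ℤ λ t → x ≡ + 2 * t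
  go (inj₁ h) = h
  go (inj₂ (t , refl)) = contradiction (trans (sym (trans (oddℤ-+ (+ 2 * t) (+ 1)) (cong (_xor true) (oddℤ-* (+ 2) t)))) o) λ ()

-- Oddness is all that counts, because twice an odd number is 2 modulo 4 whatever its sign.
neg1^-odd : ∀ j → Σ ℤ λ u → neg1^ j ≡ + 2 * u + + 1
neg1^-odd zero    = + 0 , refl
neg1^-odd (suc j) = go (neg1^-odd j)
  where
  go : (Σ ℤ λ u → neg1^ j ≡ + 2 * u + + 1) → Σ ℤ λ u → - neg1^ j ≡ + 2 * u + + 1
  go (u , e) = - u - + 1 , trans (cong -_ e) (id₁ u)
    where
    id₁ : ∀ u → - (+ 2 * u + + 1) ≡ + 2 * (- u - + 1) + + 1
    id₁ = ℤ-Solver.solve-∀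

one-+2 : ∀ m → one (m ℕ.+ 2) ≡ + 0
one-+2 zero    = refl
one-+2 (suc m) = refl

pξ≡ : ∀ n → pξ (4 ℕ.* n ℕ.+ 2) ≡ + 2 * ξ-sum (4 ℕ.* n ℕ.+ 2)
pξ≡ n = trans (cong (_+ + 2 * ξ-sum (4 ℕ.* n ℕ.+ 2)) (one-+2 (4 ℕ.* n))) (ℤₚ.+-identityˡ _)

4∣ : ∀ {x} q → x ≡ q * + 4 → + 4 ∣ x
4∣ q e = ℤ∣.∣⇒∣ᵤ (ℤ∣.divides q e)

theorem4p5 : (n : ℕ) →
    ((k : ℤ) → + n ≡ + 6 * k * (+ 3 * k - + 1) →
    (+ 4) ∣ (pξ (4 Data.Nat.* n Data.Nat.+ 2) - + 2 * neg1^ ∣ k ∣))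
    × ((¬ ∃ λ (k : ℤ) → + n ≡ + 6 * k * (+ 3 * k - + 1)) →
    (+ 4) ∣ pξ (4 Data.Nat.* n Data.Nat.+ 2))
theorem4p5 n = pentagonal , otherwise
  where
  S = ξ-sum (4 ℕ.* n ℕ.+ 2)
  odd-case : (Σ ℤ λ t → S ≡ + 2 * t + + 1) → ∀ {x} → (Σ ℤ λ u → x ≡ + 2 * u + + 1) → (+ 4) ∣ (pξ (4 ℕ.* n ℕ.+ 2) - + 2 * x)
  odd-case (t , e) (u , refl) = 4∣ (t - u) (trans (cong (_- + 2 * (+ 2 * u + + 1)) (trans (pξ≡ n) (cong (+ 2 *_) e))) (id₁ t u))
    where
    id₁ : ∀ t u → + 2 * (+ 2 * t + + 1) - + 2 * (+ 2 * u + + 1) ≡ (t - u) * + 4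
    id₁ = ℤ-Solver.solve-∀
  even-case : (Σ ℤ λ t → S ≡ + 2 * t) → + 4 ∣ pξ (4 ℕ.* n ℕ.+ 2)
  even-case (t , e) = 4∣ t (trans (pξ≡ n) (trans (cong (+ 2 *_) e) (id₁ t)))
    where
    id₁ : ∀ t → + 2 * (+ 2 * t) ≡ t * + 4
    id₁ = ℤ-Solver.solve-∀
  pentagonal : (k : ℤ) → + n ≡ + 6 * k * (+ 3 * k - + 1) → (+ 4) ∣ (pξ (4 ℕ.* n ℕ.+ 2) - + 2 * neg1^ ∣ k ∣)
  pentagonal k e = odd-case (half-odd (cnt-unique ℤ._≟_ (ξ-sum-odd n)
    (cnt-singleton (- k) (wB-index n k e) (λ {μ} f → wB-injective μ (- k) (trans f (sym (wB-index n k e))))))) (neg1^-odd ∣ k ∣)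
  otherwise : (¬ ∃ λ (k : ℤ) → + n ≡ + 6 * k * (+ 3 * k - + 1)) → + 4 ∣ pξ (4 ℕ.* n ℕ.+ 2)
  otherwise ¬k = even-case (half-even (cnt-unique ℤ._≟_ (ξ-sum-odd n) (cnt-empty λ μ e → ¬k (- μ , index-wB n μ e))))
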